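{- There exists an infinite family of maximal planar graphs such that every graph $G$ in the family satisfies $\mathrm{sat}_{\mathcal{P}}(G)\le \frac{v(G)+82}{3}$.
   Context: All graphs are finite, undirected and simple; $v(G)$ and $e(G)$ denote the numbers of vertices and edges of $G$. A plane graph is a planar graph together with a fixed crossing-free embedding in the plane. A plane graph $H$ with $v(H)=v(G)$ that is isomorphic to a subgraph of $G$ is a plane-saturated subgraph of $G$ if for every pair of non-adjacent vertices $x,y$ of $H$, adding the edge $xy$ either cannot be done without violating planarity of the given embedding of $H$ (i.e. $x,y$ do not lie on a common face), or the resulting graph $H+xy$ is not isomorphic to a subgraph of $G$. The plane-saturation number $\mathrm{sat}_{\mathcal{P}}(G)$ is the minimum of $e(H)$ over all plane-saturated subgraphs $H$ of $G$. -}

module Defs where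

open import Data.Bool.Base using (Bool; true; false; _∧_; _∨_; if_then_else_; T)
open import Data.Bool.Properties using (∧-comm; ∨-comm; ∧-zeroʳ)
open import Data.Fin.Base using (Fin; toℕ)
open import Data.Fin.Properties using (_≟_)
open import Data.Nat.Base using (ℕ; _+_; _≤_; _<ᵇ_)
open import Data.Nat.Properties using (+-0-commutativeMonoid)
open import Data.Product.Base using (Σ-syntax; ∃-syntax; _×_; _,_)
open import Data.Sum.Base using (_⊎_; inj₁; inj₂)
open import Function.Base using (_∘_)
open import Function.Bundles using (_↔_; _⇔_; Inverse)
open import Function.Definitions using (Injective; Surjective)
open import Relation.Binary.Construct.Closure.Equivalence using (EqClosure)
open import Relation.Binary.Construct.Closure.ReflexiveTransitive using (Star)
open import Relation.Binary.PropositionalEquality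
  using (_≡_; _≢_; refl; sym; trans; cong; cong₂)
open import Relation.Nullary using (¬_; yes; no; contradiction)
open import Relation.Nullary.Decidable using (⌊_⌋)

open import Algebra.Properties.CommutativeMonoid.Sum +-0-commutativeMonoid
  using (sum-syntax)

record Graph : Set where
  field
    v          : ℕ
    adj        : Fin v → Fin v → Bool
    adj-sym    : ∀ x y → adj x y ≡ adj y x
    adj-irrefl : ∀ x → adj x x ≡ false

  V : Set
  V = Fin v

  _~_ : V → V → Set
  x ~ y = T (adj x y)

  e : ℕ
  e = ∑[ x < v ] ∑[ y < v ]
        (if (toℕ x <ᵇ toℕ y) ∧ adj x y then 1 else 0)

open Graph using (v; e)

_≅_ : Graph → Graph → Set
G ≅ H = Σ[ f ∈ (Fin (v G) ↔ Fin (v H)) ]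
          (∀ x y → Graph.adj G x y ≡ Graph.adj H (Inverse.to f x) (Inverse.to f y))

-- H is isomorphic to a (not necessarily induced) subgraph of G.
_⊑_ : Graph → Graph → Set
H ⊑ G = Σ[ f ∈ (Fin (v H) → Fin (v G)) ]
          Injective _≡_ _≡_ f × (∀ {x y} → Graph._~_ H x y → Graph._~_ G (f x) (f y))

module _ (G : Graph) where
  open Graph G using (V; adj; adj-sym; adj-irrefl)

  addEdge : (x y : V) → x ≢ y → Graph
  addEdge x y x≢y = record
    { v          = v G
    ; adj        = λ u w → adj u w ∨ (is x u ∧ is y w ∨ is y u ∧ is x w)
    ; adj-sym    = λ u w → cong₂ _∨_ (adj-sym u w)
        (trans (∨-comm (is x u ∧ is y w) _)
               (cong₂ _∨_ (∧-comm (is y u) _) (∧-comm (is x u) _)))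
    ; adj-irrefl = λ u → cong₂ _∨_ (adj-irrefl u)
        (cong₂ _∨_ (disjoint u) (trans (∧-comm (is y u) _) (disjoint u)))
    }
    where
    is : V → V → Bool
    is z u = ⌊ z ≟ u ⌋

    disjoint : ∀ u → is x u ∧ is y u ≡ false
    disjoint u with x ≟ u | y ≟ u
    ... | no  _    | _        = refl
    ... | yes _    | no  _    = refl
    ... | yes refl | yes refl = contradiction refl x≢y

-- Crossing-free embeddings are encoded combinatorially, as in the theory of
-- combinatorial maps, but allowing disconnected graphs.  The data are the
-- clockwise order of the edges at every vertex and, for every side of every
-- edge, the face lying there.  A disconnected graph is not determined by the
-- rotations alone: one face may be bounded by closed walks in several
-- components, which is why the faces are part of the data.
record FaceStructure (G : Graph) : Set where
  open Graph G using (V; _~_)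
  field
    -- For x ~ y, the neighbour of x following y in the clockwise order around
    -- x.  As every neighbour is reachable from every other one, next x
    -- permutes the neighbours of x in a single cycle.  Values at non-adjacent
    -- pairs carry no meaning.
    next       : V → V → V
    next-~     : ∀ {x y} → x ~ y → x ~ next x y
    next-cycle : ∀ {x y z} → x ~ y → x ~ z → Star (λ a b → next x a ≡ b) y z

    f : ℕ

    -- For x ~ y, the face to the left of the edge xy traversed from x to y.
    -- The boundary walk of that face continues from y to next y x.  Again,
    -- values at non-adjacent pairs carry no meaning.
    left      : V → V → Fin f
    left-walk : ∀ {x y} → x ~ y → left x y ≡ left y (next y x)

    -- For an isolated vertex, the only face having it on its boundary; the
    -- value at other vertices carries no meaning.
    around : V → Fin f

  -- x is on the boundary of φ.
  _LiesOn_ : V → Fin f → Set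
  x LiesOn φ = (∃[ y ] x ~ y × left x y ≡ φ) ⊎ ((∀ y → ¬ x ~ y) × around x ≡ φ)

  data Incident : V ⊎ Fin f → V ⊎ Fin f → Set where
    edge   : ∀ {x y} → x ~ y      → Incident (inj₁ x) (inj₁ y)
    corner : ∀ {x φ} → x LiesOn φ → Incident (inj₁ x) (inj₂ φ)

  OnCommonFace : V → V → Set
  OnCommonFace x y = ∃[ φ ] x LiesOn φ × y LiesOn φ

-- Such data come from an embedding in the plane exactly when every component
-- has genus 0 and the bipartite graph whose nodes are the components and the
-- faces, with one edge for each boundary walk, is a tree.  Given that this
-- bipartite graph is connected (the field "connected"), this is equivalent to
-- Euler's formula v - e + f = 1 + c (the field "euler"): a connected bipartite
-- graph on c + f nodes has at least c + f - 1 edges, and the number of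
-- boundary walks is 2 c - v + e minus twice the total genus.
--
-- The choice of the unbounded face is not recorded, as nothing depends on it.
record PlaneEmbedding (G : Graph) : Set where
  open Graph G using (V; _~_)
  field
    faces : FaceStructure G

  open FaceStructure faces public

  field
    connected : ∀ p q → EqClosure Incident p q

    c              : ℕ
    component      : V → Fin c
    component-onto : Surjective _≡_ _≡_ component
    component-≡    : ∀ x y → component x ≡ component y ⇔ Star _~_ x y

    euler : v G + f ≡ 1 + e G + c

record PlaneGraph : Set where
  field
    graph     : Graph
    embedding : PlaneEmbedding graph

  open Graph graph public
  open PlaneEmbedding embedding public using (OnCommonFace)

Planar : Graph → Set
Planar = PlaneEmbedding

MaximalPlanar : Graph → Set
MaximalPlanar G =
  Planar G × (∀ x y (x≢y : x ≢ y) → ¬ x ~ y → ¬ Planar (addEdge G x y x≢y))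
  where open Graph G using (_~_)

record PlaneSaturated (H : PlaneGraph) (G : Graph) : Set where
  open PlaneGraph H using (graph; _~_; OnCommonFace)
  field
    spanning  : v graph ≡ v G
    subgraph  : graph ⊑ G
    saturated : ∀ x y (x≢y : x ≢ y) → ¬ x ~ y →
                ¬ OnCommonFace x y ⊎ ¬ (addEdge graph x y x≢y ⊑ G)

-- sat_P(G) = m
record IsPlaneSaturationNumber (G : Graph) (m : ℕ) : Set where
  field
    attained : Σ[ H ∈ PlaneGraph ] PlaneSaturated H G × PlaneGraph.e H ≡ m
    minimal  : ∀ H → PlaneSaturated H G → m ≤ PlaneGraph.e H

{-# OPTIONS --safe #-}

{-
Close a long cylinder of concentric four-cycles, the rings, to a triangulation
T: at the top by a wheel with four spokes around a hub h, at the bottom by a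
patch containing four disjoint wheels with four spokes.  The graph G arises by
stacking a vertex into every face of T but 18; the stacked vertices are
independent and make up about two thirds of G.

The subgraph H consists of the five wheels, of four columns running straight
down the cylinder from the rim of the top wheel to the four bottom wheels, of
one further edge at the top, and of the stacked vertices, now isolated.  Its
drawing is not inherited from G: each column with its bottom wheel lies in a
face of the top wheel of its own, and the isolated vertices lie in the fifth
face of the top wheel, at whose corners no vertices are stacked in G.

G contains no wheels with four spokes but these five.  Hence a copy of H in G
maps wheels to wheels; the top wheel stays in place, since otherwise a column
could not leave the bottom; and the columns, being as long as the distance
between the two ends, descend by one ring in every step.  So T is mapped onto
itself and stacked vertices to stacked vertices, and levels are preserved.
Therefore no edge between two vertices on a common face of H can be added.

With k + 1 levels between top and bottom, H has 49 + 4 (k + 1) edges and G has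
65 + 12 (k + 1) vertices.  That the minimum exists is decided by a search over
all plane graphs of the given order, which are finitely many up to pointwise
equality.
-}

module Submission where

open import Defs
open import Data.Nat.Base using (ℕ; _+_; _*_; _≤_)
open import Data.Product.Base using (Σ-syntax; ∃-syntax; _×_)
open import Relation.Binary.PropositionalEquality using (_≡_)
open import Data.Bool.Base using (Bool; T; _∧_; _∨_; false; if_then_else_; not; true)
open import Data.Bool.ListAction using (all; any)
open import Data.Fin using (#_)
open import Data.Fin.Base using (Fin; _↑ʳ_; _↑ˡ_; fromℕ<; join; splitAt; suc; toℕ; zero)
open import Data.List.Base using (List; []; _∷_; allFin; length; map; null; upTo)
open import Data.List.Membership.Propositional using (_∈_)
open import Data.List.Membership.Propositional.Properties using (∈-allFin; ∈-map⁺; ∈-map⁻; ∈-upTo⁺; ∈-upTo⁻)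
open import Data.List.Relation.Unary.All using (All; []; _∷_; lookup)
open import Data.List.Relation.Unary.AllPairs using ([]; _∷_)
open import Data.List.Relation.Unary.Any using (here; there)
open import Data.List.Relation.Unary.Unique.Propositional using (Unique)
open import Data.Product.Base using (_,_; proj₁; proj₂; ∃)
open import Data.Sum.Base using ([_,_]′; _⊎_; inj₁; inj₂)
open import Data.Unit.Base using (tt)
open import Function.Base using (_∘_; case_of_; id)
open import Function.Bundles using (Equivalence; Inverse; _↔_; _⇔_; mk↔ₛ′; mk⇔)
open import Function.Definitions using (Injective; Surjective)
open import Relation.Binary.Construct.Closure.Equivalence using (EqClosure)
open import Relation.Binary.Construct.Closure.Symmetric using (SymClosure; bwd; fwd)
open import Relation.Binary.Definitions using (Decidable; tri<; tri>; tri≈)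
open import Relation.Nullary using (Dec; contradiction; no; yes; ¬_)
open import Relation.Nullary.Decidable using (_×-dec_; _→-dec_; _⊎-dec_; from-yes; map′; ¬?; ⌊_⌋)

-- Saturation quantifies over all embeddings of H + xy in G, while the drawing of H is free. In the
-- drawing inherited from G, vertices of equal level in consecutive columns would share a face, and
-- the ring edge between them could be added. Giving every column a face of its own leaves, among
-- non-isolated vertices, only pairs within a column and its wheel or with the top wheel. Most of
-- these are excluded by a potential `Λ`, twice the level plus a small weight: no edge of G changes
-- it by more than 2, and the two ends of a column differ by 2 per edge. So an embedding has no
-- slack and keeps `Λ` on all non-isolated vertices. `Λ` cannot separate the rim t of the top wheel
-- from the ring r around it; this is the purpose of the further edge t₃r₀. The parameter k enters
-- only through the number of middle levels. As top, middle and bottom are the only kinds of level,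
-- every local fact is a Boolean computed from finite tables, once for all k. A middle level adds 12
-- vertices to G and 4 edges to H, hence the ratio 1/3; and 82 = 3 · 49 - 65.

-- Finite sums, Euler's formula and the maximality of triangulations.

module Counting where

  open import Data.Fin.Properties using (_≟_; toℕ-injective; any?; injective⇒≤)
  open import Data.Nat.Base
  open import Data.Nat.Properties hiding (_≟_)
  open import Relation.Binary.Construct.Closure.ReflexiveTransitive using (Star; ε; _◅_)
  open import Relation.Binary.PropositionalEquality
  open import Algebra.Properties.CommutativeMonoid.Sum +-0-commutativeMonoid
    using (sum; sum-syntax; sum-cong-≗; ∑-distrib-+; ∑-comm; sum-replicate-zero; sum-permute)

  open ≤-Reasoning

  ⟦_⟧ : Bool → ℕ
  ⟦ b ⟧ = if b then 1 else 0

  T⇒true : ∀ {b} → T b → b ≡ true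
  T⇒true {true} _ = refl

  ¬T⇒false : ∀ {b} → ¬ T b → b ≡ false
  ¬T⇒false {false} _ = refl
  ¬T⇒false {true} ¬t = contradiction tt ¬t

  T-ext : ∀ {a b} → (T a → T b) → (T b → T a) → a ≡ b
  T-ext {true}  f g = sym (T⇒true (f tt))
  T-ext {false} f g = sym (¬T⇒false g)

  ⟦⟧≥1 : ∀ {b} → T b → 1 ≤ ⟦ b ⟧
  ⟦⟧≥1 {true} _ = ≤-refl

  sum-mono : ∀ {n} {f g : Fin n → ℕ} → (∀ x → f x ≤ g x) → sum f ≤ sum g
  sum-mono {zero}  f≤g = z≤n
  sum-mono {suc n} f≤g = +-mono-≤ (f≤g zero) (sum-mono (f≤g ∘ suc))

  sum-mono-< : ∀ {n} {f g : Fin n → ℕ} → (∀ x → f x ≤ g x) → ∀ z → f z < g z → sum f < sum g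
  sum-mono-< f≤g zero    lt = +-mono-<-≤ lt (sum-mono (f≤g ∘ suc))
  sum-mono-< f≤g (suc z) lt = +-mono-≤-< (f≤g zero) (sum-mono-< (f≤g ∘ suc) z lt)

  sum-zero : ∀ {n} {f : Fin n → ℕ} → (∀ x → f x ≡ 0) → sum f ≡ 0
  sum-zero {n} f≡0 = trans (sum-cong-≗ f≡0) (sum-replicate-zero n)

  sum-const : ∀ n c → ∑[ x < n ] c ≡ n * c
  sum-const zero    c = refl
  sum-const (suc n) c = cong (c +_) (sum-const n c)

  sum-δ : ∀ {n} (z : Fin n) → ∑[ y < n ] ⟦ ⌊ z ≟ y ⌋ ⟧ ≡ 1
  sum-δ {suc n} zero    = cong suc (sum-zero {n} (λ _ → refl))
  sum-δ {suc n} (suc z) = trans (sum-cong-≗ step) (sum-δ z)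
    where
    step : ∀ y → ⟦ ⌊ suc z ≟ suc y ⌋ ⟧ ≡ ⟦ ⌊ z ≟ y ⌋ ⟧
    step y with z ≟ y
    ... | yes _ = refl
    ... | no  _ = refl

  value≤sum : ∀ {n} (f : Fin n → ℕ) z → f z ≤ sum f
  value≤sum f zero    = m≤m+n _ _
  value≤sum f (suc z) = ≤-trans (value≤sum (f ∘ suc) z) (m≤n+m _ (f zero))

  3≤sum : ∀ {n} (f : Fin n → ℕ) {i j k} → i ≢ j → i ≢ k → j ≢ k →
          1 ≤ f i → 1 ≤ f j → 1 ≤ f k → 3 ≤ sum f
  3≤sum {n} f {i} {j} {k} i≢j i≢k j≢k fi fj fk = begin
    3                                ≡⟨ sym total ⟩
    ∑[ y < n ] (δ i y + (δ j y + δ k y)) ≤⟨ sum-mono bound ⟩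
    sum f                            ∎
    where
    δ : Fin n → Fin n → ℕ
    δ z y = ⟦ ⌊ z ≟ y ⌋ ⟧

    total : ∑[ y < n ] (δ i y + (δ j y + δ k y)) ≡ 3
    total = trans (∑-distrib-+ (δ i) _)
              (cong₂ _+_ (sum-δ i) (trans (∑-distrib-+ (δ j) (δ k)) (cong₂ _+_ (sum-δ j) (sum-δ k))))

    bound : ∀ y → δ i y + (δ j y + δ k y) ≤ f y
    bound y with i ≟ y | j ≟ y | k ≟ y
    ... | yes refl | yes q    | _        = contradiction (sym q) i≢j
    ... | yes refl | no _     | yes q    = contradiction (sym q) i≢k
    ... | yes refl | no _     | no _     = fi
    ... | no _     | yes refl | yes q    = contradiction (sym q) j≢k
    ... | no _     | yes refl | no _     = fj
    ... | no _     | no _     | yes refl = fk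
    ... | no _     | no _     | no _     = z≤n

  occurs : ∀ {n} → List (Fin n) → Fin n → Bool
  occurs []       y = false
  occurs (z ∷ zs) y = ⌊ z ≟ y ⌋ ∨ occurs zs y

  occurs⇒∈ : ∀ {n} (zs : List (Fin n)) {y} → T (occurs zs y) → y ∈ zs
  occurs⇒∈ (z ∷ zs) {y} t with z ≟ y
  ... | yes refl = here refl
  ... | no _     = there (occurs⇒∈ zs t)

  ∈⇒occurs : ∀ {n} {zs : List (Fin n)} {y} → y ∈ zs → T (occurs zs y)
  ∈⇒occurs {zs = z ∷ zs} {y} p with z ≟ y | p
  ... | yes _   | _       = tt
  ... | no z≢y  | here q  = contradiction (sym q) z≢y
  ... | no _    | there q = ∈⇒occurs q

  sum-occurs : ∀ {n} {zs : List (Fin n)} → Unique zs → ∑[ y < n ] ⟦ occurs zs y ⟧ ≡ length zs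
  sum-occurs {n} []                           = sum-zero {n} (λ _ → refl)
  sum-occurs {n} {z ∷ zs} (z∉ ∷ u) = trans (sum-cong-≗ split)
    (trans (∑-distrib-+ (λ y → ⟦ ⌊ z ≟ y ⌋ ⟧) _) (cong₂ _+_ (sum-δ z) (sum-occurs u)))
    where
    split : ∀ y → ⟦ ⌊ z ≟ y ⌋ ∨ occurs zs y ⟧ ≡ ⟦ ⌊ z ≟ y ⌋ ⟧ + ⟦ occurs zs y ⟧
    split y with z ≟ y
    ... | no  _ = refl
    ... | yes refl rewrite ¬T⇒false {occurs zs z} (λ t → lookup z∉ (occurs⇒∈ zs t) refl) = refl

  module _ (G : Graph) where
    open Graph G

    private
      lower upper arc : V → V → ℕ
      upper x y = if (toℕ x <ᵇ toℕ y) ∧ adj x y then 1 else 0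
      lower x y = upper y x
      arc x y = ⟦ adj x y ⟧

      split : ∀ x y → arc x y ≡ upper x y + lower x y
      split x y rewrite adj-sym y x with <-cmp (toℕ x) (toℕ y)
      ... | tri< x<y _ y≮x
        rewrite T⇒true (<⇒<ᵇ x<y) | ¬T⇒false {toℕ y <ᵇ toℕ x} (y≮x ∘ <ᵇ⇒< _ _) = sym (+-identityʳ _)
      ... | tri> x≮y _ y<x
        rewrite T⇒true (<⇒<ᵇ y<x) | ¬T⇒false {toℕ x <ᵇ toℕ y} (x≮y ∘ <ᵇ⇒< _ _) = refl
      ... | tri≈ x≮y x≡y _ with refl ← toℕ-injective x≡y
        rewrite adj-irrefl x | ¬T⇒false {toℕ x <ᵇ toℕ x} (x≮y ∘ <ᵇ⇒< _ _) = refl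

    handshake : ∑[ x < v ] ∑[ y < v ] ⟦ adj x y ⟧ ≡ e + e
    handshake = begin-equality
      ∑[ x < v ] ∑[ y < v ] arc x y
        ≡⟨ sum-cong-≗ (λ x → trans (sum-cong-≗ (split x)) (∑-distrib-+ (upper x) (lower x))) ⟩
      ∑[ x < v ] (∑[ y < v ] upper x y + ∑[ y < v ] lower x y)
        ≡⟨ ∑-distrib-+ {v} (λ x → ∑[ y < v ] upper x y) _ ⟩
      e + ∑[ x < v ] ∑[ y < v ] lower x y
        ≡⟨ cong (e +_) (∑-comm lower) ⟩
      e + e ∎

  -- Three consecutive corners of a boundary walk are distinct because no vertex is a leaf.
  module _ {G : Graph} (E : PlaneEmbedding G) where
    open Graph G
    open PlaneEmbedding E

    module _ (someNbr : ∀ x → ∃ λ y → x ~ y)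
             (otherNbr : ∀ {x y} → x ~ y → ∃ λ z → x ~ z × z ≢ y) (x₀ : V) where

      private
        ~-sym : ∀ {x y} → x ~ y → y ~ x
        ~-sym {x} {y} = subst T (adj-sym x y)

        ~-irrefl : ∀ {x y} → x ~ y → x ≢ y
        ~-irrefl {x} x~x refl = subst T (adj-irrefl x) x~x

        next-≢ : ∀ {x y} → x ~ y → next x y ≢ y
        next-≢ {x} {y} x~y fix with z , x~z , z≢y ← otherNbr x~y =
          z≢y (sym (stuck (next-cycle x~y x~z)))
          where
          stuck : ∀ {z} → Star (λ a b → next x a ≡ b) y z → y ≡ z
          stuck ε        = refl
          stuck (p ◅ ps) with refl ← trans (sym fix) p = stuck ps

        -- No `Incident` step starts at a face, so the path from `φ` to `x₀` begins with a corner
        -- traversed backwards; `someNbr` rules out that it is the corner of an isolated vertex.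
        dart : ∀ φ → ∃ λ x → ∃ λ y → x ~ y × left x y ≡ φ
        dart φ = first (connected (inj₂ φ) (inj₁ x₀))
          where
          open import Relation.Binary.Construct.Closure.Symmetric using (fwd; bwd)
          open import Relation.Binary.Construct.Closure.Equivalence using (EqClosure)
          first : ∀ {φ} → EqClosure Incident (inj₂ φ) (inj₁ x₀) → ∃ λ x → ∃ λ y → x ~ y × left x y ≡ φ
          first (bwd (corner (inj₁ (y , xy , l))) ◅ _) = _ , y , xy , l
          first (bwd (corner (inj₂ (iso , _))) ◅ _)    = contradiction (proj₂ (someNbr _)) (iso _)

        onFace : Fin f → V → V → ℕ
        onFace φ x y = ⟦ adj x y ∧ ⌊ left x y ≟ φ ⌋ ⟧

        onFace≥1 : ∀ {φ x y} → x ~ y → left x y ≡ φ → 1 ≤ ∑[ y < v ] onFace φ x y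
        onFace≥1 {φ} {x} {y} xy refl = ≤-trans (⟦⟧≥1 t) (value≤sum (onFace φ x) y)
          where
          t : T (adj x y ∧ ⌊ left x y ≟ left x y ⌋)
          t rewrite T⇒true xy with left x y ≟ left x y
          ... | yes _ = tt
          ... | no ¬p = ¬p refl

        length≥3 : ∀ φ → 3 ≤ ∑[ x < v ] ∑[ y < v ] onFace φ x y
        length≥3 φ with x , y , xy , l ← dart φ =
          -- The tails x, y, z of three consecutive directed edges of the boundary walk contribute
          -- one each.
          3≤sum (λ x → ∑[ y < v ] onFace φ x y) (~-irrefl xy) (λ p → next-≢ yx (sym p)) (~-irrefl yz)
            (onFace≥1 xy l) (onFace≥1 yz (trans (sym (left-walk xy)) l))
            (onFace≥1 (next-~ (~-sym yz)) (trans (sym (left-walk yz)) (trans (sym (left-walk xy)) l)))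
          where
          yx = ~-sym xy
          yz = next-~ yx

      -- Double counting: each of the 2e directed edges has exactly one face on its left, and each
      -- face is on the left of at least three.
      3f≤2e : f * 3 ≤ e + e
      3f≤2e = begin
        f * 3                                                 ≡⟨ sym (sum-const f 3) ⟩
        ∑[ φ < f ] 3                                          ≤⟨ sum-mono length≥3 ⟩
        ∑[ φ < f ] ∑[ x < v ] ∑[ y < v ] onFace φ x y
          ≡⟨ ∑-comm (λ φ x → ∑[ y < v ] onFace φ x y) ⟩
        ∑[ x < v ] ∑[ φ < f ] ∑[ y < v ] onFace φ x y
          ≡⟨ sum-cong-≗ {v} (λ x → ∑-comm (λ φ y → onFace φ x y)) ⟩
        ∑[ x < v ] ∑[ y < v ] ∑[ φ < f ] onFace φ x y
          ≡⟨ sum-cong-≗ {v} (λ x → sum-cong-≗ {v} (λ y → one x y)) ⟩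
        ∑[ x < v ] ∑[ y < v ] ⟦ adj x y ⟧                     ≡⟨ handshake G ⟩
        e + e                                                 ∎
        where
        one : ∀ x y → ∑[ φ < f ] onFace φ x y ≡ ⟦ adj x y ⟧
        one x y with adj x y
        ... | false = sum-zero {f} (λ _ → refl)
        ... | true  = sum-δ (left x y)

      -- Three times Euler's formula together with `3f≤2e` gives e + 3 + 3c ≤ 3v, and c is at least
      -- 1. The term e + e + 3c is added to both sides and cancelled, which avoids subtraction.
      e+6≤3v : e + 6 ≤ 3 * v
      e+6≤3v = +-cancelʳ-≤ (e + e + 3 * c) _ _ (begin
        e + 6 + (e + e + 3 * c)        ≤⟨ bound ⟩
        3 + 3 * e + 3 * c + 3 * c        ≡⟨ eq₁ e c ⟩
        3 * (1 + e + c) + 3 * c        ≡⟨ cong (λ w → 3 * w + 3 * c) (sym euler) ⟩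
        3 * (v + f) + 3 * c            ≡⟨ eq₂ v f c ⟩
        3 * v + (f * 3 + 3 * c)        ≤⟨ +-monoʳ-≤ (3 * v) (+-monoˡ-≤ (3 * c) 3f≤2e) ⟩
        3 * v + (e + e + 3 * c)        ∎)
        where
        open import Data.Nat.Solver using (module +-*-Solver)
        open +-*-Solver
        1≤c : 1 ≤ c
        1≤c with component x₀
        ... | zero  = s≤s z≤n
        ... | suc _ = s≤s z≤n
        eq₁ : ∀ e c → 3 + 3 * e + 3 * c + 3 * c ≡ 3 * (1 + e + c) + 3 * c
        eq₁ = solve 2 (λ e c → con 3 :+ con 3 :* e :+ con 3 :* c :+ con 3 :* c := con 3 :*
          (con 1 :+ e :+ c) :+ con 3 :* c) refl
        eq₂ : ∀ v f c → 3 * (v + f) + 3 * c ≡ 3 * v + (f * 3 + 3 * c)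
        eq₂ = solve 3 (λ v f c → con 3 :* (v :+ f) :+ con 3 :* c := con 3 :* v :+
          (f :* con 3 :+ con 3 :* c)) refl
        bound : e + 6 + (e + e + 3 * c) ≤ 3 + 3 * e + 3 * c + 3 * c
        bound = begin
          e + 6 + (e + e + 3 * c)
            ≡⟨ solve 2 (λ e c → e :+ con 6 :+ (e :+ e :+ con 3 :* c) := con 3 :+ con 3 :* e :+ con 3
            :* c :+ con 3 :* con 1) refl e c ⟩
          3 + 3 * e + 3 * c + 3 * 1 ≤⟨ +-monoʳ-≤ (3 + 3 * e + 3 * c) (*-monoʳ-≤ 3 1≤c) ⟩
          3 + 3 * e + 3 * c + 3 * c ∎

  module _ (G : Graph) {x y : Graph.V G} (x≢y : x ≢ y) (x≁y : ¬ Graph._~_ G x y) where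
    open Graph G

    private
      G⁺ = addEdge G x y x≢y

      upper : (V → V → Bool) → V → V → ℕ
      upper a u w = if (toℕ u <ᵇ toℕ w) ∧ a u w then 1 else 0

      upper-mono : ∀ u w → upper adj u w ≤ upper (Graph.adj G⁺) u w
      upper-mono u w with toℕ u <ᵇ toℕ w | adj u w
      ... | false | _     = z≤n
      ... | true  | false = z≤n
      ... | true  | true  = ≤-refl

      at : ∀ {a b} → toℕ a < toℕ b → ¬ a ~ b → T (Graph.adj G⁺ a b) → e < Graph.e G⁺
      at {a} {b} a<b a≁b a~⁺b = sum-mono-< (λ u → sum-mono (upper-mono u)) a
        (sum-mono-< (upper-mono a) b lt)
        where
        lt : upper adj a b < upper (Graph.adj G⁺) a b
        lt rewrite T⇒true (<⇒<ᵇ a<b) | T⇒true a~⁺b | ¬T⇒false a≁b = ≤-refl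

    addEdge-new : Graph._~_ G⁺ x y
    addEdge-new with adj x y | x ≟ x | y ≟ y
    ... | true  | _     | _     = tt
    ... | false | yes _ | yes _ = tt
    ... | false | no p  | _     = contradiction refl p
    ... | false | yes _ | no p  = contradiction refl p

    addEdge-old : ∀ {u w} → u ~ w → Graph._~_ G⁺ u w
    addEdge-old {u} {w} uw with adj u w
    ... | true = tt

    e-addEdge : e < Graph.e G⁺
    e-addEdge with <-cmp (toℕ x) (toℕ y)
    ... | tri< x<y _ _ = at x<y x≁y addEdge-new
    ... | tri≈ _ x≡y _ = contradiction (toℕ-injective x≡y) x≢y
    ... | tri> _ _ y<x = at y<x (x≁y ∘ subst T (adj-sym y x))
                            (subst T (Graph.adj-sym G⁺ x y) addEdge-new)

  -- If f maps P into itself then also the complement, because f is a permutation.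
  module _ {n} (f : Fin n → Fin n) (f-inj : Injective _≡_ _≡_ f) where

    -- Pigeonhole: if `y` were missed, sending one extra element to `y` would extend `f` to an
    -- injection of `Fin (suc n)` into `Fin n`.
    injective⇒onto : ∀ y → ∃ λ x → f x ≡ y
    injective⇒onto y with any? (λ x → f x ≟ y)
    ... | yes p = p
    ... | no ¬p = contradiction (injective⇒≤ {f = g} g-inj) (<⇒≱ ≤-refl)
      where
      g : Fin (suc n) → Fin n
      g zero    = y
      g (suc x) = f x
      g-inj : Injective _≡_ _≡_ g
      g-inj {zero}  {zero}  _ = refl
      g-inj {zero}  {suc b} p = contradiction (b , sym p) ¬p
      g-inj {suc a} {zero}  p = contradiction (a , p) ¬p
      g-inj {suc a} {suc b} p = cong suc (f-inj p)

    invariant⁻ : (P : Fin n → Bool) → (∀ {x} → T (P x) → T (P (f x))) → ∀ {x} → T (P (f x)) → T (P x)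
    invariant⁻ P P⇒ {z} t with P z in eq
    ... | true  = tt
    -- Otherwise `P ∘ f` would hold wherever `P` does and also at `z`, although a permutation does
    -- not change how often `P` holds.
    ... | false = contradiction (trans (sum-permute (⟦_⟧ ∘ P) π) refl) (<⇒≢ lt)
      where
      π = mk↔ₛ′ f (proj₁ ∘ injective⇒onto) (proj₂ ∘ injective⇒onto)
        (λ x → f-inj (proj₂ (injective⇒onto (f x))))
      le : ∀ x → ⟦ P x ⟧ ≤ ⟦ P (f x) ⟧
      le x with P x in p
      ... | false = z≤n
      ... | true  = ⟦⟧≥1 (P⇒ (subst T (sym p) tt))
      lt : ∑[ x < n ] ⟦ P x ⟧ < ∑[ x < n ] ⟦ P (f x) ⟧
      lt = sum-mono-< le z (subst (λ b → ⟦ b ⟧ < ⟦ P (f z) ⟧) (sym eq) (⟦⟧≥1 t))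

  module _ {G : Graph} where
    open Graph G

    -- One more edge would violate `e+6≤3v`. That bound applies to the enlarged graph because two
    -- neighbours per vertex survive the addition of an edge.
    triangulation⇒maximal : PlaneEmbedding G → V → e + 6 ≡ 3 * v →
                            (∀ x → ∃ λ y → ∃ λ z → x ~ y × x ~ z × y ≢ z) → MaximalPlanar G
    triangulation⇒maximal E x₀ e+6≡3v two = E , λ x y x≢y x≁y E⁺ →
      <⇒≱ (+-monoˡ-< 6 (e-addEdge G x≢y x≁y))
          (≤-trans (e+6≤3v E⁺ (some x≢y x≁y) (other x≢y x≁y) x₀) (≤-reflexive (sym e+6≡3v)))
      where
      module _ {x y} (x≢y : x ≢ y) (x≁y : ¬ x ~ y) where
        open Graph (addEdge G x y x≢y) using () renaming (_~_ to _~⁺_)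

        some : ∀ u → ∃ λ w → u ~⁺ w
        some u = let w , _ , uw , _ = two u in w , addEdge-old G x≢y x≁y uw

        other : ∀ {u w} → u ~⁺ w → ∃ λ w′ → u ~⁺ w′ × w′ ≢ w
        other {u} {w} _ = let w₁ , w₂ , uw₁ , uw₂ , w₁≢w₂ = two u in
          case w₁ ≟ w of λ where
            (yes refl) → w₂ , addEdge-old G x≢y x≁y uw₂ , w₁≢w₂ ∘ sym
            (no w₁≢w)  → w₁ , addEdge-old G x≢y x≁y uw₁ , w₁≢w

-- Existence of the minimum: exhaustive search over plane graphs.

module Search where

  open import Data.Bool.Properties using (T?) renaming (_≟_ to _≟ᵇ_)
  open import Data.Fin.Properties using (_≟_; any?; all?; toℕ-fromℕ<; toℕ<n; toℕ-injective; +↔⊎; injective⇒≤)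
  open import Data.Nat.Base
  import Data.Nat.Properties as ℕ
  open import Data.Nat.Properties using (≤-trans; ≤-refl; <-cmp; ≤-reflexive; m≤n+m; +-0-commutativeMonoid)
  open import Data.Vec.Functional using () renaming (_∷_ to _∷ᶠ_)
  import Relation.Binary.Construct.Closure.Equivalence as EqC
  open import Relation.Binary.Construct.Closure.ReflexiveTransitive as Star using (Star; ε; _◅_; _◅◅_)
  open import Relation.Binary.PropositionalEquality
  open import Algebra.Properties.CommutativeMonoid.Sum +-0-commutativeMonoid using (sum-cong-≗)

  -- Warshall's closure: only intermediate points below k are allowed.
  module _ {n : ℕ} {R : Fin n → Fin n → Set} (R? : Decidable R) where

    private
      Reach : ∀ k → k ≤ n → Fin n → Fin n → Set
      Reach zero    _   x y = x ≡ y ⊎ R x y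
      Reach (suc k) k<n x y = Reach k (ℕ.<⇒≤ k<n) x y ⊎
        (Reach k (ℕ.<⇒≤ k<n) x (fromℕ< k<n) × Reach k (ℕ.<⇒≤ k<n) (fromℕ< k<n) y)

      reach? : ∀ k k≤n → Decidable (Reach k k≤n)
      reach? zero    _   x y = (x ≟ y) ⊎-dec R? x y
      reach? (suc k) k<n x y = reach? k _ x y ⊎-dec (reach? k _ x _ ×-dec reach? k _ _ y)

      reach-base : ∀ k k≤n {x y} → x ≡ y ⊎ R x y → Reach k k≤n x y
      reach-base zero    _   r = r
      reach-base (suc k) k<n r = inj₁ (reach-base k _ r)

      reach-star : ∀ k k≤n {x y} → Reach k k≤n x y → Star R x y
      reach-star zero    _   (inj₁ refl)    = ε
      reach-star zero    _   (inj₂ r)       = r ◅ ε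
      reach-star (suc k) k<n (inj₁ r)       = reach-star k _ r
      reach-star (suc k) k<n (inj₂ (r , s)) = reach-star k _ r ◅◅ reach-star k _ s

      reach-trans : ∀ k k≤n {x y z} → toℕ z < k → Reach k k≤n x z → Reach k k≤n z y → Reach k k≤n x y
      reach-trans (suc k) k<n {x} {y} {z} z<1+k r s with <-cmp (toℕ z) k
      ... | tri> _ _ k<z = contradiction z<1+k (ℕ.≤⇒≯ k<z)
      ... | tri< z<k _ _ = go r s
        where
        tr : ∀ {x y} → Reach k _ x z → Reach k _ z y → Reach k _ x y
        tr = reach-trans k _ z<k
        go : Reach (suc k) k<n x z → Reach (suc k) k<n z y → Reach (suc k) k<n x y
        go (inj₁ a)       (inj₁ b)       = inj₁ (tr a b)
        go (inj₁ a)       (inj₂ (b , c)) = inj₂ (tr a b , c)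
        go (inj₂ (a , b)) (inj₁ c)       = inj₂ (a , tr b c)
        -- Both halves pass through the new point `k`; the part between the two visits, with `z` on
        -- it, is cut out.
        go (inj₂ (a , b)) (inj₂ (c , d)) = inj₂ (a , d)
      ... | tri≈ _ z≡k _ with refl ← toℕ-injective {i = z} {j = fromℕ< k<n}
        (trans z≡k (sym (toℕ-fromℕ< k<n)))
        = inj₂ (left r , right s)
        where
        left : Reach (suc k) k<n x (fromℕ< k<n) → Reach k _ x (fromℕ< k<n)
        left (inj₁ a)       = a
        left (inj₂ (a , _)) = a
        right : Reach (suc k) k<n (fromℕ< k<n) y → Reach k _ (fromℕ< k<n) y
        right (inj₁ a)       = a
        right (inj₂ (_ , a)) = a

      star-reach : ∀ {x y} → Star R x y → Reach n ≤-refl x y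
      star-reach ε        = reach-base n _ (inj₁ refl)
      star-reach (r ◅ rs) = reach-trans n _ (toℕ<n _) (reach-base n _ (inj₂ r)) (star-reach rs)

    star? : Decidable (Star R)
    star? x y = map′ (reach-star n _) star-reach (reach? n ≤-refl x y)

  module _ {A : Set} {n : ℕ} (enum : Fin n ↔ A) {R : A → A → Set} (R? : Decidable R) where
    private module E = Inverse enum

    star?-via : Decidable (Star R)
    star?-via x y = map′
      (λ s → subst₂ (Star R) (E.inverseˡ refl) (E.inverseˡ refl) (Star.gmap E.to id s))
      (λ s → Star.gmap E.from (λ {i} {j} r → subst₂ R (sym (E.inverseˡ refl)) (sym (E.inverseˡ refl)) r) s)
      (star? (λ i j → R? (E.to i) (E.to j)) (E.from x) (E.from y))

  -- A search through functions meets each of them only up to pointwise equality, so only predicates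
  -- that respect `_≋_` are decided.
  record Searchable (A : Set) : Set₁ where
    infix 4 _≋_
    field
      _≋_    : A → A → Set
      ≋-refl : ∀ {x} → x ≋ x
      search : ∀ {P : A → Set} → (∀ {x y} → x ≋ y → P x → P y) → (∀ x → Dec (P x)) → Dec (∃ P)
  open Searchable

  searchBool : Searchable Bool
  searchBool = record
    { _≋_ = _≡_ ; ≋-refl = refl
    ; search = λ {P} _ P? → map′
        (λ { (inj₁ p) → true , p ; (inj₂ p) → false , p })
        (λ { (true , p) → inj₁ p ; (false , p) → inj₂ p })
        (P? true ⊎-dec P? false) }

  searchFin : ∀ n → Searchable (Fin n)
  searchFin n = record { _≋_ = _≡_ ; ≋-refl = refl ; search = λ _ P? → any? P? }

  searchFun : ∀ {A : Set} n → Searchable A → Searchable (Fin n → A)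
  searchFun {A = A} n S = record
    { _≋_ = λ f g → ∀ x → _≋_ S (f x) (g x) ; ≋-refl = λ _ → ≋-refl S ; search = go n }
    where
    go : ∀ n {P : (Fin n → A) → Set} → (∀ {f g} → (∀ x → _≋_ S (f x) (g x)) → P f → P g) →
         (∀ f → Dec (P f)) → Dec (∃ P)
    go zero    resp P? = map′ (λ p → _ , p) (λ (f , p) → resp (λ ()) p) (P? λ ())
    go (suc n) {P} resp P? = map′
      (λ (a , f , p) → (a ∷ᶠ f) , p)
      (λ (f , p) → f zero , f ∘ suc , resp (λ { zero → ≋-refl S ; (suc x) → ≋-refl S }) p)
      (search S {P = λ a → ∃ λ f → P (a ∷ᶠ f)}
        (λ a≋b (f , p) → f , resp (λ { zero → a≋b ; (suc x) → ≋-refl S }) p)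
        (λ a → go n {P = λ f → P (a ∷ᶠ f)} (λ f≋g → resp λ { zero → ≋-refl S ; (suc x) → f≋g x }) (λ f → P? (a ∷ᶠ f))))

  search× : ∀ {A B : Set} → Searchable A → Searchable B → Searchable (A × B)
  search× S S′ = record
    { _≋_ = λ (a , b) (a′ , b′) → _≋_ S a a′ × _≋_ S′ b b′
    ; ≋-refl = ≋-refl S , ≋-refl S′
    ; search = λ {P} resp P? → map′
        (λ (a , b , p) → (a , b) , p) (λ ((a , b) , p) → a , b , p)
        (search S {P = λ a → ∃ λ b → P (a , b)}
          (λ a≋a′ (b , p) → b , resp (a≋a′ , ≋-refl S′) p)
          (λ a → search S′ (λ b≋b′ → resp (≋-refl S , b≋b′)) (λ b → P? (a , b)))) }

  -- Decides a conjunction whose later parts cannot be stated before the earlier ones are proved: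
  -- the graph needs the symmetry of its adjacency, the faces need the graph.
  guard : ∀ {a b} {A : Set a} {B : Set b} → Dec A → (B → A) → (A → Dec B) → Dec B
  guard (yes a) _ k = k a
  guard (no ¬a) f _ = no (¬a ∘ f)

  module _ {n f} (adj : Fin n → Fin n → Bool) (left : Fin n → Fin n → Fin f) (around : Fin n → Fin f)
    where

    LiesOn : Fin n → Fin f → Set
    LiesOn x φ = (∃[ y ] T (adj x y) × left x y ≡ φ) ⊎ ((∀ y → ¬ T (adj x y)) × around x ≡ φ)

    liesOn? : ∀ x φ → Dec (LiesOn x φ)
    liesOn? x φ = any? (λ y → T? (adj x y) ×-dec (left x y ≟ φ))
            ⊎-dec (all? (λ y → ¬? (T? (adj x y))) ×-dec (around x ≟ φ))

  liesOn-cong : ∀ {n f} {adj adj′ : Fin n → Fin n → Bool} {left left′ : Fin n → Fin n → Fin f}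
    {around around′} →
                (∀ x y → adj x y ≡ adj′ x y) → (∀ x y → left x y ≡ left′ x y) →
                  (∀ x → around x ≡ around′ x) →
                ∀ {x φ} → LiesOn adj left around x φ → LiesOn adj′ left′ around′ x φ
  liesOn-cong p l a {x} (inj₁ (y , xy , eq)) = inj₁ (y , subst T (p x y) xy , trans (sym (l x y)) eq)
  liesOn-cong p l a {x} (inj₂ (iso , eq))    =
    inj₂ ((λ y → iso y ∘ subst T (sym (p x y))) , trans (sym (a x)) eq)

  ≡-sym² : ∀ {A B C : Set} {f g : A → B → C} → (∀ x y → f x y ≡ g x y) → ∀ x y → g x y ≡ f x y
  ≡-sym² p x y = sym (p x y)

  embeds? : ∀ {n m} (adj : Fin n → Fin n → Bool) (adj′ : Fin m → Fin m → Bool) →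
    Dec (Σ[ g ∈ (Fin n → Fin m) ] Injective _≡_ _≡_ g
      × (∀ {x y} → T (adj x y) → T (adj′ (g x) (g y))))
  embeds? {n} {m} adj adj′ = search (searchFun n (searchFin m))
    (λ p (inj , hom) → (λ {x} {y} eq → inj (trans (p x) (trans eq (sym (p y))))) ,
      λ {x} {y} xy → subst₂ (λ a b → T (adj′ a b)) (p x) (p y) (hom xy))
    (λ g → map′ (λ h {x} {y} → h x y) (λ h x y → h {x} {y})
      (all? λ x → all? λ y → (g x ≟ g y) →-dec (x ≟ y))
     ×-dec map′ (λ h {x} {y} → h x y) (λ h x y → h {x} {y})
       (all? λ x → all? λ y → T? (adj x y) →-dec T? (adj′ (g x) (g y))))

  all⊎? : ∀ {m n} {P : Fin m ⊎ Fin n → Set} → (∀ p → Dec (P p)) → Dec (∀ p → P p)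
  all⊎? P? = map′ (λ { (l , r) (inj₁ x) → l x ; (l , r) (inj₂ y) → r y })
                  (λ h → (h ∘ inj₁) , (h ∘ inj₂))
                  (all? (P? ∘ inj₁) ×-dec all? (P? ∘ inj₂))

  sym? : ∀ {A : Set} {R : A → A → Set} → Decidable R → Decidable (SymClosure R)
  sym? R? x y = map′ (λ { (inj₁ r) → fwd r ; (inj₂ r) → bwd r })
                     (λ { (fwd r) → inj₁ r ; (bwd r) → inj₂ r })
                     (R? x y ⊎-dec R? y x)

  module _ {Γ : Graph} (F : FaceStructure Γ) where
    open Graph Γ
    open FaceStructure F

    incident? : Decidable Incident
    incident? (inj₁ x) (inj₁ y) = map′ edge (λ { (edge xy) → xy }) (T? (adj x y))
    incident? (inj₁ x) (inj₂ φ) = map′ corner (λ { (corner l) → l }) (liesOn? adj left around x φ)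
    incident? (inj₂ φ) _        = no λ ()

    saturated? : ∀ G x y → Dec (∀ (x≢y : x ≢ y) → ¬ x ~ y → ¬ OnCommonFace x y
      ⊎ ¬ (addEdge Γ x y x≢y ⊑ G))
    saturated? G x y with x ≟ y
    ... | yes x≡y = yes λ x≢y → contradiction x≡y x≢y
    -- One proof of `x ≢ y` serves for all, because `⊑` sees only the adjacency of `addEdge`, which
    -- does not depend on it.
    ... | no x≢y  = map′ (λ h _ → h) (λ h → h x≢y) (¬? (T? (adj x y)) →-dec
          (¬? (any? λ φ → liesOn? adj left around x φ ×-dec liesOn? adj left around y φ) ⊎-dec
           ¬? (embeds? (Graph.adj (addEdge Γ x y x≢y)) (Graph.adj G))))

  module _ (G : Graph) (k f c : ℕ) where
    private
      n = Graph.v G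
      V = Fin n

      Raw : Set
      Raw = (V → V → Bool) × (V → V → V) × (V → V → Fin f) × (V → Fin f) × (V → Fin c)

      searchRaw : Searchable Raw
      searchRaw = search× (searchFun n (searchFun n searchBool))
                 (search× (searchFun n (searchFun n (searchFin n)))
                 (search× (searchFun n (searchFun n (searchFin f)))
                 (search× (searchFun n (searchFin f)) (searchFun n (searchFin c)))))

    -- A plane-saturated subgraph with k edges, f faces and c components, with
    -- given raw data up to pointwise equality.
    record Realised (raw : Raw) : Set where
      adj    = proj₁ raw
      next   = proj₁ (proj₂ raw)
      left   = proj₁ (proj₂ (proj₂ raw))
      around = proj₁ (proj₂ (proj₂ (proj₂ raw)))
      comp   = proj₂ (proj₂ (proj₂ (proj₂ raw)))
      field
        adj′        : V → V → Bool
        next′       : V → V → V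
        left′       : V → V → Fin f
        around′     : V → Fin f
        comp′       : V → Fin c
        adj-≗       : ∀ x y → adj x y ≡ adj′ x y
        next-≗      : ∀ x y → next x y ≡ next′ x y
        left-≗      : ∀ x y → left x y ≡ left′ x y
        around-≗    : ∀ x → around x ≡ around′ x
        comp-≗      : ∀ x → comp x ≡ comp′ x
        adj-sym     : ∀ x y → adj′ x y ≡ adj′ y x
        adj-irrefl  : ∀ x → adj′ x x ≡ false
      graph : Graph
      graph = record { v = n ; adj = adj′ ; adj-sym = adj-sym ; adj-irrefl = adj-irrefl }
      open Graph graph using (_~_)
      field
        next-~      : ∀ {x y} → x ~ y → x ~ next′ x y
        next-cycle  : ∀ {x y z} → x ~ y → x ~ z → Star (λ a b → next′ x a ≡ b) y z
        left-walk   : ∀ {x y} → x ~ y → left′ x y ≡ left′ y (next′ y x)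
      faces : FaceStructure graph
      faces = record { next = next′ ; next-~ = next-~ ; next-cycle = next-cycle ; f = f
                     ; left = left′ ; left-walk = left-walk ; around = around′ }
      field
        connected   : ∀ p q → EqClosure (FaceStructure.Incident faces) p q
        comp-onto   : Surjective _≡_ _≡_ comp′
        comp-≡      : ∀ x y → comp′ x ≡ comp′ y ⇔ Star _~_ x y
        euler       : n + f ≡ 1 + Graph.e graph + c
        subgraph    : graph ⊑ G
        saturated   : ∀ x y (x≢y : x ≢ y) → ¬ x ~ y →
                      ¬ FaceStructure.OnCommonFace faces x y ⊎ ¬ (addEdge graph x y x≢y ⊑ G)
        edges       : Graph.e graph ≡ k

    private
      open Realised using (adj-≗; next-≗; left-≗; around-≗; comp-≗)

      realised-resp : ∀ {r s} → _≋_ searchRaw r s → Realised r → Realised s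
      realised-resp (p , q , l , a , m) R = record
        { Realised R
        ; adj-≗    = λ x y → trans (sym (p x y)) (adj-≗ R x y)
        ; next-≗   = λ x y → trans (sym (q x y)) (next-≗ R x y)
        ; left-≗   = λ x y → trans (sym (l x y)) (left-≗ R x y)
        ; around-≗ = λ x → trans (sym (a x)) (around-≗ R x)
        ; comp-≗   = λ x → trans (sym (m x)) (comp-≗ R x)
        }

      realised? : ∀ r → Dec (Realised r)
      realised? r@(adj , next , left , around , comp) =
        guard (all? λ x → all? λ y → adj x y ≟ᵇ adj y x)
          (λ R x y → trans (adj-≗ R x y) (trans (Realised.adj-sym R x y) (sym (adj-≗ R y x))))
            λ adj-sym →
        guard (all? λ x → adj x x ≟ᵇ false)
          (λ R x → trans (adj-≗ R x x) (Realised.adj-irrefl R x)) λ adj-irrefl →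
        let Γ : Graph
            Γ = record { v = n ; adj = adj ; adj-sym = adj-sym ; adj-irrefl = adj-irrefl }
            open Graph Γ using (_~_)
            _~?_ : ∀ x y → Dec (x ~ y)
            x ~? y = T? (adj x y)
            to : (R : Realised r) → ∀ {x y} → x ~ y → T (Realised.adj′ R x y)
            to R {x} {y} = subst T (adj-≗ R x y)
            from : (R : Realised r) → ∀ {x y} → T (Realised.adj′ R x y) → x ~ y
            from R {x} {y} = subst T (sym (adj-≗ R x y))
            map-saturated : (R : Realised r) → ∀ x y x≢y →
              ¬ FaceStructure.OnCommonFace (Realised.faces R) x y
                ⊎ ¬ (addEdge (Realised.graph R) x y x≢y ⊑ G) →
              ¬ (∃[ φ ] LiesOn adj left around x φ × LiesOn adj left around y φ)
                ⊎ ¬ (addEdge Γ x y x≢y ⊑ G)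
            map-saturated R x y x≢y = λ where
              (inj₁ ¬common) → inj₁ λ (φ , a , b) → let m = liesOn-cong (adj-≗ R) (left-≗ R) (around-≗ R) in ¬common (φ , m a , m b)
              (inj₂ ¬embeds) → inj₂ λ (g , inj , hom) → ¬embeds
                (g , inj , λ {u} {w} uw → hom (subst (λ b → T (b ∨ _)) (sym (adj-≗ R u w)) uw))
            e-≗ : (R : Realised r) → Graph.e Γ ≡ Graph.e (Realised.graph R)
            e-≗ R = sum-cong-≗ {n} λ x → sum-cong-≗ {n} λ y →
              cong (λ b → if (toℕ x <ᵇ toℕ y) ∧ b then 1 else 0) (adj-≗ R x y)
        in
        guard (all? λ x → all? λ y → x ~? y →-dec x ~? next x y)
          (λ R x y xy → subst (x ~_) (sym (next-≗ R x y)) (from R (Realised.next-~ R (to R xy))))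
            λ next-~ →
        guard (all? λ x → all? λ y → all? λ z → x ~? y
          →-dec (x ~? z →-dec star? (λ a b → next x a ≟ b) y z))
          (λ R x y z xy xz → Star.map (λ {a} eq → trans (next-≗ R x a) eq) (Realised.next-cycle R (to R xy) (to R xz)))
          λ next-cycle →
        guard (all? λ x → all? λ y → x ~? y →-dec (left x y ≟ left y (next y x)))
          (λ R x y xy → trans (left-≗ R x y) (trans (Realised.left-walk R (to R xy))
            (trans (sym (left-≗ R y _)) (cong (left y) (sym (next-≗ R y x)))))) λ left-walk →
        let F : FaceStructure Γ
            F = record { next = next ; next-~ = λ {x} {y} → next-~ x y ; next-cycle = λ {x} {y} {z} → next-cycle x y z
                       ; f = f ; left = left ; left-walk = λ {x} {y} → left-walk x y ; around = around }
            open FaceStructure F using (Incident; OnCommonFace; edge; corner)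
            lies? : ∀ x φ → Dec (LiesOn adj left around x φ)
            lies? = liesOn? adj left around
        in
        guard (all⊎? λ p → all⊎? λ q → star?-via (+↔⊎ {n}) (sym? (incident? F)) p q)
          (λ R p q → EqC.map (λ { (FaceStructure.edge xy) → edge (from R xy)
                                ; (FaceStructure.corner l) →
                                  corner (liesOn-cong (≡-sym² (adj-≗ R)) (≡-sym² (left-≗ R))
                                  (sym ∘ around-≗ R) l) })
                             (Realised.connected R p q)) λ connected →
        guard (all? λ i → any? λ x → comp x ≟ i)
          (λ R i → let x , h = Realised.comp-onto R i in x , trans (comp-≗ R x) (h refl)) λ onto →
        guard (all? λ x → all? λ y → (comp x ≟ comp y) →-dec star? _~?_ x y)
          (λ R x y eq → Star.map (from R) (Equivalence.to (Realised.comp-≡ R x y)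
            (trans (sym (comp-≗ R x)) (trans eq (comp-≗ R y))))) λ comp⇒ →
        guard (all? λ x → all? λ y → star? _~?_ x y →-dec (comp x ≟ comp y))
          (λ R x y xy → trans (comp-≗ R x)
            (trans (Equivalence.from (Realised.comp-≡ R x y) (Star.map (to R) xy))
            (sym (comp-≗ R y)))) λ comp⇐ →
        guard (n + f ℕ.≟ 1 + Graph.e Γ + c)
          (λ R → trans (Realised.euler R) (cong (λ e → 1 + e + c) (sym (e-≗ R)))) λ euler →
        guard (embeds? adj (Graph.adj G))
          (λ R → let g , inj , hom = Realised.subgraph R in g , inj , λ xy → hom (to R xy)) λ subgraph →
        guard (all? λ x → all? λ y → saturated? F G x y)
          (λ R x y x≢y x≁y → map-saturated R x y x≢y (Realised.saturated R x y x≢y (x≁y ∘ from R)))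
            λ saturated →
        guard (Graph.e Γ ℕ.≟ k) (λ R → trans (e-≗ R) (Realised.edges R)) λ edges →
        yes record
          { adj-≗ = λ _ _ → refl ; next-≗ = λ _ _ → refl ; left-≗ = λ _ _ → refl ; around-≗ = λ _ → refl ; comp-≗ = λ _ → refl
          ; adj-sym = adj-sym ; adj-irrefl = adj-irrefl ; next-~ = λ {x} {y} → next-~ x y
          ; next-cycle = λ {x} {y} {z} → next-cycle x y z ; left-walk = λ {x} {y} → left-walk x y
          ; connected = connected ; comp-onto = λ i → let x , eq = onto i in x , λ { refl → eq }
          ; comp-≡ = λ x y → mk⇔ (comp⇒ x y) (comp⇐ x y) ; euler = euler ; subgraph = subgraph
          ; saturated = saturated ; edges = edges }

    anyRealised? : Dec (∃ Realised)
    anyRealised? = search searchRaw realised-resp realised?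

  -- Only finitely many numbers of faces and components need to be searched: the
  -- former is bounded by Euler's formula, the latter by the number of vertices.
  module _ (G : Graph) where

    Achieves : ℕ → Set
    Achieves k = Σ[ H ∈ PlaneGraph ] PlaneSaturated H G × PlaneGraph.e H ≡ k

    private
      n = Graph.v G

      fromRealised : ∀ {k f c} → ∃ (Realised G k f c) → Achieves k
      fromRealised (_ , R) = record
        { graph = graph
        ; embedding = record { faces = faces ; connected = connected ; c = _ ; component = comp′
                             ; component-onto = comp-onto ; component-≡ = comp-≡ ; euler = euler } }
        , record { spanning = refl ; subgraph = subgraph ; saturated = saturated }
        , edges
        where open Realised R

      module _ (H : PlaneGraph) (sat : PlaneSaturated H G) where
        open PlaneGraph H using (graph; embedding)
        open PlaneEmbedding embedding

        toRealised : ∃ (Realised G (PlaneGraph.e H) f c)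
        toRealised with refl ← PlaneSaturated.spanning sat = _ , record
          { adj′ = Graph.adj graph ; next′ = next ; left′ = left ; around′ = around ; comp′ = component
          ; adj-≗ = λ _ _ → refl ; next-≗ = λ _ _ → refl ; left-≗ = λ _ _ → refl ; around-≗ = λ _ →
            refl ; comp-≗ = λ _ → refl
          ; adj-sym = Graph.adj-sym graph ; adj-irrefl = Graph.adj-irrefl graph ; next-~ = next-~
          ; next-cycle = next-cycle ; left-walk = left-walk ; connected = connected ; comp-onto =
            component-onto
          ; comp-≡ = component-≡ ; euler = euler ; subgraph = PlaneSaturated.subgraph sat
          ; saturated = PlaneSaturated.saturated sat ; edges = refl }

        c≤n : c ≤ n
        c≤n with refl ← PlaneSaturated.spanning sat =
          -- Choosing a vertex in every component is injective.
          injective⇒≤ {f = proj₁ ∘ component-onto} λ {i} {j} p →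
          trans (sym (proj₂ (component-onto i) refl))
            (trans (cong component p) (proj₂ (component-onto j) refl))

        f≤ : f ≤ 1 + PlaneGraph.e H + n
        f≤ with refl ← PlaneSaturated.spanning sat =
          ≤-trans (m≤n+m f n) (≤-trans (≤-reflexive euler) (ℕ.+-monoʳ-≤ (1 + PlaneGraph.e H) c≤n))

    achieves? : ∀ k → Dec (Achieves k)
    achieves? k = map′ (λ (_ , _ , R) → fromRealised R)
      (λ { (H , sat , refl) → let f< = s≤s (f≤ H sat) ; c< = s≤s (c≤n H sat) in fromℕ< f< , fromℕ< c< ,
        subst₂ (λ f c → ∃ (Realised G _ f c)) (sym (toℕ-fromℕ< f<)) (sym (toℕ-fromℕ< c<))
          (toRealised H sat) })
      -- One more than the bounds f ≤ 1 + k + n and c ≤ n, which may both be attained.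
      (any? {n = 2 + k + n} λ f → any? {n = 1 + n} λ c → anyRealised? G k (toℕ f) (toℕ c))

    least : ∀ {P : ℕ → Set} → (∀ k → Dec (P k)) → ∀ {k} → P k → ∃[ m ] P m × m ≤ k
      × (∀ {j} → P j → m ≤ j)
    least P? {k} pk with P? 0
    ... | yes p0 = 0 , p0 , z≤n , λ _ → z≤n
    least P? {zero}  pk | no ¬p0 = contradiction pk ¬p0
    least {P} P? {suc k} pk | no ¬p0 = let m , pm , m≤k , min = least (P? ∘ suc) pk in
      suc m , pm , s≤s m≤k , λ { {zero} p0 → contradiction p0 ¬p0 ; {suc j} pj → s≤s (min pj) }

    -- Abstract, so that the type checker never runs the search.
    abstract

      saturationNumber≤ : ∀ H → PlaneSaturated H G → ∃[ m ] IsPlaneSaturationNumber G m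
        × m ≤ PlaneGraph.e H
      saturationNumber≤ H sat = let m , attained , m≤e , min = least achieves? (H , sat , refl) in
        m , record { attained = attained ; minimal = λ H′ sat′ → min (H′ , sat′ , refl) } , m≤e

-- Finite sets arranged in levels.

module Layers where

  open import Data.Fin.Properties
    using (toℕ<n; toℕ-fromℕ<; toℕ-injective; splitAt-↑ˡ; splitAt-↑ʳ; join-splitAt)
  open import Data.Nat.Base
  open import Data.Nat.Properties using (+-assoc; +-0-commutativeMonoid; _<?_; suc-injective)
  open import Relation.Binary.PropositionalEquality
  open import Algebra.Properties.CommutativeMonoid.Sum +-0-commutativeMonoid
    using (sum; sum-syntax; sum-cong-≗)

  total : (ℕ → ℕ) → ℕ → ℕ
  total s zero    = 0
  total s (suc L) = s 0 + total (s ∘ suc) L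

  -- The set is the concatenation of its levels. Level and position are plain numbers, so that
  -- elements on different levels can be compared without transport along the sizes.
  coords : ∀ s L → Fin (total s L) → ℕ × ℕ
  coords⊎ : ∀ s L → Fin (s 0) ⊎ Fin (total (s ∘ suc) L) → ℕ × ℕ
  coords s (suc L) x = coords⊎ s L (splitAt (s 0) x)
  coords⊎ s L (inj₁ i) = 0 , toℕ i
  coords⊎ s L (inj₂ y) = let ℓ , a = coords (s ∘ suc) L y in suc ℓ , a

  at : ∀ s L ℓ a → ℓ < L → a < s ℓ → Fin (total s L)
  at s (suc L) zero    a _         a< = fromℕ< a< ↑ˡ total (s ∘ suc) L
  at s (suc L) (suc ℓ) a (s≤s ℓ<L) a< = s 0 ↑ʳ at (s ∘ suc) L ℓ a ℓ<L a<

  coords-at : ∀ s L ℓ a ℓ<L a< → coords s L (at s L ℓ a ℓ<L a<) ≡ (ℓ , a)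
  coords-at s (suc L) zero a _ a<
    rewrite splitAt-↑ˡ (s 0) (fromℕ< a<) (total (s ∘ suc) L) = cong (0 ,_) (toℕ-fromℕ< a<)
  coords-at s (suc L) (suc ℓ) a (s≤s ℓ<L) a<
    rewrite splitAt-↑ʳ (s 0) _ (at (s ∘ suc) L ℓ a ℓ<L a<) | coords-at (s ∘ suc) L ℓ a ℓ<L a< = refl

  coords-injective : ∀ s L {x y} → coords s L x ≡ coords s L y → x ≡ y
  coords-injective s (suc L) {x} {y} eq = begin
    x                                         ≡⟨ join-splitAt (s 0) _ x ⟨
    join (s 0) _ (splitAt (s 0) x)
      ≡⟨ cong (join (s 0) _) (inj (splitAt (s 0) x) (splitAt (s 0) y) eq) ⟩
    join (s 0) _ (splitAt (s 0) y)            ≡⟨ join-splitAt (s 0) _ y ⟩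
    y                                         ∎
    where
    open ≡-Reasoning
    inj : ∀ p q → coords⊎ s L p ≡ coords⊎ s L q → p ≡ q
    inj (inj₁ i) (inj₁ j) e = cong inj₁ (toℕ-injective (cong proj₂ e))
    inj (inj₂ i) (inj₂ j) e = cong inj₂ (coords-injective (s ∘ suc) L
      (cong₂ _,_ (suc-injective (cong proj₁ e)) (cong proj₂ e)))

  coords-valid : ∀ s L x → proj₁ (coords s L x) < L × proj₂ (coords s L x) < s (proj₁ (coords s L x))
  coords-valid s (suc L) x with splitAt (s 0) x
  ... | inj₁ i = s≤s z≤n , toℕ<n i
  ... | inj₂ y = let p , q = coords-valid (s ∘ suc) L y in s≤s p , q

  sum-++ : ∀ m {n} (f : Fin (m + n) → ℕ) → sum f ≡ ∑[ i < m ] f (i ↑ˡ n) + ∑[ j < n ] f (m ↑ʳ j)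
  sum-++ zero    f = refl
  sum-++ (suc m) f = trans (cong (f zero +_) (sum-++ m (f ∘ suc))) (sym (+-assoc (f zero) _ _))

  totalSum : (s : ℕ → ℕ) → ℕ → (ℕ → ℕ → ℕ) → ℕ
  totalSum s zero    w = 0
  totalSum s (suc L) w = ∑[ a < s 0 ] w 0 (toℕ a) + totalSum (s ∘ suc) L (w ∘ suc)

  sum-coords : ∀ s L w → ∑[ x < total s L ] w (proj₁ (coords s L x)) (proj₂ (coords s L x)) ≡ totalSum
    s L w
  sum-coords s zero    w = refl
  sum-coords s (suc L) w = trans (sum-++ (s 0) _) (cong₂ _+_ (sum-cong-≗ onTop)
      (trans (sum-cong-≗ deeper) (sum-coords (s ∘ suc) L (w ∘ suc))))
    where
    W : ℕ × ℕ → ℕ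
    W (ℓ , a) = w ℓ a
    onTop : ∀ i → W (coords⊎ s L (splitAt (s 0) (i ↑ˡ total (s ∘ suc) L))) ≡ w 0 (toℕ i)
    onTop i = cong (W ∘ coords⊎ s L) (splitAt-↑ˡ (s 0) i _)
    deeper : ∀ y → W (coords⊎ s L (splitAt (s 0) (s 0 ↑ʳ y))) ≡ _
    deeper y = cong (W ∘ coords⊎ s L) (splitAt-↑ʳ (s 0) _ y)

  -- The coordinates are abstract: everything that follows uses their equations only, and no vertex
  -- unfolds into nested sums.
  module Grid (s : ℕ → ℕ) (L : ℕ) where

    abstract

      lev idx : Fin (total s L) → ℕ
      lev x = proj₁ (coords s L x)
      idx x = proj₂ (coords s L x)

      lev< : ∀ x → lev x < L
      lev< x = proj₁ (coords-valid s L x)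

      idx< : ∀ x → idx x < s (lev x)
      idx< x = proj₂ (coords-valid s L x)

      -- The element with the given coordinates, or a default if there is none.
      place : Fin (total s L) → ℕ → ℕ → Fin (total s L)
      place d ℓ a with ℓ <? L | a <? s ℓ
      ... | yes ℓ<L | yes a< = at s L ℓ a ℓ<L a<
      ... | _       | _      = d

      private
        coords-place : ∀ {d ℓ a} → ℓ < L → a < s ℓ → coords s L (place d ℓ a) ≡ (ℓ , a)
        coords-place {ℓ = ℓ} {a} p q with ℓ <? L | a <? s ℓ
        ... | yes ℓ<L | yes a< = coords-at s L ℓ a ℓ<L a<
        ... | no ¬p   | _      = contradiction p ¬p
        ... | yes _   | no ¬q  = contradiction q ¬q

      lev-place : ∀ {d ℓ a} → ℓ < L → a < s ℓ → lev (place d ℓ a) ≡ ℓ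
      lev-place p q = cong proj₁ (coords-place p q)

      idx-place : ∀ {d ℓ a} → ℓ < L → a < s ℓ → idx (place d ℓ a) ≡ a
      idx-place p q = cong proj₂ (coords-place p q)

      coords-unique : ∀ {x y} → lev x ≡ lev y → idx x ≡ idx y → x ≡ y
      coords-unique p q = coords-injective s L (cong₂ _,_ p q)

      sum-grid : ∀ w → ∑[ x < total s L ] w (lev x) (idx x) ≡ totalSum s L w
      sum-grid = sum-coords s L

    place-unique : ∀ {d x ℓ a} → lev x ≡ ℓ → idx x ≡ a → place d ℓ a ≡ x
    place-unique {x = x} refl refl =
      coords-unique (lev-place (lev< x) (idx< x)) (idx-place (lev< x) (idx< x))

-- Rotation systems with named neighbours.

module Rotation where

  open import Data.List.Properties using (length-map)
  import Data.List.Relation.Unary.All as All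
  import Data.List.Relation.Unary.All.Properties as All
  open import Data.Nat.Base using (ℕ; _+_)
  open import Data.Nat.Properties using (+-0-commutativeMonoid)
  open import Relation.Binary.Construct.Closure.ReflexiveTransitive using (Star; ε; _◅_)
  open import Relation.Binary.PropositionalEquality
  open import Algebra.Properties.CommutativeMonoid.Sum +-0-commutativeMonoid using (sum-syntax; sum-cong-≗)
  open Counting

  unique-map : ∀ {A B : Set} (g : A → B) (h : B → A) {xs} → (∀ {x} → x ∈ xs → h (g x) ≡ x) →
               Unique xs → Unique (map g xs)
  unique-map g h hg []        = []
  unique-map g h hg (x∉ ∷ u) =
    All.map⁺ (All.tabulate λ y∈ gx≡gy → lookup x∉ y∈
      (trans (sym (hg (here refl))) (trans (cong h gx≡gy) (hg (there y∈)))))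
    ∷ unique-map g h (hg ∘ there) u

  -- The neighbours of x are named by the codes in R x, listed clockwise.
  record RotationSystem (n : ℕ) : Set₁ where
    field
      Code    : Set
      R       : Fin n → List Code
      go      : Fin n → Code → Fin n
      code    : Fin n → Fin n → Code
      code-go : ∀ {x c} → c ∈ R x → code x (go x c) ≡ c
      back    : ∀ {x c} → c ∈ R x → code (go x c) x ∈ R (go x c)
      go-back : ∀ {x c} → c ∈ R x → go (go x c) (code (go x c) x) ≡ x
      go-≢    : ∀ {x c} → c ∈ R x → go x c ≢ x

    edge? : Fin n → Fin n → Bool
    edge? x y = occurs (map (go x) (R x)) y

    edge⁺ : ∀ {x c} → c ∈ R x → T (edge? x (go x c))
    edge⁺ {x} c∈ = ∈⇒occurs (∈-map⁺ (go x) c∈)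

    edge⁻ : ∀ {x y} → T (edge? x y) → ∃ λ c → c ∈ R x × y ≡ go x c
    edge⁻ {x} t = ∈-map⁻ (go x) (occurs⇒∈ (map (go x) (R x)) t)

    private
      edge-sym : ∀ {x y} → T (edge? x y) → T (edge? y x)
      edge-sym {x} t with c , c∈ , refl ← edge⁻ t =
        subst (T ∘ edge? (go x c)) (go-back c∈) (edge⁺ (back c∈))

    graph : Graph
    graph = record
      { v = n ; adj = edge? ; adj-sym = λ x y → T-ext edge-sym edge-sym
      ; adj-irrefl = λ x → ¬T⇒false λ t → let c , c∈ , x≡ = edge⁻ t in go-≢ c∈ (sym x≡) }

    open Graph graph using (_~_)

    -- The length of `R x` is the degree of `x`, since its codes are distinct and `code x` inverts
    -- `go x` on them.
    handshake-R : (∀ x → Unique (R x)) → ∑[ x < n ] length (R x) ≡ Graph.e graph + Graph.e graph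
    handshake-R u = trans (sym (sum-cong-≗ row)) (handshake graph)
      where
      row : ∀ x → ∑[ y < n ] ⟦ edge? x y ⟧ ≡ length (R x)
      row x = trans (sum-occurs (unique-map (go x) (code x) code-go (u x))) (length-map (go x) (R x))

  -- The data of a `FaceStructure`, given on codes instead of neighbours, so that rotations and
  -- faces can be read off a table.
  record Embedded {n} (S : RotationSystem n) : Set where
    open RotationSystem S
    field
      next        : Fin n → Code → Code
      next-∈      : ∀ {x c} → c ∈ R x → next x c ∈ R x
      next-cycle  : ∀ {x c c′} → c ∈ R x → c′ ∈ R x → Star (λ a b → next x a ≡ b) c c′
      f           : ℕ
      left        : Fin n → Code → Fin f
      left-walk   : ∀ {x c} → c ∈ R x → left x c ≡ left (go x c) (next (go x c) (code (go x c) x))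
      around      : Fin n → Fin f

    faces : FaceStructure graph
    faces = record
      { next = λ x y → go x (next x (code x y))
      ; next-~ = λ xy → case-edge xy
      ; next-cycle = λ xy xz → cycle xy xz
      ; f = f ; left = λ x y → left x (code x y)
      ; left-walk = λ xy → walk xy
      ; around = around }
      where
      open Graph graph using (_~_)
      case-edge : ∀ {x y} → x ~ y → x ~ go x (next x (code x y))
      case-edge {x} xy with c , c∈ , refl ← edge⁻ xy rewrite code-go c∈ = edge⁺ (next-∈ c∈)
      star-go : ∀ {x c c′} → c ∈ R x → Star (λ a b → next x a ≡ b) c c′ →
                Star (λ a b → go x (next x (code x a)) ≡ b) (go x c) (go x c′)
      star-go c∈ ε = ε
      star-go {x} c∈ (refl ◅ ps) = cong (go x ∘ next x) (code-go c∈) ◅ star-go (next-∈ c∈) ps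
      cycle : ∀ {x y z} → x ~ y → x ~ z → Star (λ a b → go x (next x (code x a)) ≡ b) y z
      cycle xy xz with c , c∈ , refl ← edge⁻ xy | c′ , c′∈ , refl ← edge⁻ xz =
        star-go c∈ (next-cycle c∈ c′∈)
      walk : ∀ {x y} → x ~ y → left x (code x y) ≡ left y (code y (go y (next y (code y x))))
      walk {x} xy with c , c∈ , refl ← edge⁻ xy
        rewrite code-go c∈ | code-go (next-∈ (back c∈)) = left-walk c∈

-- Graphs on a strip of levels of three kinds, given by finite tables.

module Strip where

  open import Data.Bool.Properties using (T-∧; T-∨)
  import Data.List.Relation.Unary.All as All
  open import Data.List.Relation.Unary.All.Properties using (all⁺)
  open import Data.Nat.Base
  open import Data.Nat.Properties
  open import Relation.Binary.Construct.Closure.ReflexiveTransitive using (Star; ε; _◅_)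
  open import Relation.Binary.PropositionalEquality
  open import Algebra.Properties.CommutativeMonoid.Sum +-0-commutativeMonoid using (sum-syntax)
  open Counting
  open Layers
  open Rotation

  ∧⁻ : ∀ {a b} → T (a ∧ b) → T a × T b
  ∧⁻ = Equivalence.to T-∧

  ∨⁻ : ∀ {a b} → T (a ∨ b) → T a ⊎ T b
  ∨⁻ = Equivalence.to T-∨

  ∨-elim : ∀ {a b} {C : Set} → T (a ∨ b) → (T a → C) → (T b → C) → C
  ∨-elim t f g = [ f , g ]′ (∨⁻ t)

  not⁻ : ∀ {a} → T (not a) → ¬ T a
  not⁻ {false} _ ()

  all-∈ : ∀ {A : Set} {p : A → Bool} {xs x} → T (all p xs) → x ∈ xs → T (p x)
  all-∈ {p = p} {xs} t = lookup (all⁺ p xs t)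

  ⇒⁻ : ∀ {a b} → T (not a ∨ b) → T a → T b
  ⇒⁻ {true} t _ = t

  ∧⁺ : ∀ {a b} → T a → T b → T (a ∧ b)
  ∧⁺ p q = Equivalence.from T-∧ (p , q)

  any-T : ∀ {A : Set} (p : A → Bool) {xs x} → x ∈ xs → T (p x) → T (any p xs)
  any-T p (here refl) t = Equivalence.from T-∨ (inj₁ t)
  any-T p (there x∈)  t = Equivalence.from T-∨ (inj₂ (any-T p x∈ t))

  -- A computed check.  Unlike T b, the type Valid b is never normalised.
  data Valid (b : Bool) : Set where
    valid : T b → Valid b

  valid-∈ : ∀ {A : Set} {p : A → Bool} {xs x} → Valid (all p xs) → x ∈ xs → T (p x)
  valid-∈ {p = p} (valid t) = all-∈ {p = p} t

  below? : ℕ → (ℕ → Bool) → Bool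
  below? n p = all p (upTo n)

  all-< : ∀ {p n a} → T (below? n p) → a < n → T (p a)
  all-< {p} t a<n = all-∈ {p = p} t (∈-upTo⁺ a<n)

  -- A vertex is given by its level and its position there.  A code names a
  -- neighbour by its position on the level above, on the same level or below.
  infix 8 ↑_ •_ ↓_
  data Code : Set where
    ↑_ •_ ↓_ : ℕ → Code

  _==_ : Code → Code → Bool
  (↑ a) == (↑ b) = a ≡ᵇ b
  (• a) == (• b) = a ≡ᵇ b
  (↓ a) == (↓ b) = a ≡ᵇ b
  _     == _     = false

  ==⇒≡ : ∀ c d → T (c == d) → c ≡ d
  ==⇒≡ (↑ a) (↑ b) t = cong ↑_ (≡ᵇ⇒≡ a b t)
  ==⇒≡ (• a) (• b) t = cong •_ (≡ᵇ⇒≡ a b t)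
  ==⇒≡ (↓ a) (↓ b) t = cong ↓_ (≡ᵇ⇒≡ a b t)

  ≡⇒== : ∀ {c d} → c ≡ d → T (c == d)
  ≡⇒== {↑ a} refl = ≡⇒≡ᵇ a a refl
  ≡⇒== {• a} refl = ≡⇒≡ᵇ a a refl
  ≡⇒== {↓ a} refl = ≡⇒≡ᵇ a a refl

  _∈?_ : Code → List Code → Bool
  c ∈? cs = any (c ==_) cs

  ∈?⇒∈ : ∀ {c} cs → T (c ∈? cs) → c ∈ cs
  ∈?⇒∈ {c} (d ∷ cs) t = [ here ∘ ==⇒≡ c d , there ∘ ∈?⇒∈ cs ]′ (∨⁻ t)

  ∈⇒∈? : ∀ {c cs} → c ∈ cs → T (c ∈? cs)
  ∈⇒∈? (here p)  = Equivalence.from T-∨ (inj₁ (≡⇒== p))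
  ∈⇒∈? (there p) = Equivalence.from T-∨ (inj₂ (∈⇒∈? p))

  pos : Code → ℕ
  pos (↑ a) = a
  pos (• a) = a
  pos (↓ a) = a

  move : Code → ℕ → ℕ
  move (↑ _) ℓ = pred ℓ
  move (• _) ℓ = ℓ
  move (↓ _) ℓ = suc ℓ

  reverse : Code → ℕ → Code
  reverse (↑ _) a = ↓ a
  reverse (• _) a = • a
  reverse (↓ _) a = ↑ a

  data Kind : Set where
    top mid bot : Kind

  size : Kind → ℕ
  size top = 9
  size mid = 12
  size bot = 56

  below : ℕ → ℕ → Kind
  below zero    _       = bot
  below (suc m) zero    = mid
  below (suc m) (suc ℓ) = below m ℓ

  -- Level 0 is at the top, followed by m + 1 middle levels and the bottom.
  kind : ℕ → ℕ → Kind
  kind m zero    = top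
  kind m (suc ℓ) = below (suc m) ℓ

  kinds : List Kind
  kinds = top ∷ mid ∷ bot ∷ []

  ∈kinds : ∀ k → k ∈ kinds
  ∈kinds top = here refl
  ∈kinds mid = there (here refl)
  ∈kinds bot = there (there (here refl))

  allowed : Kind → Code → Bool
  allowed top (↑ _) = false
  allowed bot (↓ _) = false
  allowed _   _     = true

  -- The kinds of level to which a code can lead. A check over all of them covers every level of
  -- every strip. As there is at least one middle level, top and bottom are never consecutive.
  nbrKinds : Kind → Code → List Kind
  nbrKinds top (↓ _) = mid ∷ []
  nbrKinds mid (↑ _) = top ∷ mid ∷ []
  nbrKinds mid (↓ _) = mid ∷ bot ∷ []
  nbrKinds bot (↑ _) = mid ∷ []
  nbrKinds k   _     = k ∷ []

  forKinds : (Kind → Bool) → Bool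
  forKinds p = all p kinds

  all-kinds : ∀ {p} → Valid (forKinds p) → ∀ k → T (p k)
  all-kinds {p} t k = valid-∈ {p = p} t (∈kinds k)

  below-mid : ∀ {m ℓ} → ℓ < m → below m ℓ ≡ mid
  below-mid {suc m} {zero}  _         = refl
  below-mid {suc m} {suc ℓ} (s≤s ℓ<m) = below-mid ℓ<m

  below-bot : ∀ {m} → below m m ≡ bot
  below-bot {zero}  = refl
  below-bot {suc m} = below-bot {m}

  mid-below : ∀ {m ℓ} → below m ℓ ≡ mid → ℓ < m
  mid-below {suc m} {zero}  _  = s≤s z≤n
  mid-below {suc m} {suc ℓ} eq = s≤s (mid-below eq)

  below-≢top : ∀ m ℓ → below m ℓ ≢ top
  below-≢top (suc m) (suc ℓ) = below-≢top m ℓ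

  below-suc : ∀ m ℓ → below m (suc ℓ) ∈ mid ∷ bot ∷ []
  below-suc zero          ℓ       = there (here refl)
  below-suc (suc zero)    zero    = there (here refl)
  below-suc (suc (suc m)) zero    = here refl
  below-suc (suc m)       (suc ℓ) = below-suc m ℓ

  module _ (m : ℕ) where

    levels : ℕ
    levels = 3 + m

    move-back : ∀ c a {ℓ} → T (allowed (kind m ℓ) c) → move (reverse c a) (move c ℓ) ≡ ℓ
    move-back (↑ _) a {suc ℓ} _ = refl
    move-back (• _) a         _ = refl
    move-back (↓ _) a         _ = refl

    move-valid : ∀ c {ℓ} → ℓ < levels → T (allowed (kind m ℓ) c) →
                 move c ℓ < levels × kind m (move c ℓ) ∈ nbrKinds (kind m ℓ) c
    move-valid (• _) {ℓ} ℓ< _ = ℓ< , self (kind m ℓ)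
      where
      self : ∀ k {b} → k ∈ nbrKinds k (• b)
      self top = here refl
      self mid = here refl
      self bot = here refl
    move-valid (↓ _) {zero} ℓ< _ = s≤s (s≤s z≤n) , here refl
    move-valid (↓ _) {suc ℓ} ℓ< t with below (suc m) ℓ in eq
    ... | top = contradiction eq (below-≢top (suc m) ℓ)
    ... | mid = s≤s (s≤s (mid-below eq)) , below-suc (suc m) ℓ
    move-valid (↑ _) {suc zero} ℓ< _ = s≤s z≤n , here refl
    move-valid (↑ _) {suc (suc ℓ)} (s≤s (s≤s ℓ<)) _
      rewrite below-mid {suc m} {ℓ} ℓ< with below m ℓ | below-suc (suc m) ℓ
    ... | mid | _ = s≤s (m≤n⇒m≤1+n ℓ<) , there (here refl)
    ... | bot | _ = s≤s (m≤n⇒m≤1+n ℓ<) , here refl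
    ... | top | here ()
    ... | top | there (here ())
    ... | top | there (there ())

    codeOf : ℕ → ℕ → ℕ → Code
    codeOf ℓ ℓ′ b = if ℓ′ ≡ᵇ ℓ then • b else (if ℓ <ᵇ ℓ′ then ↓ b else ↑ b)

    codeOf-move : ∀ c {ℓ} → T (allowed (kind m ℓ) c) → codeOf ℓ (move c ℓ) (pos c) ≡ c
    codeOf-move (• b) {ℓ}     _ rewrite T⇒true (≡⇒≡ᵇ ℓ ℓ refl) = refl
    codeOf-move (↓ b) {ℓ}     _
      rewrite ¬T⇒false {suc ℓ ≡ᵇ ℓ} (λ t → 1+n≢n (≡ᵇ⇒≡ (suc ℓ) ℓ t)) | T⇒true (<⇒<ᵇ {ℓ} (n<1+n ℓ)) =
        refl
    codeOf-move (↑ b) {suc ℓ} _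
      rewrite ¬T⇒false {ℓ ≡ᵇ suc ℓ} (λ t → 1+n≢n (sym (≡ᵇ⇒≡ ℓ (suc ℓ) t)))
            | ¬T⇒false {suc ℓ <ᵇ ℓ} (λ t → <⇒≱ (<ᵇ⇒< (suc ℓ) ℓ t) (n≤1+n ℓ)) = refl

    codeOf-back : ∀ c a {ℓ} → T (allowed (kind m ℓ) c) → codeOf (move c ℓ) ℓ a ≡ reverse c a
    codeOf-back (• b) a {ℓ} _ rewrite T⇒true (≡⇒≡ᵇ ℓ ℓ refl) = refl
    codeOf-back (↓ b) a {ℓ} _
      rewrite ¬T⇒false {ℓ ≡ᵇ suc ℓ} (λ t → 1+n≢n (sym (≡ᵇ⇒≡ ℓ (suc ℓ) t)))
            | ¬T⇒false {suc ℓ <ᵇ ℓ} (λ t → <⇒≱ (<ᵇ⇒< (suc ℓ) ℓ t) (n≤1+n ℓ)) = refl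
    codeOf-back (↑ b) a {suc ℓ} _
      rewrite ¬T⇒false {suc ℓ ≡ᵇ ℓ} (λ t → 1+n≢n (≡ᵇ⇒≡ (suc ℓ) ℓ t)) | T⇒true (<⇒<ᵇ {ℓ} (n<1+n ℓ)) =
        refl

  Rows : Set
  Rows = Kind → List (List (Code × Code))

  row : List (List (Code × Code)) → ℕ → List (Code × Code)
  row []       _       = []
  row (r ∷ _)  zero    = r
  row (_ ∷ rs) (suc a) = row rs a

  nextIn : List Code → Code → Code
  nextIn []       c = c
  nextIn (d ∷ ds) c = go d ds
    where
    go : Code → List Code → Code
    -- The order is cyclic: the last entry is followed by the head of the list.
    go e []       = d
    go e (e′ ∷ es) = if c == e then e′ else go e′ es

  faceIn : List (Code × Code) → Code → Code
  faceIn []             c = • 0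
  faceIn ((d , φ) ∷ ds) c = if c == d then φ else faceIn ds c

  reaches : List Code → ℕ → Code → Code → Bool
  reaches l zero    c d = c == d
  reaches l (suc n) c d = (c == d) ∨ reaches l n (nextIn l c) d

  reaches-star : ∀ l n c d → T (reaches l n c d) → Star (λ a b → nextIn l a ≡ b) c d
  reaches-star l zero    c d t with refl ← ==⇒≡ c d t = ε
  reaches-star l (suc n) c d t with ∨⁻ t
  ... | inj₁ eq with refl ← ==⇒≡ c d eq = ε
  ... | inj₂ r = refl ◅ reaches-star l n _ d r

  distinct : List Code → Bool
  distinct []       = true
  distinct (c ∷ cs) = not (c ∈? cs) ∧ distinct cs

  distinct⇒unique : ∀ cs → T (distinct cs) → Unique cs
  distinct⇒unique []       _ = []
  distinct⇒unique (c ∷ cs) t = let c∉ , u = ∧⁻ t in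
    All.tabulate (λ { d∈ refl → not⁻ c∉ (∈⇒∈? d∈) }) ∷ distinct⇒unique cs u

  -- composes c d e: following c and then d leads to the same level as e.
  composes : Code → Code → Code → Bool
  composes (• _) (↑ _) (↑ _) = true
  composes (• _) (• _) (• _) = true
  composes (• _) (↓ _) (↓ _) = true
  composes (↑ _) (↓ _) (• _) = true
  composes (↑ _) (• _) (↑ _) = true
  composes (↓ _) (↑ _) (• _) = true
  composes (↓ _) (• _) (↓ _) = true
  composes _     _     _     = false

  composes-move : ∀ c d e {m ℓ} → T (allowed (kind m ℓ) c) → T (composes c d e) →
    move e ℓ ≡ move d (move c ℓ)
  composes-move (• _) (↑ _) (↑ _)         _ _ = refl
  composes-move (• _) (• _) (• _)         _ _ = refl
  composes-move (• _) (↓ _) (↓ _)         _ _ = refl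
  composes-move (↑ _) (↓ _) (• _) {ℓ = suc _} _ _ = refl
  composes-move (↑ _) (• _) (↑ _)         _ _ = refl
  composes-move (↓ _) (↑ _) (• _)         _ _ = refl
  composes-move (↓ _) (• _) (↓ _)         _ _ = refl

  any-∃ : ∀ {A : Set} (p : A → Bool) xs → T (any p xs) → ∃ λ x → x ∈ xs × T (p x)
  any-∃ p (x ∷ xs) t with ∨⁻ t
  ... | inj₁ px = x , here refl , px
  ... | inj₂ ts = let y , y∈ , py = any-∃ p xs ts in y , there y∈ , py

  total-below : ∀ (s : Kind → ℕ) m → total (s ∘ below m) (suc m) ≡ m * s mid + s bot
  total-below s zero    = +-identityʳ (s bot)
  total-below s (suc m) = trans (cong (s mid +_) (total-below s m)) (sym (+-assoc (s mid) _ _))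

  totalSum-below : ∀ (s : Kind → ℕ) (w : Kind → ℕ → ℕ) m →
    totalSum (s ∘ below m) (suc m) (w ∘ below m) ≡
    m * ∑[ a < s mid ] w mid (toℕ a) + ∑[ a < s bot ] w bot (toℕ a)
  totalSum-below s w zero    = +-identityʳ _
  totalSum-below s w (suc m) =
    trans (cong (∑[ a < s mid ] w mid (toℕ a) +_) (totalSum-below s w m))
      (sym (+-assoc (∑[ a < s mid ] w mid (toℕ a)) _ _))

  total-kind : ∀ (s : Kind → ℕ) m → total (s ∘ kind m) (levels m) ≡ s top + (suc m * s mid + s bot)
  total-kind s m = cong (s top +_) (total-below s (suc m))

  kindSum : (Kind → ℕ) → (Kind → ℕ → ℕ) → Kind → ℕ
  kindSum s w k = ∑[ a < s k ] w k (toℕ a)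

  totalSum-kind : ∀ (s : Kind → ℕ) (w : Kind → ℕ → ℕ) m →
    totalSum (s ∘ kind m) (levels m) (w ∘ kind m) ≡
    kindSum s w top + (suc m * kindSum s w mid + kindSum s w bot)
  totalSum-kind s w m = cong (kindSum s w top +_) (totalSum-below s w (suc m))

  -- Every vertex but the root has a neighbour on the level above, or on the same
  -- level and of smaller rank.
  rank : Kind → ℕ → ℕ
  rank top a = if a <ᵇ 4 then 2 else if a <ᵇ 8 then 1 else 0
  rank mid a = 0
  rank bot a = if a <ᵇ 12 then 0 else if a <ᵇ 24 then 1 else if a <ᵇ 28 then 2 else 3

  isRoot : Kind → ℕ → Bool
  isRoot top a = a ≡ᵇ 8
  isRoot _   _ = false

  descends : Kind → ℕ → Code → Bool
  descends k a (↑ _) = true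
  descends k a (• b) = rank k b <ᵇ rank k a
  descends k a (↓ _) = false

  module Table (rows : Rows) where

    rot : Kind → ℕ → List Code
    rot k a = map proj₁ (row (rows k) a)

    faceCode : Kind → ℕ → Code → Code
    faceCode k a = faceIn (row (rows k) a)

    forVertices : (Kind → ℕ → Bool) → Bool
    forVertices p = forKinds λ k → below? (size k) (p k)

    forEdges : (Kind → ℕ → Code → Kind → Bool) → Bool
    forEdges p = forVertices λ k a → all (λ c → all (p k a c) (nbrKinds k c)) (rot k a)

    entry-ok? : Kind → ℕ → Code → Bool
    entry-ok? k a c = allowed k c ∧ not (c == (• a))

    reverse-ok? : Kind → ℕ → Code → Kind → Bool
    reverse-ok? k a c k′ = (pos c <ᵇ size k′) ∧ (reverse c a ∈? rot k′ (pos c))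

    -- Faces are named relative to the level of a vertex. The names at the two ends of an edge
    -- denote the same face if the numbers agree and the levels agree after the change of level
    -- along the edge, which is what `composes` tests.
    walk-ok? : Kind → ℕ → Code → Kind → Bool
    walk-ok? k a c k′ = let φ = faceCode k a c ; φ′ = faceCode k′ (pos c) (nextIn (rot k′ (pos c)) (reverse c a)) in
      (pos φ ≡ᵇ pos φ′) ∧ composes c φ′ φ

    -- Empty rows are exempt because the isolated vertices of H have no path to the root.
    descends-ok? : Kind → ℕ → Bool
    descends-ok? k a = null (rot k a) ∨ (isRoot k a ∨ any (descends k a) (rot k a))

    cyclic-ok? : List Code → Code → Bool
    cyclic-ok? l c = (nextIn l c ∈? l) ∧ all (reaches l (length l) c) l

  record Checked (rows : Rows) : Set where
    open Table rows
    field
      entries : Valid (forVertices λ k a → all (entry-ok? k a) (rot k a))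
      desc    : Valid (forVertices descends-ok?)
      rev     : Valid (forEdges reverse-ok?)
      cyclic  : Valid (forVertices λ k a → let l = rot k a in distinct l ∧ all (cyclic-ok? l) l)

  module OnStrip {rows : Rows} (ok : Checked rows) (m : ℕ) where
    open Table rows public
    open Checked ok

    open Grid (size ∘ kind m) (levels m) public

    n : ℕ
    n = total (size ∘ kind m) (levels m)

    V : Set
    V = Fin n

    K : V → Kind
    K x = kind m (lev x)

    R : V → List Code
    R x = rot (K x) (idx x)

    go : V → Code → V
    go x c = place x (move c (lev x)) (pos c)

    code : V → V → Code
    code x y = codeOf m (lev x) (lev y) (idx y)

    vertex-check : ∀ {p} → Valid (forVertices p) → ∀ x → T (p (K x) (idx x))
    vertex-check {p} t x = all-< {p (K x)} (all-kinds {λ k → below? (size k) (p k)} t (K x)) (idx< x)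

    code-check : ∀ {p : Kind → ℕ → Code → Bool} → Valid (forVertices λ k a → all (p k a) (rot k a)) →
                 ∀ {x c} → c ∈ R x → T (p (K x) (idx x) c)
    code-check {p} t {x} = all-∈ {p = p (K x) (idx x)}
      (vertex-check {λ k a → all (p k a) (rot k a)} t x)

    private
      entry-ok : ∀ {x c} → c ∈ R x → T (allowed (K x) c) × T (not (c == (• idx x)))
      entry-ok = ∧⁻ ∘ code-check {entry-ok?} entries

    code-allowed : ∀ {x c} → c ∈ R x → T (allowed (K x) c)
    code-allowed {x} {c} c∈ = proj₁ (entry-ok {x} {c} c∈)

    target : ∀ {x c} → c ∈ R x → move c (lev x) < levels m
      × kind m (move c (lev x)) ∈ nbrKinds (K x) c
    target {x} {c} c∈ = move-valid m c (lev< x) (code-allowed {x} c∈)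

    edge-check : ∀ {p} → Valid (forEdges p) → ∀ {x c} → c ∈ R x →
      T (p (K x) (idx x) c (kind m (move c (lev x))))
    edge-check {p} t {x} {c} c∈ = all-∈ {p = p (K x) (idx x) c}
      (code-check {λ k a c → all (p k a c) (nbrKinds k c)} t {x} c∈) (proj₂ (target {x} c∈))

    private
      rev-ok : ∀ {x c} → c ∈ R x → let k′ = kind m (move c (lev x)) in
               T (pos c <ᵇ size k′) × T (reverse c (idx x) ∈? rot k′ (pos c))
      rev-ok {x} c∈ = ∧⁻ (edge-check {reverse-ok?} rev {x} c∈)

    module _ {x c} (c∈ : c ∈ R x) where

      lev-go : lev (go x c) ≡ move c (lev x)
      lev-go = lev-place (proj₁ (target {x} c∈)) (<ᵇ⇒< _ _ (proj₁ (rev-ok {x} c∈)))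

      idx-go : idx (go x c) ≡ pos c
      idx-go = idx-place (proj₁ (target {x} c∈)) (<ᵇ⇒< _ _ (proj₁ (rev-ok {x} c∈)))

      K-go : K (go x c) ≡ kind m (move c (lev x))
      K-go = cong (kind m) lev-go

      R-go : R (go x c) ≡ rot (kind m (move c (lev x))) (pos c)
      R-go = cong₂ rot K-go idx-go

      code-go : code x (go x c) ≡ c
      code-go = trans (cong₂ (codeOf m (lev x)) lev-go idx-go) (codeOf-move m c (code-allowed {x} c∈))

      code-back : code (go x c) x ≡ reverse c (idx x)
      code-back = trans (cong (λ ℓ → codeOf m ℓ (lev x) (idx x)) lev-go)
        (codeOf-back m c (idx x) {lev x} (code-allowed {x} c∈))

      back-∈ : reverse c (idx x) ∈ R (go x c)
      back-∈ = subst (reverse c (idx x) ∈_) (sym R-go) (∈?⇒∈ _ (proj₂ (rev-ok {x} c∈)))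

      go-back : go (go x c) (reverse c (idx x)) ≡ x
      go-back = place-unique
        (sym (trans (cong (move (reverse c (idx x))) lev-go)
          (move-back m c (idx x) (code-allowed {x} c∈))))
        (sym (pos-reverse c))
        where
        pos-reverse : ∀ c {a} → pos (reverse c a) ≡ a
        pos-reverse (↑ _) = refl
        pos-reverse (• _) = refl
        pos-reverse (↓ _) = refl

      go-≢ : go x c ≢ x
      go-≢ eq = not⁻ (proj₂ (entry-ok {x} c∈)) (≡⇒== (begin
        c                       ≡⟨ code-go ⟨
        code x (go x c)         ≡⟨ cong (code x) eq ⟩
        codeOf m (lev x) (lev x) (idx x) ≡⟨ codeOf-move m (• idx x) {lev x} (self (K x)) ⟩
        • idx x                 ∎))
        where
        open ≡-Reasoning
        self : ∀ k {b} → T (allowed k (• b))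
        self top = tt
        self mid = tt
        self bot = tt

    system : RotationSystem n
    system = record
      { Code = Code ; R = R ; go = go ; code = code ; code-go = λ {x} → code-go {x}
      ; back = λ {x} {c} c∈ → subst (_∈ R (go x c)) (sym (code-back {x} c∈)) (back-∈ {x} c∈)
      ; go-back = λ {x} {c} c∈ → trans (cong (go (go x c)) (code-back {x} c∈)) (go-back {x} c∈)
      ; go-≢ = λ {x} → go-≢ {x} }

    open RotationSystem system public using (graph; edge⁺; edge⁻)

    next : V → Code → Code
    next x = nextIn (R x)

    private
      cyclic-at : ∀ x → T (distinct (R x)) × T (all (cyclic-ok? (R x)) (R x))
      cyclic-at x = ∧⁻ (vertex-check {λ k a → let l = rot k a in distinct l ∧ all (cyclic-ok? l) l} cyclic x)

      next-ok : ∀ {x c} → c ∈ R x → T (next x c ∈? R x)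
        × T (all (reaches (R x) (length (R x)) c) (R x))
      next-ok {x} c∈ = ∧⁻ (all-∈ {p = cyclic-ok? (R x)} (proj₂ (cyclic-at x)) c∈)

    R-unique : ∀ x → Unique (R x)
    R-unique x = distinct⇒unique (R x) (proj₁ (cyclic-at x))

    next-∈ : ∀ {x c} → c ∈ R x → next x c ∈ R x
    next-∈ {x} c∈ = ∈?⇒∈ (R x) (proj₁ (next-ok {x} c∈))

    next-cycle : ∀ {x c d} → c ∈ R x → d ∈ R x → Star (λ a b → next x a ≡ b) c d
    next-cycle {x} {c} {d} c∈ d∈ = reaches-star (R x) (length (R x)) c d
      (all-∈ {p = reaches (R x) (length (R x)) c} (proj₂ (next-ok {x} c∈)) d∈)

    degree : Kind → ℕ → ℕ
    degree k a = length (rot k a)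

    2e≡ : Graph.e graph + Graph.e graph ≡
          kindSum size degree top + (suc m * kindSum size degree mid + kindSum size degree bot)
    2e≡ = trans (sym (RotationSystem.handshake-R system R-unique))
         (trans (sum-grid (λ ℓ → degree (kind m ℓ))) (totalSum-kind size degree m))

    root : V
    root = place zero 0 8

    open Graph graph using (_~_)

    ~-sym : ∀ {x y} → x ~ y → y ~ x
    ~-sym {x} {y} = subst T (Graph.adj-sym graph x y)

    private
      root-at : ∀ ℓ {a} → T (isRoot (kind m ℓ) a) → ℓ ≡ 0 × a ≡ 8
      root-at zero    t = refl , ≡ᵇ⇒≡ _ 8 t
      root-at (suc ℓ) t with below (suc m) ℓ in eq
      ... | top = contradiction eq (below-≢top (suc m) ℓ)

      above : ∀ ℓ {b} → T (allowed (kind m ℓ) (↑ b)) → ∃ λ ℓ′ → ℓ ≡ suc ℓ′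
      above (suc ℓ) _ = ℓ , refl

      nonempty : ∀ {c : Code} {cs} → c ∈ cs → ¬ T (null cs)
      nonempty {cs = _ ∷ _} _ ()

      rankOf : V → ℕ
      rankOf x = rank (K x) (idx x)

      descend : ∀ {x c} → c ∈ R x → x ≡ root ⊎ ∃ λ y → x ~ y × (∃ λ d → d ∈ R y) ×
                (suc (lev y) ≡ lev x ⊎ lev y ≡ lev x × rankOf y < rankOf x)
      descend {x} c∈ with ∨⁻ (vertex-check {descends-ok?} desc x)
      ... | inj₁ empty = contradiction empty (nonempty c∈)
      ... | inj₂ t with ∨⁻ t
      ... | inj₁ isroot = let ℓ≡0 , a≡8 = root-at (lev x) isroot in inj₁ (sym (place-unique ℓ≡0 a≡8))
      ... | inj₂ t′ with any-∃ (descends (K x) (idx x)) (R x) t′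
      ... | d@(• b) , d∈ , lt = inj₂ (go x d , edge⁺ d∈ , (_ , back-∈ {x} d∈) , inj₂ (lev-go {x} d∈ ,
            subst₂ (λ k a → rank k a < rankOf x) (sym (K-go {x} d∈)) (sym (idx-go {x} d∈))
              (<ᵇ⇒< _ _ lt)))
      ... | d@(↑ b) , d∈ , _ = let ℓ′ , eq = above (lev x) (code-allowed {x} d∈) in
            inj₂ (go x d , edge⁺ d∈ , (_ , back-∈ {x} d∈) , inj₁
              (trans (cong suc (trans (lev-go {x} d∈) (cong pred eq))) (sym eq)))

    -- Lexicographic descent on level and rank; in `climb` the number `r` bounds the rank.
    to-root : ∀ {x c} → c ∈ R x → Star _~_ x root
    to-root {x} c∈ = climb (lev x) (suc (rankOf x)) x c∈ refl ≤-refl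
      where
      climb : ∀ ℓ r x {c} → c ∈ R x → lev x ≡ ℓ → rankOf x < r → Star _~_ x root
      climb ℓ (suc r) x c∈ eq (s≤s rank≤) with descend {x} c∈
      ... | inj₁ refl = ε
      ... | inj₂ (y , xy , (_ , d∈) , inj₂ (lev≡ , lt)) =
        xy ◅ climb ℓ r y d∈ (trans lev≡ eq) (≤-trans lt rank≤)
      climb zero    (suc r) x c∈ eq (s≤s rank≤) | inj₂ (y , xy , (_ , d∈) , inj₁ lev≡) =
        contradiction (trans lev≡ eq) λ ()
      climb (suc ℓ) (suc r) x c∈ eq (s≤s rank≤) | inj₂ (y , xy , (_ , d∈) , inj₁ lev≡) =
        -- The rank may grow on the step to the level above, so its bound is renewed.
        xy ◅ climb ℓ (suc (rankOf y)) y d∈ (suc-injective (trans lev≡ eq)) ≤-refl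

-- The tables of G and H.

module Tables where

  open Strip

  -- Positions on the top level: 0–3 are its ring r, 4–7 the rim t of the wheel
  -- with hub 8.  On the other levels 0–3 are the ring and 4–11 the vertices
  -- stacked between it and the ring above.  On the bottom level, 20 + i is the hub
  -- of a wheel with rim i, 12 + i, 24 + i, 16 + i, called b, x, y, z, and 28–55
  -- are stacked vertices.  A row lists the neighbours of a position clockwise,
  -- each with the face to the left of the edge: a face ↓ φ is number φ of the next
  -- level, and • φ number φ of the same level, or of the whole drawing in rowsH.
  rowsG : Kind → List (List (Code × Code))
  rowsG top =
    ((• 1 , ↓ 12) ∷ (• 4 , • 4) ∷ (• 7 , • 11) ∷ (• 3 , • 7) ∷ (↓ 11 , ↓ 21) ∷ (↓ 0 , ↓ 22) ∷
     (↓ 4 , ↓ 2) ∷ (↓ 1 , ↓ 0) ∷ (↓ 8 , ↓ 14) ∷ []) ∷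
    ((• 0 , • 4) ∷ (↓ 8 , ↓ 12) ∷ (↓ 1 , ↓ 13) ∷ (↓ 5 , ↓ 5) ∷ (↓ 2 , ↓ 3) ∷ (↓ 9 , ↓ 17) ∷
     (• 2 , ↓ 15) ∷ (• 5 , • 5) ∷ (• 4 , • 8) ∷ []) ∷
    ((• 1 , • 5) ∷ (↓ 9 , ↓ 15) ∷ (↓ 2 , ↓ 16) ∷ (↓ 6 , ↓ 8) ∷ (↓ 3 , ↓ 6) ∷ (↓ 10 , ↓ 20) ∷
     (• 3 , ↓ 18) ∷ (• 6 , • 6) ∷ (• 5 , • 9) ∷ []) ∷
    ((• 0 , ↓ 21) ∷ (• 7 , • 7) ∷ (• 6 , • 10) ∷ (• 2 , • 6) ∷ (↓ 10 , ↓ 18) ∷ (↓ 3 , ↓ 19) ∷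
     (↓ 7 , ↓ 11) ∷ (↓ 0 , ↓ 9) ∷ (↓ 11 , ↓ 23) ∷ []) ∷
    ((• 0 , • 11) ∷ (• 1 , • 4) ∷ (• 5 , • 8) ∷ (• 8 , • 0) ∷ (• 7 , • 3) ∷ []) ∷
    ((• 1 , • 8) ∷ (• 2 , • 5) ∷ (• 6 , • 9) ∷ (• 8 , • 1) ∷ (• 4 , • 0) ∷ []) ∷
    ((• 2 , • 9) ∷ (• 3 , • 6) ∷ (• 7 , • 10) ∷ (• 8 , • 2) ∷ (• 5 , • 1) ∷ []) ∷
    ((• 0 , • 7) ∷ (• 4 , • 11) ∷ (• 8 , • 3) ∷ (• 6 , • 2) ∷ (• 3 , • 10) ∷ []) ∷
    ((• 4 , • 3) ∷ (• 5 , • 0) ∷ (• 6 , • 1) ∷ (• 7 , • 2) ∷ []) ∷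
    []
  rowsG mid =
    ((↑ 0 , • 2) ∷ (• 11 , • 22) ∷ (↑ 3 , • 23) ∷ (• 7 , • 9) ∷ (• 3 , • 10) ∷ (↓ 11 , ↓ 21) ∷
     (↓ 0 , ↓ 22) ∷ (↓ 4 , ↓ 2) ∷ (↓ 1 , ↓ 0) ∷ (↓ 8 , ↓ 14) ∷ (• 1 , ↓ 12) ∷ (• 4 , • 1) ∷ []) ∷
    ((↑ 0 , • 14) ∷ (• 4 , • 0) ∷ (• 0 , • 1) ∷ (↓ 8 , ↓ 12) ∷ (↓ 1 , ↓ 13) ∷ (↓ 5 , ↓ 5) ∷
     (↓ 2 , ↓ 3) ∷ (↓ 9 , ↓ 17) ∷ (• 2 , ↓ 15) ∷ (• 5 , • 4) ∷ (↑ 1 , • 5) ∷ (• 8 , • 13) ∷ []) ∷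
    ((↑ 1 , • 17) ∷ (• 5 , • 3) ∷ (• 1 , • 4) ∷ (↓ 9 , ↓ 15) ∷ (↓ 2 , ↓ 16) ∷ (↓ 6 , ↓ 8) ∷
     (↓ 3 , ↓ 6) ∷ (↓ 10 , ↓ 20) ∷ (• 3 , ↓ 18) ∷ (• 6 , • 7) ∷ (↑ 2 , • 8) ∷ (• 9 , • 16) ∷ []) ∷
    ((↑ 2 , • 20) ∷ (• 6 , • 6) ∷ (• 2 , • 7) ∷ (↓ 10 , ↓ 18) ∷ (↓ 3 , ↓ 19) ∷ (↓ 7 , ↓ 11) ∷
     (↓ 0 , ↓ 9) ∷ (↓ 11 , ↓ 23) ∷ (• 0 , ↓ 21) ∷ (• 7 , • 10) ∷ (↑ 3 , • 11) ∷ (• 10 , • 19) ∷ []) ∷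
    ((↑ 0 , • 0) ∷ (• 0 , • 2) ∷ (• 1 , • 1) ∷ []) ∷
    ((↑ 1 , • 3) ∷ (• 1 , • 5) ∷ (• 2 , • 4) ∷ []) ∷
    ((↑ 2 , • 6) ∷ (• 2 , • 8) ∷ (• 3 , • 7) ∷ []) ∷
    ((↑ 3 , • 9) ∷ (• 3 , • 11) ∷ (• 0 , • 10) ∷ []) ∷
    ((↑ 0 , • 12) ∷ (• 1 , • 14) ∷ (↑ 1 , • 13) ∷ []) ∷
    ((↑ 1 , • 15) ∷ (• 2 , • 17) ∷ (↑ 2 , • 16) ∷ []) ∷
    ((↑ 2 , • 18) ∷ (• 3 , • 20) ∷ (↑ 3 , • 19) ∷ []) ∷
    ((↑ 0 , • 22) ∷ (↑ 3 , • 21) ∷ (• 0 , • 23) ∷ []) ∷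
    []
  rowsG bot =
    ((↑ 0 , • 2) ∷ (• 11 , • 22) ∷ (↑ 3 , • 23) ∷ (• 7 , • 9) ∷ (• 3 , • 10) ∷ (• 49 , • 87) ∷
     (• 19 , • 88) ∷ (• 50 , • 92) ∷ (• 12 , • 90) ∷ (• 30 , • 32) ∷ (• 20 , • 30) ∷ (• 33 , • 40) ∷
     (• 16 , • 41) ∷ (• 28 , • 26) ∷ (• 1 , • 24) ∷ (• 4 , • 1) ∷ []) ∷
    ((↑ 0 , • 14) ∷ (• 4 , • 0) ∷ (• 0 , • 1) ∷ (• 28 , • 24) ∷ (• 16 , • 25) ∷ (• 29 , • 29) ∷
     (• 13 , • 27) ∷ (• 37 , • 53) ∷ (• 21 , • 51) ∷ (• 40 , • 61) ∷ (• 17 , • 62) ∷ (• 35 , • 47) ∷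
     (• 2 , • 45) ∷ (• 5 , • 4) ∷ (↑ 1 , • 5) ∷ (• 8 , • 13) ∷ []) ∷
    ((↑ 1 , • 17) ∷ (• 5 , • 3) ∷ (• 1 , • 4) ∷ (• 35 , • 45) ∷ (• 17 , • 46) ∷ (• 36 , • 50) ∷
     (• 14 , • 48) ∷ (• 44 , • 74) ∷ (• 22 , • 72) ∷ (• 47 , • 82) ∷ (• 18 , • 83) ∷ (• 42 , • 68) ∷
     (• 3 , • 66) ∷ (• 6 , • 7) ∷ (↑ 2 , • 8) ∷ (• 9 , • 16) ∷ []) ∷
    ((↑ 2 , • 20) ∷ (• 6 , • 6) ∷ (• 2 , • 7) ∷ (• 42 , • 66) ∷ (• 18 , • 67) ∷ (• 43 , • 71) ∷
     (• 15 , • 69) ∷ (• 51 , • 95) ∷ (• 23 , • 93) ∷ (• 54 , • 103) ∷ (• 19 , • 104) ∷ (• 49 , • 89) ∷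
     (• 0 , • 87) ∷ (• 7 , • 10) ∷ (↑ 3 , • 11) ∷ (• 10 , • 19) ∷ []) ∷
    ((↑ 0 , • 0) ∷ (• 0 , • 2) ∷ (• 1 , • 1) ∷ []) ∷
    ((↑ 1 , • 3) ∷ (• 1 , • 5) ∷ (• 2 , • 4) ∷ []) ∷
    ((↑ 2 , • 6) ∷ (• 2 , • 8) ∷ (• 3 , • 7) ∷ []) ∷
    ((↑ 3 , • 9) ∷ (• 3 , • 11) ∷ (• 0 , • 10) ∷ []) ∷
    ((↑ 0 , • 12) ∷ (• 1 , • 14) ∷ (↑ 1 , • 13) ∷ []) ∷
    ((↑ 1 , • 15) ∷ (• 2 , • 17) ∷ (↑ 2 , • 16) ∷ []) ∷
    ((↑ 2 , • 18) ∷ (• 3 , • 20) ∷ (↑ 3 , • 19) ∷ []) ∷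
    ((↑ 0 , • 22) ∷ (↑ 3 , • 21) ∷ (• 0 , • 23) ∷ []) ∷
    ((• 0 , • 32) ∷ (• 50 , • 90) ∷ (• 19 , • 91) ∷ (• 55 , • 106) ∷ (• 27 , • 107) ∷ (• 24 , • 111) ∷
     (• 31 , • 35) ∷ (• 20 , • 33) ∷ (• 30 , • 31) ∷ []) ∷
    ((• 1 , • 53) ∷ (• 29 , • 27) ∷ (• 16 , • 28) ∷ (• 34 , • 43) ∷ (• 24 , • 44) ∷ (• 25 , • 108) ∷
     (• 38 , • 56) ∷ (• 21 , • 54) ∷ (• 37 , • 52) ∷ []) ∷
    ((• 2 , • 74) ∷ (• 36 , • 48) ∷ (• 17 , • 49) ∷ (• 41 , • 64) ∷ (• 25 , • 65) ∷ (• 26 , • 109) ∷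
     (• 45 , • 77) ∷ (• 22 , • 75) ∷ (• 44 , • 73) ∷ []) ∷
    ((• 3 , • 95) ∷ (• 43 , • 69) ∷ (• 18 , • 70) ∷ (• 48 , • 85) ∷ (• 26 , • 86) ∷ (• 27 , • 110) ∷
     (• 52 , • 98) ∷ (• 23 , • 96) ∷ (• 51 , • 94) ∷ []) ∷
    ((• 0 , • 26) ∷ (• 33 , • 41) ∷ (• 20 , • 39) ∷ (• 32 , • 37) ∷ (• 24 , • 38) ∷ (• 34 , • 42) ∷
     (• 13 , • 43) ∷ (• 29 , • 28) ∷ (• 1 , • 29) ∷ (• 28 , • 25) ∷ []) ∷
    ((• 1 , • 47) ∷ (• 40 , • 62) ∷ (• 21 , • 60) ∷ (• 39 , • 58) ∷ (• 25 , • 59) ∷ (• 41 , • 63) ∷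
     (• 14 , • 64) ∷ (• 36 , • 49) ∷ (• 2 , • 50) ∷ (• 35 , • 46) ∷ []) ∷
    ((• 2 , • 68) ∷ (• 47 , • 83) ∷ (• 22 , • 81) ∷ (• 46 , • 79) ∷ (• 26 , • 80) ∷ (• 48 , • 84) ∷
     (• 15 , • 85) ∷ (• 43 , • 70) ∷ (• 3 , • 71) ∷ (• 42 , • 67) ∷ []) ∷
    ((• 0 , • 92) ∷ (• 49 , • 88) ∷ (• 3 , • 89) ∷ (• 54 , • 104) ∷ (• 23 , • 102) ∷ (• 53 , • 100) ∷
     (• 27 , • 101) ∷ (• 55 , • 105) ∷ (• 12 , • 106) ∷ (• 50 , • 91) ∷ []) ∷
    ((• 0 , • 40) ∷ (• 30 , • 30) ∷ (• 12 , • 31) ∷ (• 31 , • 33) ∷ (• 24 , • 34) ∷ (• 32 , • 36) ∷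
     (• 16 , • 37) ∷ (• 33 , • 39) ∷ []) ∷
    ((• 1 , • 61) ∷ (• 37 , • 51) ∷ (• 13 , • 52) ∷ (• 38 , • 54) ∷ (• 25 , • 55) ∷ (• 39 , • 57) ∷
     (• 17 , • 58) ∷ (• 40 , • 60) ∷ []) ∷
    ((• 2 , • 82) ∷ (• 44 , • 72) ∷ (• 14 , • 73) ∷ (• 45 , • 75) ∷ (• 26 , • 76) ∷ (• 46 , • 78) ∷
     (• 18 , • 79) ∷ (• 47 , • 81) ∷ []) ∷
    ((• 3 , • 103) ∷ (• 51 , • 93) ∷ (• 15 , • 94) ∷ (• 52 , • 96) ∷ (• 27 , • 97) ∷ (• 53 , • 99) ∷
     (• 19 , • 100) ∷ (• 54 , • 102) ∷ []) ∷
    ((• 12 , • 35) ∷ (• 27 , • 111) ∷ (• 26 , • 113) ∷ (• 25 , • 112) ∷ (• 13 , • 108) ∷ (• 34 , • 44)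
      ∷
     (• 16 , • 42) ∷ (• 32 , • 38) ∷ (• 20 , • 36) ∷ (• 31 , • 34) ∷ []) ∷
    ((• 13 , • 56) ∷ (• 24 , • 108) ∷ (• 26 , • 112) ∷ (• 14 , • 109) ∷ (• 41 , • 65) ∷ (• 17 , • 63)
      ∷
     (• 39 , • 59) ∷ (• 21 , • 57) ∷ (• 38 , • 55) ∷ []) ∷
    ((• 14 , • 77) ∷ (• 25 , • 109) ∷ (• 24 , • 112) ∷ (• 27 , • 113) ∷ (• 15 , • 110) ∷ (• 48 , • 86)
      ∷
     (• 18 , • 84) ∷ (• 46 , • 80) ∷ (• 22 , • 78) ∷ (• 45 , • 76) ∷ []) ∷
    ((• 12 , • 111) ∷ (• 55 , • 107) ∷ (• 19 , • 105) ∷ (• 53 , • 101) ∷ (• 23 , • 99) ∷ (• 52 , • 97)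
      ∷
     (• 15 , • 98) ∷ (• 26 , • 110) ∷ (• 24 , • 113) ∷ []) ∷
    ((• 0 , • 24) ∷ (• 16 , • 26) ∷ (• 1 , • 25) ∷ []) ∷
    ((• 1 , • 27) ∷ (• 16 , • 29) ∷ (• 13 , • 28) ∷ []) ∷
    ((• 0 , • 30) ∷ (• 12 , • 32) ∷ (• 20 , • 31) ∷ []) ∷
    ((• 12 , • 33) ∷ (• 24 , • 35) ∷ (• 20 , • 34) ∷ []) ∷
    ((• 16 , • 38) ∷ (• 20 , • 37) ∷ (• 24 , • 36) ∷ []) ∷
    ((• 0 , • 41) ∷ (• 20 , • 40) ∷ (• 16 , • 39) ∷ []) ∷
    ((• 13 , • 44) ∷ (• 16 , • 43) ∷ (• 24 , • 42) ∷ []) ∷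
    ((• 1 , • 45) ∷ (• 17 , • 47) ∷ (• 2 , • 46) ∷ []) ∷
    ((• 2 , • 48) ∷ (• 17 , • 50) ∷ (• 14 , • 49) ∷ []) ∷
    ((• 1 , • 51) ∷ (• 13 , • 53) ∷ (• 21 , • 52) ∷ []) ∷
    ((• 13 , • 54) ∷ (• 25 , • 56) ∷ (• 21 , • 55) ∷ []) ∷
    ((• 17 , • 59) ∷ (• 21 , • 58) ∷ (• 25 , • 57) ∷ []) ∷
    ((• 1 , • 62) ∷ (• 21 , • 61) ∷ (• 17 , • 60) ∷ []) ∷
    ((• 14 , • 65) ∷ (• 17 , • 64) ∷ (• 25 , • 63) ∷ []) ∷
    ((• 2 , • 66) ∷ (• 18 , • 68) ∷ (• 3 , • 67) ∷ []) ∷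
    ((• 3 , • 69) ∷ (• 18 , • 71) ∷ (• 15 , • 70) ∷ []) ∷
    ((• 2 , • 72) ∷ (• 14 , • 74) ∷ (• 22 , • 73) ∷ []) ∷
    ((• 14 , • 75) ∷ (• 26 , • 77) ∷ (• 22 , • 76) ∷ []) ∷
    ((• 18 , • 80) ∷ (• 22 , • 79) ∷ (• 26 , • 78) ∷ []) ∷
    ((• 2 , • 83) ∷ (• 22 , • 82) ∷ (• 18 , • 81) ∷ []) ∷
    ((• 15 , • 86) ∷ (• 18 , • 85) ∷ (• 26 , • 84) ∷ []) ∷
    ((• 0 , • 88) ∷ (• 3 , • 87) ∷ (• 19 , • 89) ∷ []) ∷
    ((• 0 , • 90) ∷ (• 19 , • 92) ∷ (• 12 , • 91) ∷ []) ∷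
    ((• 3 , • 93) ∷ (• 15 , • 95) ∷ (• 23 , • 94) ∷ []) ∷
    ((• 15 , • 96) ∷ (• 27 , • 98) ∷ (• 23 , • 97) ∷ []) ∷
    ((• 19 , • 101) ∷ (• 23 , • 100) ∷ (• 27 , • 99) ∷ []) ∷
    ((• 3 , • 104) ∷ (• 23 , • 103) ∷ (• 19 , • 102) ∷ []) ∷
    ((• 12 , • 107) ∷ (• 19 , • 106) ∷ (• 27 , • 105) ∷ []) ∷
    []

  -- The 22 faces of the drawing. Columns 1, 2, 3 lie in the triangles ht₁t₂, ht₂t₃, ht₃t₀ of the
  -- top wheel, which become faces 2, 3, 0. Column 0 lies outside the wheel in face 5, from which
  -- the edge r₀t₃ cuts off the triangle r₀t₃t₀ as face 4. Face 1 is the triangle ht₀t₁ and contains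
  -- the isolated vertices. Faces 6-21 are the triangles of the bottom wheels, four for each.
  rowsH : Kind → List (List (Code × Code))
  rowsH top =
    ((↓ 0 , • 5) ∷ (• 4 , • 5) ∷ (• 7 , • 4) ∷ []) ∷
    ((• 5 , • 2) ∷ (↓ 1 , • 2) ∷ []) ∷
    ((• 6 , • 3) ∷ (↓ 2 , • 3) ∷ []) ∷
    ((• 7 , • 0) ∷ (↓ 3 , • 0) ∷ []) ∷
    ((• 0 , • 4) ∷ (• 5 , • 5) ∷ (• 8 , • 1) ∷ (• 7 , • 0) ∷ []) ∷
    ((• 6 , • 5) ∷ (• 1 , • 2) ∷ (• 8 , • 2) ∷ (• 4 , • 1) ∷ []) ∷
    ((• 7 , • 5) ∷ (• 2 , • 3) ∷ (• 8 , • 3) ∷ (• 5 , • 2) ∷ []) ∷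
    ((• 0 , • 5) ∷ (• 4 , • 4) ∷ (• 3 , • 0) ∷ (• 8 , • 0) ∷ (• 6 , • 3) ∷ []) ∷
    ((• 4 , • 0) ∷ (• 5 , • 1) ∷ (• 6 , • 2) ∷ (• 7 , • 3) ∷ []) ∷
    []
  rowsH mid =
    ((↑ 0 , • 5) ∷ (↓ 0 , • 5) ∷ []) ∷
    ((↑ 1 , • 2) ∷ (↓ 1 , • 2) ∷ []) ∷
    ((↑ 2 , • 3) ∷ (↓ 2 , • 3) ∷ []) ∷
    ((↑ 3 , • 0) ∷ (↓ 3 , • 0) ∷ []) ∷
    [] ∷
    [] ∷
    [] ∷
    [] ∷
    [] ∷
    [] ∷
    [] ∷
    [] ∷
    []
  rowsH bot =
    ((↑ 0 , • 5) ∷ (• 12 , • 5) ∷ (• 20 , • 7) ∷ (• 16 , • 6) ∷ []) ∷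
    ((↑ 1 , • 2) ∷ (• 13 , • 2) ∷ (• 21 , • 11) ∷ (• 17 , • 10) ∷ []) ∷
    ((↑ 2 , • 3) ∷ (• 14 , • 3) ∷ (• 22 , • 15) ∷ (• 18 , • 14) ∷ []) ∷
    ((↑ 3 , • 0) ∷ (• 15 , • 0) ∷ (• 23 , • 19) ∷ (• 19 , • 18) ∷ []) ∷
    [] ∷
    [] ∷
    [] ∷
    [] ∷
    [] ∷
    [] ∷
    [] ∷
    [] ∷
    ((• 24 , • 5) ∷ (• 20 , • 8) ∷ (• 0 , • 7) ∷ []) ∷
    ((• 25 , • 2) ∷ (• 21 , • 12) ∷ (• 1 , • 11) ∷ []) ∷
    ((• 26 , • 3) ∷ (• 22 , • 16) ∷ (• 2 , • 15) ∷ []) ∷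
    ((• 27 , • 0) ∷ (• 23 , • 20) ∷ (• 3 , • 19) ∷ []) ∷
    ((• 0 , • 5) ∷ (• 20 , • 6) ∷ (• 24 , • 9) ∷ []) ∷
    ((• 1 , • 2) ∷ (• 21 , • 10) ∷ (• 25 , • 13) ∷ []) ∷
    ((• 2 , • 3) ∷ (• 22 , • 14) ∷ (• 26 , • 17) ∷ []) ∷
    ((• 3 , • 0) ∷ (• 23 , • 18) ∷ (• 27 , • 21) ∷ []) ∷
    ((• 0 , • 6) ∷ (• 12 , • 7) ∷ (• 24 , • 8) ∷ (• 16 , • 9) ∷ []) ∷
    ((• 1 , • 10) ∷ (• 13 , • 11) ∷ (• 25 , • 12) ∷ (• 17 , • 13) ∷ []) ∷
    ((• 2 , • 14) ∷ (• 14 , • 15) ∷ (• 26 , • 16) ∷ (• 18 , • 17) ∷ []) ∷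
    ((• 3 , • 18) ∷ (• 15 , • 19) ∷ (• 27 , • 20) ∷ (• 19 , • 21) ∷ []) ∷
    ((• 16 , • 5) ∷ (• 20 , • 9) ∷ (• 12 , • 8) ∷ []) ∷
    ((• 17 , • 2) ∷ (• 21 , • 13) ∷ (• 13 , • 12) ∷ []) ∷
    ((• 18 , • 3) ∷ (• 22 , • 17) ∷ (• 14 , • 16) ∷ []) ∷
    ((• 19 , • 0) ∷ (• 23 , • 21) ∷ (• 15 , • 20) ∷ []) ∷
    [] ∷
    [] ∷
    [] ∷
    [] ∷
    [] ∷
    [] ∷
    [] ∷
    [] ∷
    [] ∷
    [] ∷
    [] ∷
    [] ∷
    [] ∷
    [] ∷
    [] ∷
    [] ∷
    [] ∷
    [] ∷
    [] ∷
    [] ∷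
    [] ∷
    [] ∷
    [] ∷
    [] ∷
    [] ∷
    [] ∷
    [] ∷
    [] ∷
    []

  checkedG : Checked rowsG
  checkedG = record { entries = valid tt ; desc = valid tt ; rev = valid tt ; cyclic = valid tt }

  checkedH : Checked rowsH
  checkedH = record { entries = valid tt ; desc = valid tt ; rev = valid tt ; cyclic = valid tt }

-- G is a maximal planar graph.

module Triangulation where

  open import Data.Nat.Base
  open import Data.Nat.Properties
  open import Data.Nat.Solver using (module +-*-Solver)
  import Relation.Binary.Construct.Closure.Equivalence as EqC
  open import Relation.Binary.Construct.Closure.ReflexiveTransitive as Star using (Star; _◅_; _◅◅_)
  open import Relation.Binary.PropositionalEquality
  open Counting
  open Layers
  open Rotation
  open Strip
  open Tables

  open Table rowsG

  private
    -- The 12 triangles at the top contain no stacked vertex. Between two rings there are 8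
    -- triangles of T, each split into three: 24, counted on the lower level. The bottom has 28
    -- further split triangles and 6 unsplit ones: 24 + 84 + 6 = 114.
    faceSize : Kind → ℕ
    faceSize top = 12
    faceSize mid = 24
    faceSize bot = 114

    walk-okG : Valid (forEdges walk-ok?)
    walk-okG = valid tt

    corner? : Kind → ℕ → Bool
    corner? k φ = any (λ a → any (λ c → faceCode k a c == (• φ)) (rot k a)) (upTo (size k))

    -- Every face number is in use; this joins each face to a vertex, as `connected` requires.
    cornersG : Valid (forKinds λ k → below? (faceSize k) (corner? k))
    cornersG = valid tt

    degree≥2 : Valid (forVertices λ k a → 1 <ᵇ length (rot k a))
    degree≥2 = valid tt

  module G (m : ℕ) = OnStrip checkedG m

  module _ (m : ℕ) where
    open G m hiding (rot; forVertices; forEdges; faceCode; walk-ok?)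

    private
      module F = Grid (faceSize ∘ kind m) (levels m)

      f : ℕ
      f = total (faceSize ∘ kind m) (levels m)

      left : V → Code → Fin f
      left x c = let φ = faceCode (K x) (idx x) c in F.place zero (move φ (lev x)) (pos φ)

      left-walk : ∀ {x c} → c ∈ R x → left x c ≡ left (go x c) (next (go x c) (code (go x c) x))
      left-walk {x} {c} c∈ rewrite code-back {x} c∈ | R-go {x} c∈ | K-go {x} c∈ | lev-go {x} c∈ |
        idx-go {x} c∈ =
        let k = kind m (move c (lev x))
            φ  = faceCode (K x) (idx x) c
            φ′ = faceCode k (pos c) (nextIn (rot k (pos c)) (reverse c (idx x)))
            p , q = ∧⁻ (edge-check {walk-ok?} walk-okG {x} c∈)
        in cong₂ (F.place zero) (composes-move c φ′ φ {m} {lev x} (code-allowed {x} c∈) q)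
              (≡ᵇ⇒≡ (pos φ) (pos φ′) p)

      embedded : Embedded system
      embedded = record
        { next = next ; next-∈ = λ {x} → next-∈ {x} ; next-cycle = λ {x} → next-cycle {x}
        ; f = f ; left = left ; left-walk = λ {x} → left-walk {x} ; around = λ _ → zero }

      open Graph graph using (_~_)
      open FaceStructure (Embedded.faces embedded) using (Incident; edge; corner)

      twoCodes : ∀ x → ∃ λ c → ∃ λ d → c ∈ R x × d ∈ R x × c ≢ d
      twoCodes x = first (R x) (R-unique x) (vertex-check {λ k a → 1 <ᵇ length (rot k a)} degree≥2 x)
        where
        first : ∀ cs → Unique cs → T (1 <ᵇ length cs) → ∃ λ c → ∃ λ d → c ∈ cs × d ∈ cs × c ≢ d
        first (c ∷ d ∷ _) ((c≢d ∷ _) ∷ _) _ = c , d , here refl , there (here refl) , c≢d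

      vertex-root : ∀ x → Star _~_ x root
      vertex-root x = let _ , _ , c∈ , _ = twoCodes x in to-root {x} c∈

      cornerOf : ∀ φ → ∃ λ x → ∃ λ c → c ∈ R x × left x c ≡ φ
      cornerOf φ =
        let ℓ = F.lev φ
            k = kind m ℓ
            t = all-< {corner? k} (all-kinds {λ k → below? (faceSize k) (corner? k)} cornersG k)
              (F.idx< φ)
            a , a∈ , s = any-∃ (λ a → any (λ c → faceCode k a c == (• F.idx φ)) (rot k a))
              (upTo (size k)) t
            c , c∈ , eq = any-∃ (λ c → faceCode k a c == (• F.idx φ)) (rot k a) s
            a< = ∈-upTo⁻ a∈
            x = place zero ℓ a
            lx = lev-place {zero} (F.lev< φ) a<
            ix = idx-place {zero} (F.lev< φ) a<
            Rx : R x ≡ rot k a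
            Rx = cong₂ rot (cong (kind m) lx) ix
            code≡ : faceCode (K x) (idx x) c ≡ • F.idx φ
            code≡ = trans (cong₂ (λ k a → faceCode k a c) (cong (kind m) lx) ix) (==⇒≡ _ _ eq)
        in x , c , subst (c ∈_) (sym Rx) c∈ ,
           trans (cong (λ d → F.place zero (move d (lev x)) (pos d)) code≡)
                 (F.place-unique (sym lx) refl)

      to-rootᴵ : ∀ p → EqClosure Incident p (inj₁ root)
      to-rootᴵ (inj₁ x) = Star.gmap inj₁ (fwd ∘ edge) (vertex-root x)
      to-rootᴵ (inj₂ φ) = let x , c , c∈ , eq = cornerOf φ in
        bwd (corner (inj₁ (go x c , edge⁺ c∈ , trans (cong (left x) (code-go {x} c∈)) eq))) ◅ to-rootᴵ
          (inj₁ x)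

      2e : Graph.e graph + Graph.e graph ≡ 378 + suc m * 72
      -- The degree sums 60, 72 and 318 of the three kinds of level are computed from the table.
      2e = trans 2e≡ (solve 1 (λ k → con 60 :+ (k :* con 72 :+ con 318) := con 378 :+ k :* con 72)
        refl (suc m))
        where open +-*-Solver

      e≡ : Graph.e graph ≡ 189 + suc m * 36
      e≡ = *-cancelˡ-≡ _ _ 2 (trans (solve 1 (λ e → con 2 :* e := e :+ e) refl (Graph.e graph))
             (trans 2e (solve 1 (λ k → con 378 :+ k :* con 72 := con 2 :* (con 189 :+ k :* con 36))
               refl (suc m))))
        where open +-*-Solver

      f≡ : f ≡ 126 + suc m * 24
      f≡ = trans (total-kind faceSize m)
        (solve 1 (λ k → con 12 :+ (k :* con 24 :+ con 114) := con 126 :+ k :* con 24) refl (suc m))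
        where open +-*-Solver

    n≡ : n ≡ 65 + suc m * 12
    n≡ = trans (total-kind size m)
      (solve 1 (λ k → con 9 :+ (k :* con 12 :+ con 56) := con 65 :+ k :* con 12) refl (suc m))
      where open +-*-Solver

    planarG : PlaneEmbedding graph
    planarG = record
      { faces = Embedded.faces embedded
      ; connected = λ p q → to-rootᴵ p ◅◅ EqC.symmetric _ (to-rootᴵ q)
      ; c = 1
      ; component = λ _ → zero
      ; component-onto = λ { zero → root , λ _ → refl }
      ; component-≡ = λ x y → mk⇔ (λ _ → vertex-root x ◅◅ Star.reverse ~-sym (vertex-root y))
        (λ _ → refl)
      ; euler = trans (cong₂ _+_ n≡ f≡) (trans (eq (suc m)) (cong (λ e → 1 + e + 1) (sym e≡)))
      }
      where
      open +-*-Solver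
      eq : ∀ k → 65 + k * 12 + (126 + k * 24) ≡ 1 + (189 + k * 36) + 1
      eq = solve 1 (λ k → con 65 :+ k :* con 12 :+ (con 126 :+ k :* con 24) := con 1 :+
        (con 189 :+ k :* con 36) :+ con 1) refl

    maximalPlanarG : MaximalPlanar graph
    maximalPlanarG = triangulation⇒maximal planarG root
      (trans (cong (_+ 6) e≡) (trans (eq (suc m)) (cong (3 *_) (sym n≡))))
      λ x → let c , d , c∈ , d∈ , c≢d = twoCodes x in
        go x c , go x d , edge⁺ c∈ , edge⁺ d∈ ,
        λ p → c≢d (trans (sym (code-go {x} c∈)) (trans (cong (code x) p) (code-go {x} d∈)))
      where
      open +-*-Solver
      eq : ∀ k → 189 + k * 36 + 6 ≡ 3 * (65 + k * 12)
      eq = solve 1 (λ k → con 189 :+ k :* con 36 :+ con 6 := con 3 :* (con 65 :+ k :* con 12)) refl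

-- H is a plane graph.

module Sparse where

  open import Data.Fin.Properties using (toℕ<n; toℕ-fromℕ<; toℕ-injective)
  open import Data.Nat.Base
  open import Data.Nat.Properties
  open import Data.Nat.Solver using (module +-*-Solver)
  import Relation.Binary.Construct.Closure.Equivalence as EqC
  open import Relation.Binary.Construct.Closure.ReflexiveTransitive as Star using (Star; ε; _◅_; _◅◅_)
  open import Relation.Binary.PropositionalEquality
  open Counting
  open Layers
  open Rotation
  open Strip
  open Tables

  open Table rowsH

  module H (m : ℕ) = OnStrip checkedH m

  abstract

    face : ℕ → Fin 22
    face k with k <? 22
    ... | yes k< = fromℕ< k<
    ... | no _   = zero

    toℕ-face : ∀ {k} → k < 22 → toℕ (face k) ≡ k
    toℕ-face {k} k< with k <? 22
    ... | yes p = toℕ-fromℕ< p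
    ... | no ¬p = contradiction k< ¬p

  faceNo : Kind → ℕ → Code → ℕ
  faceNo k a c = pos (faceCode k a c)

  isolated? : Kind → ℕ → Bool
  isolated? k a = null (rot k a)

  private
    walk-okH? : Kind → ℕ → Code → Kind → Bool
    walk-okH? k a c k′ = faceNo k a c ≡ᵇ faceNo k′ (pos c) (nextIn (rot k′ (pos c)) (reverse c a))

    walk-okH : Valid (forEdges walk-okH?)
    walk-okH = valid tt

    face<22 : Valid (forVertices λ k a → all (λ c → faceNo k a c <ᵇ 22) (rot k a))
    face<22 = valid tt

    corner? : Kind → ℕ → Bool
    corner? k φ = any (λ a → any (λ c → faceNo k a c ≡ᵇ φ) (rot k a)) (upTo (size k))

    -- Faces 0-5 have a corner on the top level and the wheel triangles 6-21 one at the bottom, so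
    -- the middle levels need not be searched.
    cornersH : Valid (below? 22 λ φ → corner? top φ ∨ corner? bot φ)
    cornersH = valid tt

    -- The isolated vertices of a level are numbered consecutively.
    isolatedCount : Kind → ℕ
    isolatedCount top = 0
    isolatedCount mid = 8
    isolatedCount bot = 36

    -- Positions 4-11 close up to 0-7, and positions 28-55 at the bottom to 8-35.
    number unnumber : Kind → ℕ → ℕ
    number   k a = if a <ᵇ 12 then a ∸ 4 else a ∸ 20
    unnumber k b = if b <ᵇ 8 then b + 4 else b + 20

    number-ok? : Kind → ℕ → Bool
    number-ok? k a = not (isolated? k a)
      ∨ ((number k a <ᵇ isolatedCount k) ∧ (unnumber k (number k a) ≡ᵇ a))

    number-ok : Valid (forVertices number-ok?)
    number-ok = valid tt

    unnumber-ok? : Kind → ℕ → Bool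
    unnumber-ok? k b = (unnumber k b <ᵇ size k)
      ∧ (isolated? k (unnumber k b) ∧ (number k (unnumber k b) ≡ᵇ b))

    unnumber-ok : Valid (forKinds λ k → below? (isolatedCount k) (unnumber-ok? k))
    unnumber-ok = valid tt

  -- The triangle ht₀t₁, the only one of the five faces of the top wheel that contains no column.
  isoFace : Fin 22
  isoFace = face 1

  -- A case distinction on `b` with evidence in both branches, in which `b` itself is not replaced
  -- in the goal.
  data Side (b : Bool) : Set where
    holds : T b → Side b
    fails : ¬ T b → Side b

  side : ∀ b → Side b
  side true  = holds tt
  side false = fails λ ()

  module _ (m : ℕ) where
    open H m hiding (rot; forVertices; forEdges; faceCode; walk-ok?)

    isolated : V → Bool
    isolated x = isolated? (K x) (idx x)

    leftH : V → Code → Fin 22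
    leftH x c = face (faceNo (K x) (idx x) c)

    toℕ-left : ∀ {x c} → c ∈ R x → toℕ (leftH x c) ≡ faceNo (K x) (idx x) c
    toℕ-left {x} c∈ = toℕ-face (<ᵇ⇒< _ _ (code-check {λ k a c → faceNo k a c <ᵇ 22} face<22 {x} c∈))

    private
      left-walk : ∀ {x c} → c ∈ R x → leftH x c ≡ leftH (go x c) (next (go x c) (code (go x c) x))
      left-walk {x} {c} c∈ rewrite code-back {x} c∈ | R-go {x} c∈ | K-go {x} c∈ | idx-go {x} c∈ =
        cong face (≡ᵇ⇒≡ _ _ (edge-check {walk-okH?} walk-okH {x} c∈))

    embeddedH : Embedded system
    embeddedH = record
      { next = next ; next-∈ = λ {x} → next-∈ {x} ; next-cycle = λ {x} → next-cycle {x}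
      ; f = 22 ; left = leftH ; left-walk = λ {x} → left-walk {x} ; around = λ _ → isoFace }

    open Graph graph using (_~_)
    open FaceStructure (Embedded.faces embeddedH) using (Incident; edge; corner)

    private
      bot-level : kind m (2 + m) ≡ bot
      bot-level = below-bot {suc m}

      cornerAt : ∀ k ℓ → ℓ < levels m → kind m ℓ ≡ k → ∀ φ → T (corner? k (toℕ φ)) →
                 ∃ λ x → ∃ λ c → c ∈ R x × leftH x c ≡ φ
      cornerAt k ℓ ℓ< refl φ t =
        let a , a∈ , s = any-∃ (λ a → any (λ c → faceNo k a c ≡ᵇ toℕ φ) (rot k a)) (upTo (size k)) t
            c , c∈ , eq = any-∃ (λ c → faceNo k a c ≡ᵇ toℕ φ) (rot k a) s
            x = place zero ℓ a
            lx = cong (kind m) (lev-place {zero} ℓ< (∈-upTo⁻ a∈))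
            ix = idx-place {zero} ℓ< (∈-upTo⁻ a∈)
            c∈x = subst (c ∈_) (sym (cong₂ rot lx ix)) c∈
        in x , c , c∈x , toℕ-injective (trans (toℕ-left {x} c∈x)
             (trans (cong₂ (λ k a → faceNo k a c) lx ix) (≡ᵇ⇒≡ _ _ eq)))

      cornerOf : ∀ φ → ∃ λ x → ∃ λ c → c ∈ R x × leftH x c ≡ φ
      cornerOf φ with ∨⁻ (valid-∈ {p = λ φ → corner? top φ ∨ corner? bot φ} cornersH
        (∈-upTo⁺ (toℕ<n φ)))
      ... | inj₁ t = cornerAt top 0 (s≤s z≤n) refl φ t
      ... | inj₂ t = cornerAt bot (2 + m) ≤-refl bot-level φ t

    isolated-∉ : ∀ {x c} → T (isolated x) → ¬ c ∈ R x
    isolated-∉ {x} iso c∈ with R x | c∈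
    ... | _ ∷ _ | _ = iso

    private
      firstCode : ∀ x → ¬ T (isolated x) → ∃ λ c → c ∈ R x
      firstCode x ¬iso with R x
      ... | []    = contradiction tt ¬iso
      ... | c ∷ _ = c , here refl

      isolated-≁ : ∀ {x} → T (isolated x) → ∀ y → ¬ x ~ y
      isolated-≁ {x} iso y xy = let _ , c∈ , _ = edge⁻ xy in isolated-∉ {x} iso c∈

      core-root : ∀ x → ¬ T (isolated x) → Star _~_ x root
      core-root x ¬iso = to-root {x} (proj₂ (firstCode x ¬iso))

      to-rootᴵ : ∀ p → EqClosure Incident p (inj₁ root)
      face-root : ∀ φ → EqClosure Incident (inj₂ φ) (inj₁ root)
      face-root φ = let x , c , c∈ , eq = cornerOf φ in
        bwd (corner (inj₁ (go x c , edge⁺ c∈ , trans (cong (leftH x) (code-go {x} c∈)) eq)))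
        ◅ Star.gmap inj₁ (fwd ∘ edge) (to-root {x} c∈)
      to-rootᴵ (inj₂ φ) = face-root φ
      to-rootᴵ (inj₁ x) with side (isolated x)
      ... | holds iso = fwd (corner (inj₂ (isolated-≁ {x} iso , refl))) ◅ face-root isoFace
      ... | fails ¬iso = Star.gmap inj₁ (fwd ∘ edge) (core-root x ¬iso)

      -- Component 0 is the connected core.
      components : Kind → ℕ
      components top = 1
      components k   = isolatedCount k

      module C = Grid (components ∘ kind m) (levels m)

      c = total (components ∘ kind m) (levels m)

      -- An isolated vertex is a component of its own, placed on its own level. Level 0 has no
      -- isolated vertices, which leaves the coordinates (0, 0) to the core.
      component : V → Fin c
      component x = if isolated x then C.place zero (lev x) (number (K x) (idx x)) else C.place zero 0
        0

      isolatedCount≤ : ∀ k {b} → b < isolatedCount k → b < components k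
      isolatedCount≤ mid p = p
      isolatedCount≤ bot p = p

      components≤ : ∀ ℓ {b} → b < components (kind m (suc ℓ)) → b < isolatedCount (kind m (suc ℓ))
      components≤ ℓ p with below (suc m) ℓ in eq
      ... | top = contradiction eq (below-≢top (suc m) ℓ)
      ... | mid = p
      ... | bot = p

      number-valid : ∀ x → T (isolated x) → number (K x) (idx x) < isolatedCount (K x) ×
                                            unnumber (K x) (number (K x) (idx x)) ≡ idx x
      number-valid x iso with ∨⁻ (vertex-check {number-ok?} number-ok x)
      ... | inj₁ ¬iso = contradiction iso (not⁻ ¬iso)
      ... | inj₂ t = let p , q = ∧⁻ t in <ᵇ⇒< _ _ p , ≡ᵇ⇒≡ _ _ q

      component-core : ∀ {x} → ¬ T (isolated x) → component x ≡ C.place zero 0 0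
      component-core ¬iso rewrite ¬T⇒false ¬iso = refl

      component-iso : ∀ {x} → T (isolated x) →
        component x ≡ C.place zero (lev x) (number (K x) (idx x))
      component-iso iso rewrite T⇒true iso = refl

      lev-component : ∀ x → T (isolated x) → C.lev (component x) ≡ lev x ×
                      C.idx (component x) ≡ number (K x) (idx x)
      lev-component x iso rewrite component-iso {x} iso =
        let p = isolatedCount≤ (K x) (proj₁ (number-valid x iso)) in
        C.lev-place {zero} (lev< x) p , C.idx-place {zero} (lev< x) p

      lev-core : C.lev (C.place zero 0 0) ≡ 0
      lev-core = C.lev-place {zero} (s≤s z≤n) (s≤s z≤n)

      iso-lev : ∀ ℓ {b} → b < isolatedCount (kind m ℓ) → ℓ ≢ 0
      iso-lev zero () _

      iso≢core : ∀ {x y} → T (isolated x) → ¬ T (isolated y) → component x ≢ component y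
      iso≢core {x} {y} iso ¬iso eq = iso-lev (lev x) (proj₁ (number-valid x iso))
        (trans (sym (proj₁ (lev-component x iso)))
          (trans (cong C.lev (trans eq (component-core {y} ¬iso))) lev-core))

      iso-injective : ∀ {x y} → T (isolated x) → T (isolated y) → component x ≡ component y → x ≡ y
      iso-injective {x} {y} ix iy eq = coords-unique lev≡ (begin
        idx x                                   ≡⟨ proj₂ (number-valid x ix) ⟨
        unnumber (K x) (number (K x) (idx x))   ≡⟨ cong₂ unnumber (cong (kind m) lev≡) number≡ ⟩
        unnumber (K y) (number (K y) (idx y))   ≡⟨ proj₂ (number-valid y iy) ⟩
        idx y                                   ∎)
        where
        open ≡-Reasoning
        lev≡ : lev x ≡ lev y
        lev≡ = trans (sym (proj₁ (lev-component x ix)))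
          (trans (cong C.lev eq) (proj₁ (lev-component y iy)))
        number≡ : number (K x) (idx x) ≡ number (K y) (idx y)
        number≡ = trans (sym (proj₂ (lev-component x ix)))
          (trans (cong C.idx eq) (proj₂ (lev-component y iy)))

      same⇒path : ∀ x y → component x ≡ component y → Star _~_ x y
      same⇒path x y eq with side (isolated x) | side (isolated y)
      ... | holds ix  | holds iy  = subst (Star _~_ x) (iso-injective ix iy eq) ε
      ... | holds ix  | fails ¬iy = contradiction eq (iso≢core {x} {y} ix ¬iy)
      ... | fails ¬ix | holds iy  = contradiction (sym eq) (iso≢core {y} {x} iy ¬ix)
      ... | fails ¬ix | fails ¬iy = core-root x ¬ix ◅◅ Star.reverse ~-sym (core-root y ¬iy)

      edge-same : ∀ {x y} → x ~ y → component x ≡ component y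
      edge-same {x} {y} xy = trans (component-core {x} λ iso → isolated-≁ {x} iso y xy)
                                   (sym (component-core {y} λ iso → isolated-≁ {y} iso x (~-sym xy)))

      path⇒same : ∀ {x y} → Star _~_ x y → component x ≡ component y
      path⇒same ε        = refl
      path⇒same (xy ◅ p) = trans (edge-same xy) (path⇒same p)

      onto : ∀ i → ∃ λ x → component x ≡ i
      onto i = go′ (C.lev i) (C.lev< i) (C.idx< i) refl
        where
        go′ : ∀ ℓ → ℓ < levels m → C.idx i < components (kind m (C.lev i)) → C.lev i ≡ ℓ → ∃ λ x →
          component x ≡ i
        go′ zero _ i< eq = root , trans (component-core {root} root-core)
          (C.place-unique eq (n<1⇒n≡0 (subst (λ ℓ → C.idx i < components (kind m ℓ)) eq i<)))
          where
          root-core : ¬ T (isolated root)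
          root-core rewrite lev-place {zero} {0} {8} (s≤s z≤n) (m≤m+n 9 0) | idx-place {zero} {0} {8}
            (s≤s z≤n) (m≤m+n 9 0) = λ ()
        go′ (suc ℓ) ℓ< i< eq =
          let k = kind m (suc ℓ)
              b = C.idx i
              b< = components≤ ℓ (subst (λ ℓ → b < components (kind m ℓ)) eq i<)
              p , q = ∧⁻ {unnumber k b <ᵇ size k}
                (all-< {unnumber-ok? k} (all-kinds {λ k → below? (isolatedCount k) (unnumber-ok? k)}
                unnumber-ok k) b<)
              iso , num = ∧⁻ q
              x = place zero (suc ℓ) (unnumber k b)
              lx = lev-place {zero} ℓ< (<ᵇ⇒< _ _ p)
              ix = idx-place {zero} ℓ< (<ᵇ⇒< _ _ p)
              kx = cong (kind m) lx
          in x , trans (component-iso {x} (subst₂ (λ k a → T (isolated? k a)) (sym kx) (sym ix) iso))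
               (C.place-unique (trans eq (sym lx)) (sym (trans (cong₂ number kx ix) (≡ᵇ⇒≡ _ _ num))))

      2e : Graph.e graph + Graph.e graph ≡ 98 + suc m * 8
      2e = trans 2e≡ (solve 1 (λ k → con 30 :+ (k :* con 8 :+ con 68) := con 98 :+ k :* con 8) refl
        (suc m))
        where open +-*-Solver

    -- Five wheels with 8 edges each, the edge r₀t₃, the four edges t_i r_i, and four columns with m
    -- + 2 edges between levels: 40 + 1 + 4 + 4 (m + 2).
    e≡H : Graph.e graph ≡ 49 + suc m * 4
    e≡H = *-cancelˡ-≡ _ _ 2 (trans (solve 1 (λ e → con 2 :* e := e :+ e) refl (Graph.e graph))
           (trans 2e (solve 1 (λ k → con 98 :+ k :* con 8 := con 2 :* (con 49 :+ k :* con 4)) refl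
             (suc m))))
      where open +-*-Solver

    planeH : PlaneGraph
    planeH = record { graph = graph ; embedding = record
      { faces = Embedded.faces embeddedH
      ; connected = λ p q → to-rootᴵ p ◅◅ EqC.symmetric _ (to-rootᴵ q)
      ; c = c
      ; component = component
      ; component-onto = λ i → let x , eq = onto i in x , λ { refl → eq }
      ; component-≡ = λ x y → mk⇔ (same⇒path x y) path⇒same
      ; euler = trans (cong (_+ 22) (total-kind size m)) (trans (eq (suc m))
          (sym (cong₂ (λ e c → 1 + e + c) e≡H (total-kind components m)))) } }
      where
      open +-*-Solver
      eq : ∀ k → 9 + (k * 12 + 56) + 22 ≡ 1 + (49 + k * 4) + (1 + (k * 8 + 36))
      eq = solve 1 (λ k → con 9 :+ (k :* con 12 :+ con 56) :+ con 22 :=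
             con 1 :+ (con 49 :+ k :* con 4) :+ (con 1 :+ (k :* con 8 :+ con 36))) refl

-- All wheels with four spokes in G.

module Wheels where

  open import Data.Nat.Base
  open import Data.Nat.Properties using (≡⇒≡ᵇ)
  open import Relation.Binary.PropositionalEquality using (_≡_; _≢_)
  open Strip
  open Tables

  module TG = Table rowsG
  module TH = Table rowsH

  _=ᵏ_ : Kind → Kind → Bool
  top =ᵏ top = true
  mid =ᵏ mid = true
  bot =ᵏ bot = true
  _   =ᵏ _   = false

  -- The kinds of the levels above, at and below a vertex.
  Window : Set
  Window = Kind × Kind × Kind

  -- At the ends of the strip the missing level is replaced by another of the same kind: `pred 0` is
  -- 0, and `kind` is `bot` beyond the bottom. The window `(top , mid , bot)` arises if there is a
  -- single middle level.
  windows : List Window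
  windows = (top , top , mid) ∷ (top , mid , mid) ∷ (top , mid , bot) ∷ (mid , mid , mid) ∷
            (mid , mid , bot) ∷ (mid , bot , bot) ∷ []

  kindAt : Window → Code → Kind
  kindAt (u , k , d) (↑ _) = u
  kindAt (u , k , d) (• _) = k
  kindAt (u , k , d) (↓ _) = d

  adjAt? : Window → Code → Code → Bool
  adjAt? w c d = any (λ e → composes c e d ∧ (pos e ≡ᵇ pos d)) (TG.rot (kindAt w c) (pos c))

  data Hub : Set where
    hubT : Hub
    hubB : Fin 4 → Hub

  hubs : List Hub
  hubs = hubT ∷ map hubB (allFin 4)

  hubKind : Hub → Kind
  hubKind hubT     = top
  hubKind (hubB _) = bot

  hubIdx : Hub → ℕ
  hubIdx hubT     = 8
  hubIdx (hubB i) = 20 + toℕ i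

  rimIdx : Hub → Fin 4 → ℕ
  rimIdx hubT     j                      = 4 + toℕ j
  rimIdx (hubB i) zero                   = toℕ i
  rimIdx (hubB i) (suc zero)             = 12 + toℕ i
  rimIdx (hubB i) (suc (suc zero))       = 24 + toℕ i
  rimIdx (hubB i) (suc (suc (suc zero))) = 16 + toℕ i

  rims : Hub → List Code
  rims u = map (λ j → • rimIdx u j) (allFin 4)

  isWheel? : Kind → ℕ → List Code → Bool
  isWheel? k a cs = any (λ u → (k =ᵏ hubKind u) ∧ ((a ≡ᵇ hubIdx u) ∧ all (_∈? rims u) cs)) hubs

  -- A closed walk of four neighbours with c₁ ≠ c₃ and c₂ ≠ c₄ has to run on the rim of a listed hub
  -- and to be chordless. The search is staged from `wheel₁?` to `wheel₄?`, so that a missing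
  -- adjacency ends it before the next vertex is chosen.
  wheel₄? : Window → ℕ → Code → Code → Code → Code → Bool
  wheel₄? w@(_ , k , _) a c₁ c₂ c₃ c₄ = not (adjAt? w c₃ c₄) ∨ (not (adjAt? w c₄ c₁) ∨ ((c₂ == c₄) ∨
    (isWheel? k a (c₁ ∷ c₂ ∷ c₃ ∷ c₄ ∷ []) ∧ (not (adjAt? w c₁ c₃) ∧ not (adjAt? w c₂ c₄)))))

  wheel₃? : Window → ℕ → Code → Code → Code → Bool
  wheel₃? w@(_ , k , _) a c₁ c₂ c₃ = not (adjAt? w c₂ c₃)
    ∨ ((c₁ == c₃) ∨ all (wheel₄? w a c₁ c₂ c₃) (TG.rot k a))

  wheel₂? : Window → ℕ → Code → Code → Bool
  wheel₂? w@(_ , k , _) a c₁ c₂ = not (adjAt? w c₁ c₂) ∨ all (wheel₃? w a c₁ c₂) (TG.rot k a)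

  wheel₁? : Window → ℕ → Code → Bool
  wheel₁? w@(_ , k , _) a c₁ = all (wheel₂? w a c₁) (TG.rot k a)

  wheels? : Window → Bool
  wheels? w@(_ , k , _) = below? (size k) λ a → all (wheel₁? w a) (TG.rot k a)

  private
    wheels-ok : Valid (all wheels? windows)
    wheels-ok = valid tt

  abstract

    WheelCodes : Kind → ℕ → List Code → Set
    WheelCodes k a cs = T (isWheel? k a cs)

    wheelCodes⁻ : ∀ {k a cs} → WheelCodes k a cs →
                  ∃ λ u → T (k =ᵏ hubKind u) × T (a ≡ᵇ hubIdx u) × T (all (λ c → c ∈? rims u) cs)
    wheelCodes⁻ {k} {a} {cs} t =
      let u , _ , s = any-∃ (λ u → (k =ᵏ hubKind u) ∧ ((a ≡ᵇ hubIdx u) ∧ all (_∈? rims u) cs)) hubs t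
          p , q = ∧⁻ {k =ᵏ hubKind u} s
      in u , p , ∧⁻ {a ≡ᵇ hubIdx u} q

    AdjAt : Window → Code → Code → Set
    AdjAt w c d = T (adjAt? w c d)

    adjAt⁺ : ∀ w {c d e} → e ∈ TG.rot (kindAt w c) (pos c) → T (composes c e d) → pos e ≡ pos d →
      AdjAt w c d
    adjAt⁺ w {c} {d} e∈ t p = any-T (λ e → composes c e d ∧ (pos e ≡ᵇ pos d)) e∈ (∧⁺ t (≡⇒≡ᵇ _ _ p))

    wheelCodes : ∀ {w} → w ∈ windows → let k = proj₁ (proj₂ w) in ∀ {a} → a < size k →
      let R = TG.rot k a in ∀ {c₁ c₂ c₃ c₄} → c₁ ∈ R → c₂ ∈ R → c₃ ∈ R → c₄ ∈ R →
      AdjAt w c₁ c₂ → AdjAt w c₂ c₃ → AdjAt w c₃ c₄ → AdjAt w c₄ c₁ → c₁ ≢ c₃ → c₂ ≢ c₄ →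
      WheelCodes k a (c₁ ∷ c₂ ∷ c₃ ∷ c₄ ∷ []) × ¬ AdjAt w c₁ c₃ × ¬ AdjAt w c₂ c₄
    wheelCodes {w} w∈ {a} a< {c₁} {c₂} {c₃} {c₄} c₁∈ c₂∈ c₃∈ c₄∈ a₁₂ a₂₃ a₃₄ a₄₁ n₁₃ n₂₄ =
      let k = proj₁ (proj₂ w)
          t₁ = all-< {λ a → all (wheel₁? w a) (TG.rot k a)} {size k}
            (valid-∈ {p = wheels?} {windows} wheels-ok w∈) a<
          t₂ = ⇒⁻ {adjAt? w c₁ c₂}
            (all-∈ {p = wheel₂? w a c₁} {TG.rot k a} (all-∈ {p = wheel₁? w a} {TG.rot k a} t₁ c₁∈)
            c₂∈) a₁₂
          t₃ = drop (n₁₃ ∘ ==⇒≡ c₁ c₃)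
            (⇒⁻ {adjAt? w c₂ c₃} (all-∈ {p = wheel₃? w a c₁ c₂} {TG.rot k a} t₂ c₃∈) a₂₃)
          t₄ = drop (n₂₄ ∘ ==⇒≡ c₂ c₄) (⇒⁻ {adjAt? w c₄ c₁} (⇒⁻ {adjAt? w c₃ c₄}
                 (all-∈ {p = wheel₄? w a c₁ c₂ c₃} {TG.rot k a} t₃ c₄∈) a₃₄) a₄₁)
          p , q = ∧⁻ {isWheel? k a (c₁ ∷ c₂ ∷ c₃ ∷ c₄ ∷ [])} t₄
          q₁ , q₂ = ∧⁻ {not (adjAt? w c₁ c₃)} q
      in p , not⁻ q₁ , not⁻ q₂
      where
      drop : ∀ {a b} → ¬ T a → T (a ∨ b) → T b
      drop ¬a t with ∨⁻ t
      ... | inj₁ a = contradiction a ¬a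
      ... | inj₂ b = b

-- Finite checks on the tables.

module Checks where

  open import Data.Bool.Properties using (T?)
  open import Data.Fin.Properties using (_≟_; all?)
  open import Data.Nat.Base
  open import Relation.Binary.PropositionalEquality using (_≢_)
  open Strip
  open Tables
  open Wheels

  onWheel? : Kind → ℕ → Bool
  onWheel? k a = any (λ u → (k =ᵏ hubKind u)
    ∧ ((a ≡ᵇ hubIdx u) ∨ any (λ j → a ≡ᵇ rimIdx u j) (allFin 4))) hubs

  forHubs : (Hub → Bool) → Bool
  forHubs p = all p hubs

  onWheel-hub : Valid (forHubs λ u → onWheel? (hubKind u) (hubIdx u))
  onWheel-hub = valid tt

  onWheel-rim : Valid (forHubs λ u → all (λ j → onWheel? (hubKind u) (rimIdx u j)) (allFin 4))
  onWheel-rim = valid tt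

  rim<size : Valid (forHubs λ u → (hubIdx u <ᵇ size (hubKind u))
    ∧ all (λ j → rimIdx u j <ᵇ size (hubKind u)) (allFin 4))
  rim<size = valid tt

  cyclic : Fin 4 → Fin 4
  cyclic zero                   = suc zero
  cyclic (suc zero)             = suc (suc zero)
  cyclic (suc (suc zero))       = suc (suc (suc zero))
  cyclic (suc (suc (suc zero))) = zero

  spokesH : Valid (forHubs λ u → all (λ j → ((• rimIdx u j) ∈? TH.rot (hubKind u) (hubIdx u)) ∧
                                        ((• rimIdx u (cyclic j)) ∈? TH.rot (hubKind u) (rimIdx u j)))
                                          (allFin 4))
  spokesH = valid tt

  -- A walk of length two from y_j whose first step leaves the wheels returns to them.
  stays? : Code → Bool
  stays? (• e) = onWheel? bot e
  stays? _     = false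

  trapped? : Fin 4 → Code → Bool
  trapped? j (• b) = onWheel? bot b ∨ all stays? (TG.rot bot b)
  trapped? j _     = false

  trapped : Valid (all (λ j → all (trapped? j) (TG.rot bot (24 + toℕ j))) (allFin 4))
  trapped = valid tt

  columnsH : Valid (all (λ i → ((↓ toℕ i) ∈? TH.rot top (toℕ i))
    ∧ (((↓ toℕ i) ∈? TH.rot mid (toℕ i)) ∧
                           ((• toℕ i) ∈? TH.rot top (4 + toℕ i)))) (allFin 4))
  columnsH = valid tt

  lockH : Valid ((• 0) ∈? TH.rot top 7)
  lockH = valid tt

  -- Chosen such that `Λ`, twice the level plus the weight, changes by at most 2 along an edge of G,
  -- but is 2 on the t_i and 2B + 4 on the ends b_i of the columns at the bottom level B. The B + 1
  -- edges from t_i to b_i then leave no slack. Stacked vertices and all bottom vertices off the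
  -- ring have odd weight, so parity bars the columns from them, and b_i is the only vertex of
  -- weight 4 on its rim.
  weight : Kind → ℕ → ℕ
  weight top a = if a <ᵇ 4 then 4 else if a <ᵇ 8 then 2 else 0
  weight mid a = if a <ᵇ 4 then 4 else 3
  weight bot a = if a <ᵇ 4 then 4 else if a <ᵇ 12 then 3 else 5

  -- The change of level plus one, which stays within the natural numbers. Because of this shift the
  -- gain of 2 allowed for `Λ` appears as 4 in `slope?`.
  height : Code → ℕ
  height (↑ _) = 0
  height (• _) = 1
  height (↓ _) = 2

  slope? : Kind → ℕ → Code → Kind → Bool
  slope? k a c k′ = 2 * height c + weight k′ (pos c) ≤ᵇ 4 + weight k a

  slope : Valid (TG.forEdges slope?)
  slope = valid tt

  -- Leaves ring vertices as the only ones with `Λ` of the form 2ℓ + 4: odd weights make `Λ` odd,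
  -- and t and h at the top stay below 4.
  parity? : Kind → ℕ → Bool
  parity? k a = ((weight k a ≡ᵇ 4) ∧ (a <ᵇ 4))
    ∨ ((weight k a ≡ᵇ 3) ∨ ((weight k a ≡ᵇ 5) ∨ ((k =ᵏ top) ∧ (weight k a <ᵇ 4))))

  parities : Valid (TG.forVertices parity?)
  parities = valid tt

  core? : Kind → ℕ → Bool
  core? k a = not (null (TH.rot k a))

  core-ok? : Kind → ℕ → Bool
  core-ok? k a = not (core? k a) ∨ ((a <ᵇ 4) ∨ onWheel? k a)

  core-ok : Valid (TG.forVertices core-ok?)
  core-ok = valid tt

  independent? : Kind → ℕ → Code → Kind → Bool
  independent? k a c k′ = core? k a ∨ core? k′ (pos c)

  independent : Valid (TG.forEdges independent?)
  independent = valid tt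

  -- On the top level `3 <ᵇ a` selects the t_i and h; no vertex is stacked into any of the triangles
  -- at them.
  saturatedTop? : Kind → ℕ → Code → Kind → Bool
  saturatedTop? k a c k′ = not ((k =ᵏ top) ∧ (3 <ᵇ a)) ∨ core? k′ (pos c)

  saturatedTop : Valid (TG.forEdges saturatedTop?)
  saturatedTop = valid tt

  isoFaceOf? : Kind → ℕ → Code → Bool
  isoFaceOf? k a c = not (pos (TH.faceCode k a c) ≡ᵇ 1) ∨ ((k =ᵏ top) ∧ (3 <ᵇ a))

  isoFaceOf : Valid (TH.forVertices λ k a → all (isoFaceOf? k a) (TH.rot k a))
  isoFaceOf = valid tt

  shares : Kind → ℕ → Kind → ℕ → Bool
  shares k a k′ b = any (λ c → any (λ d → pos (TH.faceCode k a c) ≡ᵇ pos (TH.faceCode k′ b d))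
    (TH.rot k′ b)) (TH.rot k a)

  -- The edge r₀ t₃ of H tells the neighbours of r_i apart: under every embedding the
  -- image of r_i is adjacent to those of t_i and t_{i-1} only.  These are the pairs
  -- (j , i) for which t_j and r_i lie on a common face of H without being adjacent.
  lockPairs : List (Fin 4 × Fin 4)
  lockPairs = (# 1 , # 0) ∷ (# 2 , # 0) ∷ (# 2 , # 1) ∷ (# 3 , # 2) ∷ (# 0 , # 3) ∷ []

  oppositeRims? : Kind → ℕ → ℕ → Bool
  oppositeRims? k a b =
    any (λ u → (k =ᵏ hubKind u) ∧ any (λ j → (a ≡ᵇ rimIdx u j) ∧ (b ≡ᵇ rimIdx u (cyclic (cyclic j))))
    (allFin 4)) hubs

  locked? : Kind → ℕ → ℕ → Bool
  locked? k a b = (k =ᵏ top) ∧ any (λ (j , i) → (a ≡ᵇ rimIdx hubT j) ∧ (b ≡ᵇ toℕ i)) lockPairs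

  -- Besides equality and adjacency in H the cases are: `Λ` differs by more than 2, where the common
  -- level cancels; opposite rim vertices, as the wheels of G are chordless; and the pairs told
  -- apart by the edge r₀t₃.
  sameLevel? : Kind → ℕ → ℕ → Bool
  sameLevel? k a b = not (shares k a k b) ∨ ((a ≡ᵇ b) ∨ (((• b) ∈? TH.rot k a) ∨
    ((2 + weight k a <ᵇ weight k b) ∨ ((2 + weight k b <ᵇ weight k a) ∨
    (oppositeRims? k a b ∨ (locked? k a b ∨ locked? k b a))))))

  sameLevel : Valid (TG.forVertices λ k a → below? (size k) (sameLevel? k a))
  sameLevel = valid tt

  -- The difference of levels already contributes 2 to `Λ`, so any larger weight below exceeds the
  -- slope. The bottom has to be exempted because `nbrKinds bot (↓ 0)` lists `bot` itself.
  nextLevel? : Kind → ℕ → Kind → ℕ → Bool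
  nextLevel? k a k′ b = (k =ᵏ bot)
    ∨ (not (shares k a k′ b) ∨ (((↓ b) ∈? TH.rot k a) ∨ (weight k a <ᵇ weight k′ b)))

  nextLevels? : Kind → ℕ → Kind → Bool
  nextLevels? k a k′ = below? (size k′) (nextLevel? k a k′)

  nextLevel : Valid (TG.forVertices λ k a → all (nextLevels? k a) (nbrKinds k (↓ 0)))
  nextLevel = valid tt

  tt? tr? : Fin 4 → Fin 4 → Bool
  tt? a b = (• (4 + toℕ b)) ∈? TG.rot top (4 + toℕ a)
  tr? a b = (• (toℕ b)) ∈? TG.rot top (4 + toℕ a)

  _≟₄_ : Fin 4 → Fin 4 → Bool
  i ≟₄ j = toℕ i ≡ᵇ toℕ j

  infixr 3 _⇒_
  _⇒_ : Bool → Bool → Bool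
  a ⇒ b = not a ∨ b

  all₄ : (Fin 4 → Bool) → Bool
  all₄ p = all p (allFin 4)

  -- In G every r has two neighbours among the t, consecutive on the rim. The image of r₀ is the r
  -- between the images of t₃ and t₀; then distinctness forces the images of r₃, r₂ and r₁ in turn.
  -- Each hypothesis follows directly after the values it concerns, which prunes the enumeration.
  lock : ∀ g₀ g₁ → T (tt? g₀ g₁) → ∀ g₂ → T (tt? g₁ g₂) → g₀ ≢ g₂ →
         ∀ g₃ → T (tt? g₂ g₃) → T (tt? g₃ g₀) → g₁ ≢ g₃ →
         ∀ s₀ → T (tr? g₀ s₀) → T (tr? g₃ s₀) →
         ∀ s₁ → T (tr? g₁ s₁) → s₀ ≢ s₁ →
         ∀ s₂ → T (tr? g₂ s₂) → s₀ ≢ s₂ → s₁ ≢ s₂ →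
         ∀ s₃ → T (tr? g₃ s₃) → s₀ ≢ s₃ → s₁ ≢ s₃ → s₂ ≢ s₃ →
         ¬ T (tr? g₁ s₀) × ¬ T (tr? g₂ s₀) × ¬ T (tr? g₂ s₁) × ¬ T (tr? g₃ s₂) × ¬ T (tr? g₀ s₃)
  lock = from-yes (
    all? λ g₀ → all? λ g₁ → T? (tt? g₀ g₁)
      →-dec (all? λ g₂ → T? (tt? g₁ g₂) →-dec (¬? (g₀ ≟ g₂) →-dec (
    all? λ g₃ → T? (tt? g₂ g₃) →-dec (T? (tt? g₃ g₀) →-dec (¬? (g₁ ≟ g₃) →-dec (
    all? λ s₀ → T? (tr? g₀ s₀) →-dec (T? (tr? g₃ s₀) →-dec (
    all? λ s₁ → T? (tr? g₁ s₁) →-dec (¬? (s₀ ≟ s₁) →-dec (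
    all? λ s₂ → T? (tr? g₂ s₂) →-dec (¬? (s₀ ≟ s₂) →-dec (¬? (s₁ ≟ s₂) →-dec (
    all? λ s₃ → T? (tr? g₃ s₃) →-dec (¬? (s₀ ≟ s₃) →-dec (¬? (s₁ ≟ s₃) →-dec (¬? (s₂ ≟ s₃) →-dec (
    ¬? (T? (tr? g₁ s₀)) ×-dec (¬? (T? (tr? g₂ s₀)) ×-dec (¬? (T? (tr? g₂ s₁)) ×-dec (
    ¬? (T? (tr? g₃ s₂)) ×-dec ¬? (T? (tr? g₀ s₃)))))))))))))))))))))))

  ring-core : Valid (forKinds λ k → below? 4 (core? k))
  ring-core = valid tt

  onWheel-core? : Kind → ℕ → Bool
  onWheel-core? k a = not (onWheel? k a) ∨ core? k a

  onWheel-core : Valid (TG.forVertices onWheel-core?)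
  onWheel-core = valid tt

  -- For vertices two or more levels apart: the upper one is not at the bottom and the lower one not
  -- at the top, so the weights cannot make up for the 4 that the levels contribute to `Λ`.
  lower? upper? : Kind → ℕ → Bool
  lower? k a = not (core? k a) ∨ ((k =ᵏ bot) ∨ (weight k a ≤ᵇ 4))
  upper? k a = not (core? k a) ∨ ((k =ᵏ top) ∨ (4 ≤ᵇ weight k a))

  lower : Valid (TG.forVertices lower?)
  lower = valid tt

  upper : Valid (TG.forVertices upper?)
  upper = valid tt

-- Wheels, columns and the potential `Λ` on strips of arbitrary length.

module Rigid where

  open import Data.Empty using (⊥; ⊥-elim)
  open import Data.Fin.Properties using (toℕ<n; toℕ-fromℕ<; toℕ-injective)
  open import Data.Nat.Base hiding (parity)
  open import Data.Nat.Properties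
  open import Data.Nat.Solver using (module +-*-Solver)
  open import Relation.Binary.PropositionalEquality
  open Counting
  open Layers
  open Rotation
  open Strip
  open Tables
  open Wheels
  open Checks
  open Sparse using (module H; embeddedH; leftH; toℕ-left; toℕ-face; isoFace; Side; holds; fails; side)
  open Triangulation using (module G)

  =ᵏ⇒≡ : ∀ k l → T (k =ᵏ l) → k ≡ l
  =ᵏ⇒≡ top top _ = refl
  =ᵏ⇒≡ mid mid _ = refl
  =ᵏ⇒≡ bot bot _ = refl

  all₄-at : ∀ (p : Fin 4 → Bool) → T (all₄ p) → ∀ i → T (p i)
  all₄-at p t i = all-∈ {p = p} t (∈-allFin i)

  valid₄-at : ∀ (p : Fin 4 → Bool) → Valid (all₄ p) → ∀ i → T (p i)
  valid₄-at p t i = valid-∈ {p = p} t (∈-allFin i)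

  ∈hubs : ∀ u → u ∈ hubs
  ∈hubs hubT     = here refl
  ∈hubs (hubB i) = there (∈-map⁺ hubB (∈-allFin i))

  hubs-at : ∀ (p : Hub → Bool) → Valid (forHubs p) → ∀ u → T (p u)
  hubs-at p t u = valid-∈ {p = p} t (∈hubs u)

  composes-height : ∀ c d e → height c + height d ≡ suc (height e) → T (composes c d e)
  composes-height (↑ _) (↑ _) _     ()
  composes-height (↑ _) (• _) (↑ _) _ = tt
  composes-height (↑ _) (• _) (• _) ()
  composes-height (↑ _) (• _) (↓ _) ()
  composes-height (↑ _) (↓ _) (↑ _) ()
  composes-height (↑ _) (↓ _) (• _) _ = tt
  composes-height (↑ _) (↓ _) (↓ _) ()
  composes-height (• _) (↑ _) (↑ _) _ = tt
  composes-height (• _) (↑ _) (• _) ()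
  composes-height (• _) (↑ _) (↓ _) ()
  composes-height (• _) (• _) (↑ _) ()
  composes-height (• _) (• _) (• _) _ = tt
  composes-height (• _) (• _) (↓ _) ()
  composes-height (• _) (↓ _) (↑ _) ()
  composes-height (• _) (↓ _) (• _) ()
  composes-height (• _) (↓ _) (↓ _) _ = tt
  composes-height (↓ _) (↑ _) (↑ _) ()
  composes-height (↓ _) (↑ _) (• _) _ = tt
  composes-height (↓ _) (↑ _) (↓ _) ()
  composes-height (↓ _) (• _) (↑ _) ()
  composes-height (↓ _) (• _) (• _) ()
  composes-height (↓ _) (• _) (↓ _) _ = tt
  composes-height (↓ _) (↓ _) (↑ _) ()
  composes-height (↓ _) (↓ _) (• _) ()
  composes-height (↓ _) (↓ _) (↓ _) ()

  move-height : ∀ c {m ℓ} → T (allowed (kind m ℓ) c) → suc (move c ℓ) ≡ ℓ + height c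
  move-height (↑ _) {ℓ = suc ℓ} _ = sym (+-identityʳ (suc ℓ))
  move-height (• _) {ℓ = ℓ}     _ = +-comm 1 ℓ
  move-height (↓ _) {ℓ = ℓ}     _ = +-comm 2 ℓ

  weight-ring : ∀ k {a} → a < 4 → weight k a ≡ 4
  weight-ring top a< rewrite T⇒true (<⇒<ᵇ a<) = refl
  weight-ring mid a< rewrite T⇒true (<⇒<ᵇ a<) = refl
  weight-ring bot a< rewrite T⇒true (<⇒<ᵇ a<) = refl

  rimIdx-injective? : Valid (forHubs λ u → all₄ λ i → all₄ λ j →
    (rimIdx u i ≡ᵇ rimIdx u j) ⇒ (i ≟₄ j))
  rimIdx-injective? = valid tt

  rimIdx-injective : ∀ u {i j} → rimIdx u i ≡ rimIdx u j → i ≡ j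
  rimIdx-injective u {i} {j} eq = toℕ-injective (≡ᵇ⇒≡ _ _ (⇒⁻
    (all₄-at (λ j → (rimIdx u i ≡ᵇ rimIdx u j) ⇒ (i ≟₄ j))
      (all₄-at (λ i → all₄ λ j → (rimIdx u i ≡ᵇ rimIdx u j) ⇒ (i ≟₄ j))
        (hubs-at (λ u → all₄ λ i → all₄ λ j → (rimIdx u i ≡ᵇ rimIdx u j) ⇒ (i ≟₄ j)) rimIdx-injective?
          u) i) j)
    (≡⇒≡ᵇ _ _ eq)))

  ∈rims : ∀ u {c} → T (c ∈? rims u) → ∃ λ j → c ≡ • rimIdx u j
  ∈rims u t = let j , _ , eq = ∈-map⁻ (λ j → • rimIdx u j) (∈?⇒∈ (rims u) t) in j , eq

  module Geometry (m : ℕ) where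
    open G m public using (V; lev; idx; K; lev<; idx<; place; lev-place; idx-place; place-unique; go;
      coords-unique)
    module GG = G m
    module HH = H m
    open Graph GG.graph public using () renaming (_~_ to _~ᴳ_)
    open Graph HH.graph public using () renaming (_~_ to _~ᴴ_)

    B : ℕ
    B = 2 + m

    vt : ℕ → ℕ → V
    vt ℓ a = place zero ℓ a

    B-kind : kind m B ≡ bot
    B-kind = below-bot {suc m}

    top⇒0 : ∀ ℓ → kind m ℓ ≡ top → ℓ ≡ 0
    top⇒0 zero    _  = refl
    top⇒0 (suc ℓ) eq = contradiction eq (below-≢top (suc m) ℓ)

    bot⇒B : ∀ ℓ → ℓ < levels m → kind m ℓ ≡ bot → ℓ ≡ B
    bot⇒B (suc ℓ) (s≤s (s≤s ℓ≤)) eq with ℓ <? suc m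
    ... | yes ℓ< = contradiction (trans (sym (below-mid ℓ<)) eq) λ ()
    ... | no ℓ≮  = cong suc (≤-antisym ℓ≤ (≮⇒≥ ℓ≮))

    hubLevel : Hub → ℕ
    hubLevel hubT     = 0
    hubLevel (hubB _) = B

    hubLevel< : ∀ u → hubLevel u < levels m
    hubLevel< hubT     = s≤s z≤n
    hubLevel< (hubB _) = ≤-refl

    kind-hubLevel : ∀ u → kind m (hubLevel u) ≡ hubKind u
    kind-hubLevel hubT     = refl
    kind-hubLevel (hubB _) = B-kind

    level-hub : ∀ u x → K x ≡ hubKind u → lev x ≡ hubLevel u
    level-hub hubT     x eq = top⇒0 (lev x) eq
    level-hub (hubB _) x eq = bot⇒B (lev x) (lev< x) eq

    hubV : Hub → V
    hubV u = vt (hubLevel u) (hubIdx u)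

    rimV : Hub → Fin 4 → V
    rimV u j = vt (hubLevel u) (rimIdx u j)

    private
      idx-ok : ∀ u → T (hubIdx u <ᵇ size (hubKind u))
        × T (all (λ j → rimIdx u j <ᵇ size (hubKind u)) (allFin 4))
      idx-ok u = ∧⁻ (hubs-at (λ u → (hubIdx u <ᵇ size (hubKind u))
        ∧ all (λ j → rimIdx u j <ᵇ size (hubKind u)) (allFin 4)) rim<size u)

    hubIdx< : ∀ u → hubIdx u < size (hubKind u)
    hubIdx< u = <ᵇ⇒< _ _ (proj₁ (idx-ok u))

    rimIdx< : ∀ u j → rimIdx u j < size (hubKind u)
    rimIdx< u j = <ᵇ⇒< _ _ (all₄-at (λ j → rimIdx u j <ᵇ size (hubKind u)) (proj₂ (idx-ok u)) j)

    module _ {ℓ a k} (ℓ< : ℓ < levels m) (k≡ : kind m ℓ ≡ k) (a< : a < size k) where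

      lev-vt : lev (vt ℓ a) ≡ ℓ
      lev-vt = lev-place ℓ< (subst (λ k → a < size k) (sym k≡) a<)

      idx-vt : idx (vt ℓ a) ≡ a
      idx-vt = idx-place ℓ< (subst (λ k → a < size k) (sym k≡) a<)

      K-vt : K (vt ℓ a) ≡ k
      K-vt = trans (cong (kind m) lev-vt) k≡

      edgeᴴ : ∀ {c} → c ∈ TH.rot k a → vt ℓ a ~ᴴ vt (move c ℓ) (pos c)
      edgeᴴ {c} c∈ = subst (vt ℓ a ~ᴴ_)
        (sym (place-unique (trans (HH.lev-go {vt ℓ a} c∈′) (cong (move c) lev-vt))
          (HH.idx-go {vt ℓ a} c∈′)))
        (HH.edge⁺ c∈′)
        where
        c∈′ : c ∈ HH.R (vt ℓ a)
        c∈′ = subst (c ∈_) (sym (cong₂ TH.rot K-vt idx-vt)) c∈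

      edgeᴳ⁻ : ∀ {y} → vt ℓ a ~ᴳ y → ∃ λ c → c ∈ TG.rot k a × lev y ≡ move c ℓ × idx y ≡ pos c
      edgeᴳ⁻ xy with c , c∈ , refl ← GG.edge⁻ xy =
        c , subst (c ∈_) (cong₂ TG.rot K-vt idx-vt) c∈ ,
        trans (GG.lev-go {vt ℓ a} c∈) (cong (move c) lev-vt) , GG.idx-go {vt ℓ a} c∈

    lev-hub : ∀ u → lev (hubV u) ≡ hubLevel u
    lev-hub u = lev-vt (hubLevel< u) (kind-hubLevel u) (hubIdx< u)
    idx-hub : ∀ u → idx (hubV u) ≡ hubIdx u
    idx-hub u = idx-vt (hubLevel< u) (kind-hubLevel u) (hubIdx< u)
    K-hub : ∀ u → K (hubV u) ≡ hubKind u
    K-hub u = K-vt (hubLevel< u) (kind-hubLevel u) (hubIdx< u)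
    lev-rim : ∀ u j → lev (rimV u j) ≡ hubLevel u
    lev-rim u j = lev-vt (hubLevel< u) (kind-hubLevel u) (rimIdx< u j)
    idx-rim : ∀ u j → idx (rimV u j) ≡ rimIdx u j
    idx-rim u j = idx-vt (hubLevel< u) (kind-hubLevel u) (rimIdx< u j)
    K-rim : ∀ u j → K (rimV u j) ≡ hubKind u
    K-rim u j = K-vt (hubLevel< u) (kind-hubLevel u) (rimIdx< u j)

    rimV-injective : ∀ u {i j} → rimV u i ≡ rimV u j → i ≡ j
    rimV-injective u {i} {j} eq =
      rimIdx-injective u (trans (sym (idx-rim u i)) (trans (cong idx eq) (idx-rim u j)))

    private
      spoke-ok : ∀ u j → T ((• rimIdx u j) ∈? TH.rot (hubKind u) (hubIdx u)) ×
                         T ((• rimIdx u (cyclic j)) ∈? TH.rot (hubKind u) (rimIdx u j))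
      spoke-ok u j = ∧⁻ (all₄-at (p u) (hubs-at (λ u → all₄ (p u)) spokesH u) j)
        where
        p : Hub → Fin 4 → Bool
        p u j = ((• rimIdx u j) ∈? TH.rot (hubKind u) (hubIdx u)) ∧
                ((• rimIdx u (cyclic j)) ∈? TH.rot (hubKind u) (rimIdx u j))

    spoke : ∀ u j → hubV u ~ᴴ rimV u j
    spoke u j = edgeᴴ (hubLevel< u) (kind-hubLevel u) (hubIdx< u) {• rimIdx u j}
      (∈?⇒∈ _ (proj₁ (spoke-ok u j)))

    rimEdge : ∀ u j → rimV u j ~ᴴ rimV u (cyclic j)
    rimEdge u j = edgeᴴ (hubLevel< u) (kind-hubLevel u) (rimIdx< u j) {• rimIdx u (cyclic j)}
      (∈?⇒∈ _ (proj₂ (spoke-ok u j)))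

    window : V → Window
    window x = kind m (pred (lev x)) , K x , kind m (suc (lev x))

    private
      window-below : ∀ m ℓ → ℓ < m → (below m ℓ , below m (suc ℓ)) ≡ (mid , mid)
        ⊎ (below m ℓ , below m (suc ℓ)) ≡ (mid , bot)
      window-below (suc zero)    zero    _        = inj₂ refl
      window-below (suc (suc m)) zero    _        = inj₁ refl
      window-below (suc m)       (suc ℓ) (s≤s ℓ<) = window-below m ℓ ℓ<

      window₃ : ∀ m ℓ → suc ℓ ≤ m → (below m ℓ , below m (suc ℓ) , below m (suc (suc ℓ))) ∈
                (mid , mid , mid) ∷ (mid , mid , bot) ∷ (mid , bot , bot) ∷ []
      window₃ (suc zero)          zero    _        = there (there (here refl))
      window₃ (suc (suc zero))    zero    _        = there (here refl)
      window₃ (suc (suc (suc m))) zero    _        = here refl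
      window₃ (suc m)             (suc ℓ) (s≤s ℓ<) = window₃ m ℓ ℓ<

      window∈ : ∀ ℓ → ℓ < levels m → (kind m (pred ℓ) , kind m ℓ , kind m (suc ℓ)) ∈ windows
      window∈ zero          _ = here refl
      window∈ (suc zero)    _ with window-below (suc m) 0 (s≤s z≤n)
      ... | inj₁ eq rewrite cong proj₂ eq = there (here refl)
      ... | inj₂ eq rewrite cong proj₂ eq = there (there (here refl))
      window∈ (suc (suc ℓ)) (s≤s (s≤s ℓ<)) = there (there (there (window₃ (suc m) ℓ ℓ<)))

      kindAt-window : ∀ x c → kindAt (window x) c ≡ kind m (move c (lev x))
      kindAt-window x (↑ _) = refl
      kindAt-window x (• _) = refl
      kindAt-window x (↓ _) = refl

      -- Reading the level of `go x d` both from `x` and from `go x c` gives the equation between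
      -- heights from which `composes-height` recovers the tabulated adjacency.
      adjAt : ∀ {x c d} → c ∈ GG.R x → d ∈ GG.R x → go x c ~ᴳ go x d → AdjAt (window x) c d
      adjAt {x} {c} {d} c∈ d∈ yz with e , e∈ , eq ← GG.edge⁻ yz =
        adjAt⁺ (window x)
          (subst (e ∈_) (trans (GG.R-go {x} c∈)
            (cong (λ k → TG.rot k (pos c)) (sym (kindAt-window x c)))) e∈)
          (composes-height c e d heights)
          (trans (sym (GG.idx-go {go x c} e∈)) (trans (cong idx (sym eq)) (GG.idx-go {x} d∈)))
        where
        ℓ = lev x
        lev≡ : move d ℓ ≡ move e (lev (go x c))
        lev≡ = trans (sym (GG.lev-go {x} d∈)) (trans (cong lev eq) (GG.lev-go {go x c} e∈))
        heights : height c + height e ≡ suc (height d)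
        heights = +-cancelˡ-≡ ℓ _ _ (begin
          ℓ + (height c + height e)          ≡⟨ sym (+-assoc ℓ _ _) ⟩
          ℓ + height c + height e            ≡⟨ cong (_+ height e)
            (sym (move-height c {m} {ℓ} (GG.code-allowed {x} c∈))) ⟩
          suc (move c ℓ) + height e          ≡⟨ cong (λ l → suc l + height e) (sym (GG.lev-go {x} c∈))
            ⟩
          suc (lev (go x c) + height e)      ≡⟨ cong suc
            (sym (move-height e {m} {lev (go x c)} (GG.code-allowed {go x c} e∈))) ⟩
          suc (suc (move e (lev (go x c))))  ≡⟨ cong (2 +_) (sym lev≡) ⟩
          suc (suc (move d ℓ))               ≡⟨ cong suc
            (move-height d {m} {ℓ} (GG.code-allowed {x} d∈)) ⟩
          suc (ℓ + height d)                 ≡⟨ sym (+-suc ℓ _) ⟩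
          ℓ + suc (height d)                 ∎)
          where open ≡-Reasoning

    record WheelAt (x y₁ y₂ y₃ y₄ : V) : Set where
      field
        hub  : Hub
        x≡   : x ≡ hubV hub
        r₁   : ∃ λ j → y₁ ≡ rimV hub j
        r₂   : ∃ λ j → y₂ ≡ rimV hub j
        r₃   : ∃ λ j → y₃ ≡ rimV hub j
        r₄   : ∃ λ j → y₄ ≡ rimV hub j
        opp₁ : ¬ y₁ ~ᴳ y₃
        opp₂ : ¬ y₂ ~ᴳ y₄

    private
      wheelAt-codes : ∀ {x c₁ c₂ c₃ c₄} → c₁ ∈ GG.R x → c₂ ∈ GG.R x → c₃ ∈ GG.R x → c₄ ∈ GG.R x →
        go x c₁ ~ᴳ go x c₂ → go x c₂ ~ᴳ go x c₃ → go x c₃ ~ᴳ go x c₄ → go x c₄ ~ᴳ go x c₁ →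
        go x c₁ ≢ go x c₃ → go x c₂ ≢ go x c₄ → WheelAt x (go x c₁) (go x c₂) (go x c₃) (go x c₄)
      wheelAt-codes {x} {c₁} {c₂} {c₃} {c₄} c₁∈ c₂∈ c₃∈ c₄∈ a₁₂ a₂₃ a₃₄ a₄₁ n₁₃ n₂₄ = record
        { hub = u ; x≡ = sym (place-unique lev≡ idx≡)
        ; r₁ = rim c₁∈ (here refl) ; r₂ = rim c₂∈ (there (here refl))
        ; r₃ = rim c₃∈ (there (there (here refl))) ; r₄ = rim c₄∈ (there (there (there (here refl))))
        ; opp₁ = λ a₁₃ → proj₁ (proj₂ wc) (adjAt {x} c₁∈ c₃∈ a₁₃)
        ; opp₂ = λ a₂₄ → proj₂ (proj₂ wc) (adjAt {x} c₂∈ c₄∈ a₂₄) }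
        where
        cs = c₁ ∷ c₂ ∷ c₃ ∷ c₄ ∷ []
        wc = wheelCodes (window∈ (lev x) (lev< x)) (idx< x) c₁∈ c₂∈ c₃∈ c₄∈
               (adjAt {x} c₁∈ c₂∈ a₁₂) (adjAt {x} c₂∈ c₃∈ a₂₃) (adjAt {x} c₃∈ c₄∈ a₃₄)
                 (adjAt {x} c₄∈ c₁∈ a₄₁)
               (n₁₃ ∘ cong (go x)) (n₂₄ ∘ cong (go x))
        found = wheelCodes⁻ (proj₁ wc)
        u = proj₁ found
        lev≡ : lev x ≡ hubLevel u
        lev≡ = level-hub u x (=ᵏ⇒≡ _ _ (proj₁ (proj₂ found)))
        idx≡ : idx x ≡ hubIdx u
        idx≡ = ≡ᵇ⇒≡ _ _ (proj₁ (proj₂ (proj₂ found)))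
        rim : ∀ {c} → c ∈ GG.R x → c ∈ cs → ∃ λ j → go x c ≡ rimV u j
        rim {c} c∈ c∈cs = rim′
          (∈rims u {c} (all-∈ {p = λ c → c ∈? rims u} {cs} (proj₂ (proj₂ (proj₂ found))) c∈cs))
          where
          rim′ : (∃ λ j → c ≡ • rimIdx u j) → ∃ λ j → go x c ≡ rimV u j
          rim′ (j , refl) = j , sym (place-unique (trans (GG.lev-go {x} c∈) lev≡) (GG.idx-go {x} c∈))

    wheelAt : ∀ {x y₁ y₂ y₃ y₄} → x ~ᴳ y₁ → x ~ᴳ y₂ → x ~ᴳ y₃ → x ~ᴳ y₄ →
              y₁ ~ᴳ y₂ → y₂ ~ᴳ y₃ → y₃ ~ᴳ y₄ → y₄ ~ᴳ y₁ → y₁ ≢ y₃ → y₂ ≢ y₄ → WheelAt x y₁ y₂ y₃ y₄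
    wheelAt xy₁ xy₂ xy₃ xy₄ = match (GG.edge⁻ xy₁) (GG.edge⁻ xy₂) (GG.edge⁻ xy₃) (GG.edge⁻ xy₄)
      where
      Nbr : V → V → Set
      Nbr x y = ∃ λ c → c ∈ GG.R x × y ≡ go x c
      match : ∀ {x y₁ y₂ y₃ y₄} → Nbr x y₁ → Nbr x y₂ → Nbr x y₃ → Nbr x y₄ →
              y₁ ~ᴳ y₂ → y₂ ~ᴳ y₃ → y₃ ~ᴳ y₄ → y₄ ~ᴳ y₁ → y₁ ≢ y₃ → y₂ ≢ y₄ → WheelAt x y₁ y₂ y₃ y₄
      match {x} (c₁ , c₁∈ , refl) (c₂ , c₂∈ , refl) (c₃ , c₃∈ , refl) (c₄ , c₄∈ , refl) =
        wheelAt-codes {x} c₁∈ c₂∈ c₃∈ c₄∈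

    -- An edge of G changes Λ by 2 at most, so a column of H, which has to gain 2 per
    -- edge on average, gains exactly 2 on every edge.
    Λ : V → ℕ
    Λ x = 2 * lev x + weight (K x) (idx x)

    Λ-slope : ∀ {x y} → x ~ᴳ y → Λ y ≤ 2 + Λ x
    Λ-slope {x} xy with c , c∈ , refl ← GG.edge⁻ xy = +-cancelˡ-≤ 2 _ _ (begin
      2 + Λ (go x c)
        ≡⟨ cong (2 +_) (cong₂ (λ l w → 2 * l + w) (GG.lev-go {x} c∈)
        (cong₂ weight (GG.K-go {x} c∈) (GG.idx-go {x} c∈))) ⟩
      2 + (2 * move c ℓ + w′)
        ≡⟨ solve 2 (λ l w → con 2 :+ (con 2 :* l :+ w) := con 2 :* (con 1 :+ l) :+ w) refl (move c ℓ)
        w′ ⟩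
      2 * suc (move c ℓ) + w′
        ≡⟨ cong (λ l → 2 * l + w′) (move-height c {m} {ℓ} (GG.code-allowed {x} c∈)) ⟩
      2 * (ℓ + height c) + w′
        ≡⟨ solve 3 (λ l h w → con 2 :* (l :+ h) :+ w := con 2 :* l :+ (con 2 :* h :+ w)) refl ℓ
        (height c) w′ ⟩
      2 * ℓ + (2 * height c + w′)
        ≤⟨ +-monoʳ-≤ (2 * ℓ) (≤ᵇ⇒≤ _ _ (GG.edge-check {slope?} slope {x} c∈)) ⟩
      2 * ℓ + (4 + weight (K x) (idx x))
        ≡⟨ solve 2 (λ a b → a :+ (con 4 :+ b) := con 2 :+ (con 2 :+ (a :+ b))) refl (2 * ℓ)
        (weight (K x) (idx x)) ⟩
      2 + (2 + Λ x)                                  ∎)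
      where
      open ≤-Reasoning
      open +-*-Solver
      ℓ = lev x
      w′ = weight (kind m (move c ℓ)) (pos c)

    -- The weights 3 and 5 are excluded by parity, each by an `odd k` for the weight 2k + 1; at the
    -- top a weight below 4 makes `Λ` too small.
    Λ-ring : ∀ {y ℓ} → Λ y ≡ 2 * ℓ + 4 → lev y ≡ ℓ × idx y < 4
    Λ-ring {y} {ℓ} eq with ∨⁻ {(weight (K y) (idx y) ≡ᵇ 4) ∧ (idx y <ᵇ 4)}
      (GG.vertex-check {parity?} parities y)
    ... | inj₁ t = let w≡ , a< = ∧⁻ {weight (K y) (idx y) ≡ᵇ 4} t in
          *-cancelˡ-≡ (lev y) ℓ 2
            (+-cancelʳ-≡ 4 _ _ (trans (cong (2 * lev y +_) (sym (≡ᵇ⇒≡ _ _ w≡))) eq)) , <ᵇ⇒< _ _ a<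
    ... | inj₂ t with ∨⁻ {weight (K y) (idx y) ≡ᵇ 3} t
    ... | inj₁ w≡ = contradiction (trans (sym eq) (cong (2 * lev y +_) (≡ᵇ⇒≡ _ _ w≡))) (odd 1)
      where
      odd : ∀ k → 2 * ℓ + 4 ≢ 2 * lev y + (2 * k + 1)
      odd k p = even≢odd (ℓ + 2) (lev y + k)
        (trans (*-distribˡ-+ 2 ℓ 2)
        (trans p (solve 2 (λ a b → con 2 :* a :+ (con 2 :* b :+ con 1) := con 1 :+ con 2 :*
        (a :+ b)) refl (lev y) k)))
        where open +-*-Solver
    ... | inj₂ t with ∨⁻ {weight (K y) (idx y) ≡ᵇ 5} t
    ... | inj₁ w≡ = contradiction (trans (sym eq) (cong (2 * lev y +_) (≡ᵇ⇒≡ _ _ w≡))) (odd 2)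
      where
      odd : ∀ k → 2 * ℓ + 4 ≢ 2 * lev y + (2 * k + 1)
      odd k p = even≢odd (ℓ + 2) (lev y + k)
        (trans (*-distribˡ-+ 2 ℓ 2)
        (trans p (solve 2 (λ a b → con 2 :* a :+ (con 2 :* b :+ con 1) := con 1 :+ con 2 :*
        (a :+ b)) refl (lev y) k)))
        where open +-*-Solver
    ... | inj₂ t = let k≡ , w< = ∧⁻ {K y =ᵏ top} t in
          contradiction (subst (λ l → 2 * l + weight (K y) (idx y) ≡ 2 * ℓ + 4)
            (top⇒0 (lev y) (=ᵏ⇒≡ _ _ k≡)) eq)
                        (<⇒≢ (≤-trans (<ᵇ⇒< _ _ w<) (m≤n+m 4 (2 * ℓ))))

    col : ℕ → Fin 4 → V
    col ℓ i = vt ℓ (toℕ i)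

    ring<size : ∀ k {a} → a < 4 → a < size k
    ring<size top a< = ≤-trans a< (≤ᵇ⇒≤ 4 9 tt)
    ring<size mid a< = ≤-trans a< (≤ᵇ⇒≤ 4 12 tt)
    ring<size bot a< = ≤-trans a< (≤ᵇ⇒≤ 4 56 tt)

    lev-col : ∀ {ℓ} i → ℓ < levels m → lev (col ℓ i) ≡ ℓ
    lev-col {ℓ} i ℓ< = lev-vt ℓ< refl (ring<size (kind m ℓ) (toℕ<n i))

    idx-col : ∀ {ℓ} i → ℓ < levels m → idx (col ℓ i) ≡ toℕ i
    idx-col {ℓ} i ℓ< = idx-vt ℓ< refl (ring<size (kind m ℓ) (toℕ<n i))

    private
      column-ok : ∀ i → T ((↓ toℕ i) ∈? TH.rot top (toℕ i))
        × T (((↓ toℕ i) ∈? TH.rot mid (toℕ i)) ∧ ((• toℕ i) ∈? TH.rot top (4 + toℕ i)))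
      column-ok i = ∧⁻ (valid₄-at (λ i → ((↓ toℕ i) ∈? TH.rot top (toℕ i))
        ∧ (((↓ toℕ i) ∈? TH.rot mid (toℕ i)) ∧ ((• toℕ i) ∈? TH.rot top (4 + toℕ i)))) columnsH i)

    topEdge : ∀ i → rimV hubT i ~ᴴ col 0 i
    topEdge i = edgeᴴ (s≤s z≤n) refl (rimIdx< hubT i) {• toℕ i}
      (∈?⇒∈ _ (proj₂ (∧⁻ {(↓ toℕ i) ∈? TH.rot mid (toℕ i)} (proj₂ (column-ok i)))))

    colEdge : ∀ {ℓ} i → ℓ < B → col ℓ i ~ᴴ col (suc ℓ) i
    colEdge {zero} i _ = edgeᴴ (s≤s z≤n) refl (ring<size top (toℕ<n i)) {↓ toℕ i}
      (∈?⇒∈ _ (proj₁ (column-ok i)))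
    colEdge {suc ℓ} i (s≤s ℓ<) = edgeᴴ (s≤s (m≤n⇒m≤1+n ℓ<)) (below-mid ℓ<) (ring<size mid (toℕ<n i))
      {↓ toℕ i}
      (∈?⇒∈ _ (proj₁ (∧⁻ {(↓ toℕ i) ∈? TH.rot mid (toℕ i)} (proj₂ (column-ok i)))))

    Λ-vt : ∀ {ℓ a k} → ℓ < levels m → kind m ℓ ≡ k → a < size k → Λ (vt ℓ a) ≡ 2 * ℓ + weight k a
    Λ-vt ℓ< k≡ a< = cong₂ (λ l w → 2 * l + w) (lev-vt ℓ< k≡ a<)
      (cong₂ weight (K-vt ℓ< k≡ a<) (idx-vt ℓ< k≡ a<))

    Λ-hub : ∀ u → Λ (hubV u) ≡ 2 * hubLevel u + weight (hubKind u) (hubIdx u)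
    Λ-hub u = Λ-vt (hubLevel< u) (kind-hubLevel u) (hubIdx< u)

    Λ-rim : ∀ u j → Λ (rimV u j) ≡ 2 * hubLevel u + weight (hubKind u) (rimIdx u j)
    Λ-rim u j = Λ-vt (hubLevel< u) (kind-hubLevel u) (rimIdx< u j)

    Λ-col : ∀ {ℓ} i → ℓ < levels m → Λ (col ℓ i) ≡ 2 * ℓ + 4
    Λ-col {ℓ} i ℓ< = trans (Λ-vt ℓ< refl (ring<size (kind m ℓ) (toℕ<n i)))
      (cong (2 * ℓ +_) (weight-ring (kind m ℓ) (toℕ<n i)))

    OnWheel Core : V → Set
    OnWheel x = T (onWheel? (K x) (idx x))
    Core x = T (core? (K x) (idx x))

    onWheel-cases : ∀ x → OnWheel x → (∃ λ u → x ≡ hubV u) ⊎ (∃ λ u → ∃ λ j → x ≡ rimV u j)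
    onWheel-cases x t =
      let u , _ , s = any-∃ (λ u → (K x =ᵏ hubKind u) ∧ ((idx x ≡ᵇ hubIdx u) ∨ any (λ j → idx x ≡ᵇ rimIdx u j) (allFin 4))) hubs t
          k≡ , r = ∧⁻ {K x =ᵏ hubKind u} s
          lev≡ = level-hub u x (=ᵏ⇒≡ _ _ k≡)
      in case ∨⁻ {idx x ≡ᵇ hubIdx u} r of λ where
        (inj₁ eq) → inj₁ (u , sym (place-unique lev≡ (≡ᵇ⇒≡ _ _ eq)))
        (inj₂ js) → let j , _ , eq = any-∃ (λ j → idx x ≡ᵇ rimIdx u j) (allFin 4) js in
                    inj₂ (u , j , sym (place-unique lev≡ (≡ᵇ⇒≡ _ _ eq)))

    hub-onWheel : ∀ u → OnWheel (hubV u)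
    hub-onWheel u = subst₂ (λ k a → T (onWheel? k a)) (sym (K-hub u)) (sym (idx-hub u))
      (hubs-at (λ u → onWheel? (hubKind u) (hubIdx u)) onWheel-hub u)

    rim-onWheel : ∀ u j → OnWheel (rimV u j)
    rim-onWheel u j = subst₂ (λ k a → T (onWheel? k a)) (sym (K-rim u j)) (sym (idx-rim u j))
      (all₄-at (λ j → onWheel? (hubKind u) (rimIdx u j))
        (hubs-at (λ u → all₄ λ j → onWheel? (hubKind u) (rimIdx u j)) onWheel-rim u) j)

    -- Rigidity of the embeddings of H in G.

    module _ (f : V → V) (f-inj : Injective _≡_ _≡_ f) (hom : ∀ {x y} → x ~ᴴ y → f x ~ᴳ f y) where

      image : ∀ u → WheelAt (f (hubV u)) (f (rimV u zero)) (f (rimV u (suc zero)))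
                            (f (rimV u (suc (suc zero)))) (f (rimV u (suc (suc (suc zero)))))
      image u = wheelAt (hom (spoke u _)) (hom (spoke u _)) (hom (spoke u _)) (hom (spoke u _))
        (hom (rimEdge u zero)) (hom (rimEdge u (suc zero))) (hom (rimEdge u (suc (suc zero))))
          (hom (rimEdge u (suc (suc (suc zero)))))
        (λ eq → contradiction (rimV-injective u (f-inj eq)) λ ())
          (λ eq → contradiction (rimV-injective u (f-inj eq)) λ ())

      σ : Hub → Hub
      σ u = WheelAt.hub (image u)

      f-hub : ∀ u → f (hubV u) ≡ hubV (σ u)
      f-hub u = WheelAt.x≡ (image u)

      f-rim : ∀ u j → ∃ λ j′ → f (rimV u j) ≡ rimV (σ u) j′
      f-rim u zero                   = WheelAt.r₁ (image u)
      f-rim u (suc zero)             = WheelAt.r₂ (image u)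
      f-rim u (suc (suc zero))       = WheelAt.r₃ (image u)
      f-rim u (suc (suc (suc zero))) = WheelAt.r₄ (image u)

      ρ : Hub → Fin 4 → Fin 4
      ρ u j = proj₁ (f-rim u j)

      f-rim≡ : ∀ u j → f (rimV u j) ≡ rimV (σ u) (ρ u j)
      f-rim≡ u j = proj₂ (f-rim u j)

      ρ-injective : ∀ u → Injective _≡_ _≡_ (ρ u)
      ρ-injective u {i} {j} eq = rimV-injective u (f-inj
        (trans (f-rim≡ u i) (trans (cong (rimV (σ u)) eq) (sym (f-rim≡ u j)))))

      ~ᴳ-sym : ∀ {x y} → x ~ᴳ y → y ~ᴳ x
      ~ᴳ-sym {x} = GG.~-sym {x}

      opposite : ∀ u j → ¬ f (rimV u j) ~ᴳ f (rimV u (cyclic (cyclic j)))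
      opposite u zero                   = WheelAt.opp₁ (image u)
      opposite u (suc zero)             = WheelAt.opp₂ (image u)
      opposite u (suc (suc zero))       = WheelAt.opp₁ (image u) ∘ ~ᴳ-sym
      opposite u (suc (suc (suc zero))) = WheelAt.opp₂ (image u) ∘ ~ᴳ-sym

      f-onWheel : ∀ {x} → OnWheel x → OnWheel (f x)
      f-onWheel {x} t with onWheel-cases x t
      ... | inj₁ (u , refl)     = subst OnWheel (sym (f-hub u)) (hub-onWheel (σ u))
      ... | inj₂ (u , j , refl) = subst OnWheel (sym (f-rim≡ u j)) (rim-onWheel (σ u) (ρ u j))

      -- Wheel vertices already fill all places on the wheels of G, so column vertices off the
      -- wheels remain off them.
      f-onWheel⁻ : ∀ {x} → OnWheel (f x) → OnWheel x
      f-onWheel⁻ = invariant⁻ f f-inj (λ x → onWheel? (K x) (idx x)) f-onWheel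

      col-offWheel : ∀ i → ¬ OnWheel (col 0 i) × ¬ OnWheel (col 1 i)
      col-offWheel i = subst₂ (λ k a → ¬ T (onWheel? k a)) (sym (cong (kind m) (lev-col i (s≤s z≤n))))
        (sym (idx-col i (s≤s z≤n)))
                         (not⁻ (valid₄-at (λ i → not (onWheel? top (toℕ i))) (valid tt) i))
                     , subst (λ k → ¬ T (onWheel? k (idx (col 1 i))))
                       (sym (cong (kind m) (lev-col i (s≤s (s≤s z≤n))))) (λ ())

      stays : ∀ {x} → K x ≡ bot → ∀ e → e ∈ GG.R x → T (stays? e) → OnWheel (go x e)
      stays {x} k≡ (• e) e∈ t = subst₂ (λ k a → T (onWheel? k a)) (sym (trans (GG.K-go {x} e∈) k≡))
        (sym (GG.idx-go {x} e∈)) t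

      -- If t_i went to y_j, then the next vertex r_i of the column would go to a neighbour of y_j
      -- off the wheels. All neighbours of such a vertex lie on wheels, which leaves no place for
      -- the vertex after r_i.
      module Trap (i j : Fin 4) (ft≡ : f (rimV hubT i) ≡ rimV (hubB j) (suc (suc zero))) where

        x₀ = f (col 0 i)
        x₁ = f (col 1 i)

        off₀ : ¬ OnWheel x₀
        off₀ = proj₁ (col-offWheel i) ∘ f-onWheel⁻

        off₁ : ¬ OnWheel x₁
        off₁ = proj₂ (col-offWheel i) ∘ f-onWheel⁻

        leaves : ∀ b → K x₀ ≡ bot → idx x₀ ≡ b → T (all stays? (TG.rot bot b)) → ⊥
        leaves b k≡ a≡ t = leave (GG.edge⁻ (hom (colEdge {0} i (s≤s z≤n))))
          where
          leave : (∃ λ e → e ∈ GG.R x₀ × x₁ ≡ go x₀ e) → ⊥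
          leave (e , e∈ , eq) = off₁ (subst OnWheel (sym eq) (stays k≡ e e∈
            (all-∈ {p = stays?} {TG.rot bot b} t (subst (e ∈_) (cong₂ TG.rot k≡ a≡) e∈))))

        step : ∀ c → lev x₀ ≡ move c B → idx x₀ ≡ pos c → T (trapped? j c) → ⊥
        step (• b) l a t = ∨-elim {onWheel? bot b} t
          (λ on → off₀ (subst₂ (λ k a → T (onWheel? k a)) (sym k≡) (sym a) on)) (leaves b k≡ a)
          where
          k≡ : K x₀ ≡ bot
          k≡ = trans (cong (kind m) l) B-kind

        caught : ⊥
        caught =
          let c , c∈ , l , a = edgeᴳ⁻ ≤-refl B-kind (rimIdx< (hubB j) (suc (suc zero))) (subst (_~ᴳ x₀) ft≡ (hom (topEdge i)))
          in step c l a (all-∈ {p = trapped? j} {TG.rot bot (24 + toℕ j)}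
               (valid₄-at (λ j → all (trapped? j) (TG.rot bot (24 + toℕ j))) trapped j) c∈)

      -- Otherwise a column would be trapped on the wheels at the bottom.
      σ-top : σ hubT ≡ hubT
      σ-top = decide (σ hubT) refl
        where
        decide : ∀ u → σ hubT ≡ u → σ hubT ≡ hubT
        decide hubT     eq = eq
        decide (hubB j) eq =
          -- The rim is mapped onto the rim, so some t_i hits y_j, which `rimIdx` lists at
          -- `suc (suc zero)`.
          let i , ρi = injective⇒onto (ρ hubT) (ρ-injective hubT) (suc (suc zero))
          in ⊥-elim (Trap.caught i j (trans (f-rim≡ hubT i) (cong₂ rimV eq ρi)))

      f-h : f (hubV hubT) ≡ hubV hubT
      f-h = trans (f-hub hubT) (cong hubV σ-top)

      f-t : ∀ j → f (rimV hubT j) ≡ rimV hubT (ρ hubT j)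
      f-t j = trans (f-rim≡ hubT j) (cong (λ u → rimV u (ρ hubT j)) σ-top)

      σ-bot : ∀ i → ∃ λ i′ → σ (hubB i) ≡ hubB i′
      σ-bot i = decide (σ (hubB i)) refl
        where
        decide : ∀ u → σ (hubB i) ≡ u → ∃ λ i′ → σ (hubB i) ≡ hubB i′
        decide (hubB i′) eq = i′ , eq
        decide hubT      eq =
          contradiction (trans (sym (lev-hub (hubB i))) (trans (cong lev same) (lev-hub hubT))) λ ()
          where
          same : hubV (hubB i) ≡ hubV hubT
          same = f-inj (trans (f-hub (hubB i)) (trans (cong hubV eq) (sym f-h)))

      τ : Fin 4 → Fin 4
      τ i = proj₁ (σ-bot i)

      f-k : ∀ i → f (hubV (hubB i)) ≡ hubV (hubB (τ i))
      f-k i = trans (f-hub (hubB i)) (cong hubV (proj₂ (σ-bot i)))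

      f-b : ∀ i j → f (rimV (hubB i) j) ≡ rimV (hubB (τ i)) (ρ (hubB i) j)
      f-b i j = trans (f-rim≡ (hubB i) j) (cong (λ u → rimV u (ρ (hubB i) j)) (proj₂ (σ-bot i)))

      weight-t : ∀ j → weight top (rimIdx hubT j) ≡ 2
      weight-t j = ≡ᵇ⇒≡ _ _ (valid₄-at (λ j → weight top (rimIdx hubT j) ≡ᵇ 2) (valid tt) j)

      weight-b : ∀ i j → 4 ≤ weight bot (rimIdx (hubB i) j)
      weight-b i j = ≤ᵇ⇒≤ _ _ (all₄-at (λ j → 4 ≤ᵇ weight bot (rimIdx (hubB i) j))
        (valid₄-at (λ i → all₄ λ j → 4 ≤ᵇ weight bot (rimIdx (hubB i) j)) (valid tt) i) j)

      weight-xyz : ∀ i j → weight bot (rimIdx (hubB i) (suc j)) ≡ 5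
      weight-xyz i zero             =
        ≡ᵇ⇒≡ _ _ (valid₄-at (λ i → weight bot (12 + toℕ i) ≡ᵇ 5) (valid tt) i)
      weight-xyz i (suc zero)       =
        ≡ᵇ⇒≡ _ _ (valid₄-at (λ i → weight bot (24 + toℕ i) ≡ᵇ 5) (valid tt) i)
      weight-xyz i (suc (suc zero)) =
        ≡ᵇ⇒≡ _ _ (valid₄-at (λ i → weight bot (16 + toℕ i) ≡ᵇ 5) (valid tt) i)

      weight-k : ∀ i → weight bot (hubIdx (hubB i)) ≡ 5
      weight-k i = ≡ᵇ⇒≡ _ _ (valid₄-at (λ i → weight bot (20 + toℕ i) ≡ᵇ 5) (valid tt) i)

      Λ-t : ∀ j → Λ (rimV hubT j) ≡ 2
      Λ-t j = trans (Λ-rim hubT j) (weight-t j)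

      -- The upper bound, from the t_i downwards: the top wheel stays in place, so `Λ` starts with
      -- 2.
      climb : ∀ ℓ i → ℓ < levels m → Λ (f (col ℓ i)) ≤ 2 * ℓ + 4
      climb zero i _ = ≤-trans (Λ-slope (hom (topEdge i)))
        (≤-reflexive (cong (2 +_) (trans (cong Λ (f-t i)) (Λ-t (ρ hubT i)))))
      climb (suc ℓ) i (s≤s ℓ<) = ≤-trans (Λ-slope (hom (colEdge {ℓ} i ℓ<)))
        (≤-trans (+-monoʳ-≤ 2 (climb ℓ i (m≤n⇒m≤1+n ℓ<)))
        (≤-reflexive (solve 1 (λ l → con 2 :+ (con 2 :* l :+ con 4) := con 2 :* (con 1 :+ l) :+ con 4)
          refl ℓ)))
        where open +-*-Solver

      -- The lower bound, from the other end of the column; `d` is the distance to the bottom. Which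
      -- rim vertex is the image of b_i is still open, but all of them have weight at least 4.
      descend : ∀ d ℓ i → ℓ + d ≡ B → 2 * B + 4 ≤ Λ (f (col ℓ i)) + 2 * d
      descend zero ℓ i eq with refl ← trans (sym (+-identityʳ ℓ)) eq = begin
        2 * B + 4
          ≤⟨ +-monoʳ-≤ (2 * B) (weight-b (τ i) (ρ (hubB i) zero)) ⟩
        2 * B + weight bot (rimIdx (hubB (τ i)) (ρ (hubB i) zero))
          ≡⟨ Λ-rim (hubB (τ i)) (ρ (hubB i) zero) ⟨
        Λ (rimV (hubB (τ i)) (ρ (hubB i) zero))                          ≡⟨ cong Λ (f-b i zero) ⟨
        Λ (f (col B i))                                                  ≡⟨ +-identityʳ _ ⟨
        Λ (f (col B i)) + 2 * 0                                          ∎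
        where open ≤-Reasoning
      descend (suc d) ℓ i eq = begin
        2 * B + 4
          ≤⟨ descend d (suc ℓ) i (trans (sym (+-suc ℓ d)) eq) ⟩
        Λ (f (col (suc ℓ) i)) + 2 * d
          ≤⟨ +-monoˡ-≤ (2 * d) (Λ-slope (hom (colEdge {ℓ} i (m+1+n≤m′ eq)))) ⟩
        2 + Λ (f (col ℓ i)) + 2 * d
          ≡⟨ solve 2 (λ a d → con 2 :+ a :+ con 2 :* d := a :+ con 2 :* (con 1 :+ d)) refl
          (Λ (f (col ℓ i))) d ⟩
        Λ (f (col ℓ i)) + 2 * suc d               ∎
        where
        open ≤-Reasoning
        open +-*-Solver
        m+1+n≤m′ : ∀ {ℓ d n} → ℓ + suc d ≡ n → ℓ < n
        m+1+n≤m′ {ℓ} {d} refl = ≤-trans (s≤s (m≤m+n ℓ d)) (≤-reflexive (sym (+-suc ℓ d)))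

      Λ-f-col : ∀ {ℓ} i → ℓ < levels m → Λ (f (col ℓ i)) ≡ 2 * ℓ + 4
      Λ-f-col {ℓ} i ℓ< = ≤-antisym (climb ℓ i ℓ<) (+-cancelʳ-≤ (2 * d) _ _ (begin
        2 * ℓ + 4 + 2 * d            ≡⟨ solve 2
          (λ l d → con 2 :* l :+ con 4 :+ con 2 :* d := con 2 :* (l :+ d) :+ con 4) refl ℓ d ⟩
        2 * (ℓ + d) + 4              ≡⟨ cong (λ l → 2 * l + 4) ℓ+d ⟩
        2 * B + 4                    ≤⟨ descend d ℓ i ℓ+d ⟩
        Λ (f (col ℓ i)) + 2 * d      ∎))
        where
        open ≤-Reasoning
        open +-*-Solver
        d = B ∸ ℓ
        ℓ+d : ℓ + d ≡ B
        ℓ+d = m+[n∸m]≡n (s≤s⁻¹ ℓ<)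

      -- On every other rim vertex `Λ` is 2B + 5, but the column ends with exactly 2B + 4.
      f-b₀ : ∀ i → ρ (hubB i) zero ≡ zero
      f-b₀ i = decide (ρ (hubB i) zero) refl
        where
        decide : ∀ j → ρ (hubB i) zero ≡ j → ρ (hubB i) zero ≡ zero
        decide zero    eq = eq
        decide (suc j) eq = contradiction (+-cancelˡ-≡ (2 * B) 4 5 (begin
          2 * B + 4                                                   ≡⟨ Λ-f-col i ≤-refl ⟨
          Λ (f (col B i))                                             ≡⟨ cong Λ (f-b i zero) ⟩
          Λ (rimV (hubB (τ i)) (ρ (hubB i) zero))
            ≡⟨ Λ-rim (hubB (τ i)) (ρ (hubB i) zero) ⟩
          2 * B + weight bot (rimIdx (hubB (τ i)) (ρ (hubB i) zero))
            ≡⟨ cong (λ j → 2 * B + weight bot (rimIdx (hubB (τ i)) j)) eq ⟩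
          2 * B + weight bot (rimIdx (hubB (τ i)) (suc j))
            ≡⟨ cong (2 * B +_) (weight-xyz (τ i) j) ⟩
          2 * B + 5                                                   ∎)) λ ()
          where open ≡-Reasoning

      ring : ∀ x → idx x < 4 → ∃ λ i → x ≡ col (lev x) i
      ring x a< = fromℕ< a< , sym (place-unique refl (sym (toℕ-fromℕ< a<)))

      core-cases : ∀ x → Core x → idx x < 4 ⊎ OnWheel x
      core-cases x t with ∨⁻ (⇒⁻ {core? (K x) (idx x)} (GG.vertex-check {core-ok?} core-ok x) t)
      ... | inj₁ a< = inj₁ (<ᵇ⇒< _ _ a<)
      ... | inj₂ on = inj₂ on

      -- On columns this is `Λ-f-col`. As b goes to a b, injectivity sends the rest of a bottom rim,
      -- of constant weight 5, to the rest of a bottom rim.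
      Λ-f : ∀ x → Core x → Λ (f x) ≡ Λ x
      Λ-f x t with core-cases x t
      ... | inj₁ a< = let i , eq = ring x a< in trans (cong (Λ ∘ f) eq) (trans (Λ-f-col i (lev< x))
                        (sym (trans (cong Λ eq) (Λ-col i (lev< x)))))
      ... | inj₂ on with onWheel-cases x on
      ... | inj₁ (hubT , refl)   = cong Λ f-h
      ... | inj₁ (hubB i , refl) = trans (cong Λ (f-k i))
        (trans (Λ-hub (hubB (τ i)))
        (trans (cong (2 * B +_) (trans (weight-k (τ i)) (sym (weight-k i))))
        (sym (Λ-hub (hubB i)))))
      ... | inj₂ (hubT , j , refl) = trans (cong Λ (f-t j)) (trans (Λ-t _) (sym (Λ-t j)))
      ... | inj₂ (hubB i , zero , refl) = trans (Λ-f-col i ≤-refl) (sym (Λ-col i ≤-refl))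
      ... | inj₂ (hubB i , suc j , refl) = trans (cong Λ (f-b i (suc j)))
        (trans (Λ-rim (hubB (τ i)) (ρ (hubB i) (suc j)))
              (trans (cong (2 * B +_) (trans (five (ρ (hubB i) (suc j)) refl) (sym (weight-xyz i j))))
                (sym (Λ-rim (hubB i) (suc j)))))
        where
        five : ∀ j′ → ρ (hubB i) (suc j) ≡ j′ → weight bot (rimIdx (hubB (τ i)) j′) ≡ 5
        five zero     eq = contradiction
          (ρ-injective (hubB i) {suc j} {zero} (trans eq (sym (f-b₀ i)))) λ ()
        five (suc j′) _  = weight-xyz (τ i) j′

      core-onWheel : ∀ {x} → OnWheel x → Core x
      core-onWheel {x} = ⇒⁻ {onWheel? (K x) (idx x)} (GG.vertex-check {onWheel-core?} onWheel-core x)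

      core-ring : ∀ x → idx x < 4 → Core x
      core-ring x a< = all-< {core? (K x)} (all-kinds {λ k → below? 4 (core? k)} ring-core (K x)) a<

      f-core : ∀ {x} → Core x → Core (f x)
      f-core {x} t = decide (core-cases x t)
        where
        decide : idx x < 4 ⊎ OnWheel x → Core (f x)
        decide (inj₁ a<) = let i , eq = ring x a< in
          core-ring (f x) (proj₂
            (Λ-ring {f x} {lev x} (trans (cong (Λ ∘ f) eq) (Λ-f-col i (lev< x)))))
        decide (inj₂ on) = core-onWheel (f-onWheel on)

      f-core⁻ : ∀ {x} → Core (f x) → Core x
      f-core⁻ = invariant⁻ f f-inj (λ x → core? (K x) (idx x)) f-core

      target-core : ∀ (p : Kind → ℕ → Bool → Bool) →
        Valid (TG.forEdges λ k a c k′ → p k a (core? k′ (pos c))) →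
                    ∀ {x y} → x ~ᴳ y → T (p (K x) (idx x) (core? (K y) (idx y)))
      target-core p chk {x} {y} xy = decide (GG.edge⁻ xy)
        where
        decide : (∃ λ c → c ∈ GG.R x × y ≡ go x c) → T (p (K x) (idx x) (core? (K y) (idx y)))
        decide (c , c∈ , eq) = subst₂ (λ k a → T (p (K x) (idx x) (core? k a)))
          (sym (trans (cong K eq) (GG.K-go {x} c∈))) (sym (trans (cong idx eq) (GG.idx-go {x} c∈)))
          (GG.edge-check {λ k a c k′ → p k a (core? k′ (pos c))} chk {x} c∈)

      isolated-independent : ∀ {x y} → x ~ᴳ y → Core x ⊎ Core y
      isolated-independent xy = ∨⁻ (target-core (λ k a b → core? k a ∨ b) independent xy)

      TopInner : V → Set
      TopInner x = T ((K x =ᵏ top) ∧ (3 <ᵇ idx x))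

      topInner-saturated : ∀ {x y} → TopInner x → x ~ᴳ y → Core y
      topInner-saturated {x} t xy =
        ⇒⁻ {(K x =ᵏ top) ∧ (3 <ᵇ idx x)} (target-core (λ k a b → not ((k =ᵏ top) ∧ (3 <ᵇ a)) ∨ b)
          saturatedTop xy) t

      topInner-V : ∀ {ℓ a} → ℓ ≡ 0 → 3 < a → a < 9 → TopInner (vt ℓ a)
      topInner-V refl a> a< = subst₂ (λ k a → T ((k =ᵏ top) ∧ (3 <ᵇ a)))
        (sym (K-vt (s≤s z≤n) refl a<)) (sym (idx-vt (s≤s z≤n) refl a<)) (<⇒<ᵇ a>)

      f-topInner : ∀ {y} → TopInner y → Core y → TopInner (f y)
      f-topInner {y} t core = decide (core-cases y core)
        where
        k≡ : K y ≡ top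
        k≡ = =ᵏ⇒≡ _ _ (proj₁ (∧⁻ {K y =ᵏ top} t))
        decide : idx y < 4 ⊎ OnWheel y → TopInner (f y)
        decide (inj₁ a<) = contradiction a< (<⇒≱ (s≤s (<ᵇ⇒< 3 _ (proj₂ (∧⁻ {K y =ᵏ top} t)))))
        decide (inj₂ on) = decide′ (onWheel-cases y on)
          where
          decide′ : (∃ λ u → y ≡ hubV u) ⊎ (∃ λ u → ∃ λ j → y ≡ rimV u j) → TopInner (f y)
          decide′ (inj₁ (hubT , refl))       = subst TopInner (sym f-h)
            (topInner-V refl (≤ᵇ⇒≤ 4 8 tt) (≤ᵇ⇒≤ 9 9 tt))
          decide′ (inj₁ (hubB i , refl))     = contradiction (trans (sym k≡) (K-hub (hubB i))) λ ()
          decide′ (inj₂ (hubT , j , refl))   = subst TopInner (sym (f-t j))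
            (topInner-V refl (s≤s (s≤s (s≤s (s≤s z≤n)))) (rimIdx< hubT (ρ hubT j)))
          decide′ (inj₂ (hubB i , j , refl)) = contradiction (trans (sym k≡) (K-rim (hubB i) j)) λ ()

      -- Non-adjacent vertices on a common face of H have non-adjacent images.

      Seen : V → Fin 22 → Set
      Seen x φ = (∃ λ c → c ∈ HH.R x × leftH m x c ≡ φ) ⊎ (¬ Core x × isoFace ≡ φ)

      core-code : ∀ x {c} → c ∈ HH.R x → Core x
      core-code x c∈ = nonempty c∈
        where
        nonempty : ∀ {c : Code} {cs} → c ∈ cs → T (not (null cs))
        nonempty (here _)  = tt
        nonempty (there _) = tt

      code-core : ∀ x → Core x → ∃ λ c → c ∈ HH.R x
      code-core x = first (HH.R x)
        where
        first : ∀ cs → T (not (null cs)) → ∃ λ c → c ∈ cs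
        first (c ∷ _) _ = c , here refl

      seen : ∀ {x φ} → FaceStructure._LiesOn_ (Embedded.faces (embeddedH m)) x φ → Seen x φ
      seen {x} {φ} (inj₁ (y , xy , eq)) = decide (HH.edge⁻ xy)
        where
        decide : (∃ λ c → c ∈ HH.R x × y ≡ go x c) → Seen x φ
        decide (c , c∈ , y≡) = inj₁ (c , c∈ ,
          trans (cong (leftH m x) (sym (trans (cong (HH.code x) y≡) (HH.code-go {x} c∈)))) eq)
      seen {x} (inj₂ (iso , eq)) = inj₂ ((λ t → let c , c∈ = code-core x t in iso (go x c) (HH.edge⁺ c∈)) , eq)

      isoFace⇒topInner : ∀ {y c} → c ∈ HH.R y → leftH m y c ≡ isoFace → TopInner y
      isoFace⇒topInner {y} {c} c∈ eq = ⇒⁻ {pos (TH.faceCode (K y) (idx y) c) ≡ᵇ 1}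
        (HH.code-check {isoFaceOf?} isoFaceOf {y} c∈)
        (≡⇒≡ᵇ _ _ (trans (sym (toℕ-left m {y} c∈)) (trans (cong toℕ eq) (toℕ-face (s≤s (s≤s z≤n))))))

      -- An isolated vertex shares its face only with h, t₀ and t₁. Their images are again among h
      -- and the t_i, next to which nothing is stacked in G, while `f x` is a stacked vertex by
      -- `f-core⁻`.
      isolated-core : ∀ {x y φ} → Seen x φ → Seen y φ → ¬ Core x → Core y → ¬ f y ~ᴳ f x
      isolated-core {x} (inj₁ (_ , c∈ , _)) _ ¬core _ _ = ¬core (core-code x c∈)
      isolated-core (inj₂ _) (inj₂ (¬core , _)) _ core _ = ¬core core
      isolated-core {x} {y} (inj₂ (_ , refl)) (inj₁ (c , c∈ , eq)) ¬core core fyx =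
        ¬core (f-core⁻ (topInner-saturated {f y} {f x}
          (f-topInner {y} (isoFace⇒topInner {y} c∈ eq) core) fyx))

      shared : ∀ {x y φ} → Seen x φ → Seen y φ → Core x → Core y →
        T (shares (K x) (idx x) (K y) (idx y))
      shared (inj₂ (¬core , _)) _ core _ = contradiction core ¬core
      shared (inj₁ _) (inj₂ (¬core , _)) _ core = contradiction core ¬core
      shared {x} {y} (inj₁ (c , c∈ , eq)) (inj₁ (d , d∈ , eq′)) _ _ =
        any-T (λ c → any (λ d → pos (TH.faceCode (K x) (idx x) c) ≡ᵇ pos
          (TH.faceCode (K y) (idx y) d)) (HH.R y)) c∈
          (any-T (λ d → pos (TH.faceCode (K x) (idx x) c) ≡ᵇ pos (TH.faceCode (K y) (idx y) d)) d∈
            (≡⇒≡ᵇ _ _ (trans (sym (toℕ-left m {x} c∈))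
              (trans (cong toℕ (trans eq (sym eq′))) (toℕ-left m {y} d∈)))))

      too-steep : ∀ {x y} → Core x → Core y → 2 + Λ x < Λ y → ¬ f x ~ᴳ f y
      too-steep {x} {y} cx cy lt fxy =
        <⇒≱ lt (subst₂ (λ a b → b ≤ 2 + a) (Λ-f x cx) (Λ-f y cy) (Λ-slope fxy))

      adjacent-at : ∀ {x y c} → c ∈ HH.R x → lev y ≡ move c (lev x) → idx y ≡ pos c → x ~ᴴ y
      adjacent-at {x} {y} c∈ l a = subst (x ~ᴴ_) (place-unique l a) (HH.edge⁺ c∈)

      s-ring : ∀ i → lev (f (col 0 i)) ≡ 0 × idx (f (col 0 i)) < 4
      s-ring i = Λ-ring (Λ-f-col i (s≤s z≤n))

      s : Fin 4 → Fin 4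
      s i = fromℕ< (proj₂ (s-ring i))

      f-r : ∀ i → f (col 0 i) ≡ col 0 (s i)
      f-r i = sym (place-unique (proj₁ (s-ring i)) (sym (toℕ-fromℕ< (proj₂ (s-ring i)))))

      s-injective : ∀ {i j} → s i ≡ s j → i ≡ j
      s-injective {i} {j} eq = toℕ-injective (trans (sym (idx-col i (s≤s z≤n)))
        (trans (cong idx (f-inj (trans (f-r i) (trans (cong (col 0) eq) (sym (f-r j))))))
          (idx-col j (s≤s z≤n))))

      top-code : ∀ {a c} → a < 9 → c ∈ TG.rot top a → move c 0 ≡ 0 → c ≡ • pos c
      top-code {a} {• b} _ _ _ = refl
      -- As `pred 0` is 0, an upward code would not be refuted by its level; the top rows contain
      -- none.
      top-code {a} {↑ b} a< c∈ _ = ⊥-elim (all-∈ {p = TG.entry-ok? top a}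
        (all-< {λ a → all (TG.entry-ok? top a) (TG.rot top a)}
          (all-kinds {λ k → below? (size k) λ a → all (TG.entry-ok? k a) (TG.rot k a)}
            (Checked.entries checkedG) top) a<) c∈)

      top-adjacent : ∀ j {y} → rimV hubT j ~ᴳ y → lev y ≡ 0 → (• idx y) ∈ TG.rot top (rimIdx hubT j)
      top-adjacent j ty l =
        let c , c∈ , l′ , a = edgeᴳ⁻ (s≤s z≤n) refl (rimIdx< hubT j) ty
        in subst (_∈ TG.rot top (rimIdx hubT j))
              (trans (top-code (rimIdx< hubT j) c∈ (trans (sym l′) l)) (cong •_ (sym a))) c∈

      g : Fin 4 → Fin 4
      g = ρ hubT

      g-rim : ∀ i j → f (rimV hubT i) ~ᴳ f (rimV hubT j) → T (tt? (g i) (g j))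
      g-rim i j tt′ = subst (λ a → T ((• a) ∈? TG.rot top (rimIdx hubT (g i)))) (idx-rim hubT (g j))
        (∈⇒∈? (top-adjacent (g i) (subst₂ _~ᴳ_ (f-t i) (f-t j) tt′) (lev-rim hubT (g j))))

      g-ring : ∀ i j → f (rimV hubT i) ~ᴳ f (col 0 j) → T (tr? (g i) (s j))
      g-ring i j tr′ = subst (λ a → T ((• a) ∈? TG.rot top (rimIdx hubT (g i))))
        (idx-col (s j) (s≤s z≤n))
        (∈⇒∈? (top-adjacent (g i) (subst₂ _~ᴳ_ (f-t i) (f-r j) tr′) (lev-col (s j) (s≤s z≤n))))

      lockEdge : rimV hubT (# 3) ~ᴴ col 0 (# 0)
      lockEdge = edgeᴴ (s≤s z≤n) refl (rimIdx< hubT (# 3)) {• 0} (there-lock lockH)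
        where
        there-lock : Valid ((• 0) ∈? TH.rot top 7) → (• 0) ∈ TH.rot top 7
        there-lock (valid t) = ∈?⇒∈ (TH.rot top 7) t

      locked : ¬ T (tr? (g (# 1)) (s (# 0))) × ¬ T (tr? (g (# 2)) (s (# 0)))
        × ¬ T (tr? (g (# 2)) (s (# 1))) ×
               ¬ T (tr? (g (# 3)) (s (# 2))) × ¬ T (tr? (g (# 0)) (s (# 3)))
      locked = lock (g (# 0)) (g (# 1)) (rim (# 0) (# 1) (rimEdge hubT (# 0)))
        (g (# 2)) (rim (# 1) (# 2) (rimEdge hubT (# 1))) (g≢ {# 0} {# 2} λ ())
        (g (# 3)) (rim (# 2) (# 3) (rimEdge hubT (# 2))) (rim (# 3) (# 0) (rimEdge hubT (# 3)))
          (g≢ {# 1} {# 3} λ ())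
        (s (# 0)) (spine (# 0)) (g-ring (# 3) (# 0) (hom lockEdge))
        (s (# 1)) (spine (# 1)) (s≢ λ ())
        (s (# 2)) (spine (# 2)) (s≢ λ ()) (s≢ λ ())
        (s (# 3)) (spine (# 3)) (s≢ λ ()) (s≢ λ ()) (s≢ λ ())
        where
        rim : ∀ i j → rimV hubT i ~ᴴ rimV hubT j → T (tt? (g i) (g j))
        rim i j e = g-rim i j (hom e)
        spine : ∀ i → T (tr? (g i) (s i))
        spine i = g-ring i i (hom (topEdge i))
        g≢ : ∀ {i j} → i ≢ j → g i ≢ g j
        g≢ i≢j eq = i≢j (ρ-injective hubT eq)
        s≢ : ∀ {i j} → i ≢ j → s i ≢ s j
        s≢ i≢j eq = i≢j (s-injective eq)

      lock-separated : ∀ {j i} → (j , i) ∈ lockPairs → ¬ f (rimV hubT j) ~ᴳ f (col 0 i)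
      lock-separated {j} {i} p = pick p locked ∘ g-ring j i
        where
        pick : ∀ {j i} → (j , i) ∈ lockPairs →
          ¬ T (tr? (g (# 1)) (s (# 0))) × ¬ T (tr? (g (# 2)) (s (# 0)))
            × ¬ T (tr? (g (# 2)) (s (# 1))) ×
          ¬ T (tr? (g (# 3)) (s (# 2))) × ¬ T (tr? (g (# 0)) (s (# 3))) → ¬ T (tr? (g j) (s i))
        pick (here refl)                                 (a , _)             = a
        pick (there (here refl))                         (_ , a , _)         = a
        pick (there (there (here refl)))                 (_ , _ , a , _)     = a
        pick (there (there (there (here refl))))         (_ , _ , _ , a , _) = a
        pick (there (there (there (there (here refl))))) (_ , _ , _ , _ , a) = a

      locked-separated : ∀ {x y} → lev x ≡ lev y → T (locked? (K x) (idx x) (idx y)) → ¬ f x ~ᴳ f y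
      locked-separated {x} {y} l t =
        let k≡ , t′ = ∧⁻ {K x =ᵏ top} t
            (j , i) , p , eqs = any-∃ (λ (j , i) → (idx x ≡ᵇ rimIdx hubT j) ∧ (idx y ≡ᵇ toℕ i))
              lockPairs t′
            a , b = ∧⁻ {idx x ≡ᵇ rimIdx hubT j} eqs
            lx = top⇒0 (lev x) (=ᵏ⇒≡ _ _ k≡)
        in subst₂ (λ u w → ¬ f u ~ᴳ f w)
             (place-unique lx (≡ᵇ⇒≡ _ _ a)) (place-unique (trans (sym l) lx) (≡ᵇ⇒≡ _ _ b))
               (lock-separated p)

      opposite-separated : ∀ {x y} → lev x ≡ lev y → T (oppositeRims? (K x) (idx x) (idx y)) →
        ¬ f x ~ᴳ f y
      opposite-separated {x} {y} l t =
        let u , _ , t₁ = any-∃ (λ u → (K x =ᵏ hubKind u) ∧ any (λ j → (idx x ≡ᵇ rimIdx u j) ∧ (idx y ≡ᵇ rimIdx u (cyclic (cyclic j)))) (allFin 4)) hubs t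
            k≡ , t₂ = ∧⁻ {K x =ᵏ hubKind u} t₁
            j , _ , eqs = any-∃ (λ j → (idx x ≡ᵇ rimIdx u j)
              ∧ (idx y ≡ᵇ rimIdx u (cyclic (cyclic j)))) (allFin 4) t₂
            a , b = ∧⁻ {idx x ≡ᵇ rimIdx u j} eqs
            lx = level-hub u x (=ᵏ⇒≡ _ _ k≡)
        in subst₂ (λ u w → ¬ f u ~ᴳ f w)
             (place-unique lx (≡ᵇ⇒≡ _ _ a)) (place-unique (trans (sym l) lx) (≡ᵇ⇒≡ _ _ b))
               (opposite u j)

      sym-≁ : ∀ {x y} → ¬ f y ~ᴳ f x → ¬ f x ~ᴳ f y
      sym-≁ ¬yx xy = ¬yx (~ᴳ-sym xy)

      same-level : ∀ {x y} → Core x → Core y → x ≢ y → ¬ x ~ᴴ y → lev y ≡ lev x →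
                   T (shares (K x) (idx x) (K y) (idx y)) → ¬ f x ~ᴳ f y
      same-level {x} {y} cx cy x≢y x≁y l sh =
        ∨-elim {a ≡ᵇ b} (⇒⁻ {shares k a k b} check (subst (λ k′ → T (shares k a k′ b)) ky sh))
          (λ t → contradiction (coords-unique (sym l) (≡ᵇ⇒≡ a b t)) x≢y) λ t →
        ∨-elim {(• b) ∈? TH.rot k a} t
          (λ t → contradiction (adjacent-at {x} {y} {• b} (∈?⇒∈ (TH.rot k a) t) l refl) x≁y) λ t →
        ∨-elim {2 + weight k a <ᵇ weight k b} t
          (λ t → too-steep cx cy (subst (2 + Λ x <_) (sym Λy) (steep t))) λ t →
        ∨-elim {2 + weight k b <ᵇ weight k a} t
          (λ t → sym-≁ (too-steep cy cx (subst (λ w → 2 + w < Λ x) (sym Λy) (steep t)))) λ t →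
        ∨-elim {oppositeRims? k a b} t (opposite-separated (sym l)) λ t →
        ∨-elim {locked? k a b} t (locked-separated (sym l)) λ t →
        sym-≁ (locked-separated l (subst (λ k → T (locked? k b a)) (sym ky) t))
        where
        k = K x
        a = idx x
        b = idx y
        ky : K y ≡ k
        ky = cong (kind m) l
        check : T (sameLevel? k a b)
        check = all-< {sameLevel? k a}
          (GG.vertex-check {λ k a → below? (size k) (sameLevel? k a)} sameLevel x)
          (subst (λ k → b < size k) ky (idx< y))
        Λy : Λ y ≡ 2 * lev x + weight k b
        Λy = cong₂ (λ l k → 2 * l + weight k b) l ky
        steep : ∀ {v w} → T (2 + v <ᵇ w) → 2 + (2 * lev x + v) < 2 * lev x + w
        steep {v} {w} t = subst (_< 2 * lev x + w)
          (solve 2 (λ l v → l :+ (con 2 :+ v) := con 2 :+ (l :+ v)) refl (2 * lev x) v)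
          (+-monoʳ-< (2 * lev x) (<ᵇ⇒< (2 + v) w t))
          where open +-*-Solver

      not-bot : ∀ {x y} → lev x < lev y → K x ≢ bot
      not-bot {x} {y} lt eq =
        <⇒≱ lt (subst (lev y ≤_) (sym (bot⇒B (lev x) (lev< x) eq)) (s≤s⁻¹ (lev< y)))

      next-level : ∀ {x y} → Core x → Core y → ¬ x ~ᴴ y → lev y ≡ suc (lev x) →
                   T (shares (K x) (idx x) (K y) (idx y)) → ¬ f x ~ᴳ f y
      next-level {x} {y} cx cy x≁y l sh =
        ∨-elim {K x =ᵏ bot} check (λ t → contradiction (=ᵏ⇒≡ _ _ t) k≢bot) λ t →
        ∨-elim {(↓ idx y) ∈? TH.rot (K x) (idx x)} (⇒⁻ {shares (K x) (idx x) (K y) (idx y)} t sh)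
          (λ t → contradiction (adjacent-at {x} {y} {↓ idx y} (∈?⇒∈ (HH.R x) t) l refl) x≁y)
          (λ t → too-steep cx cy (steep t))
        where
        k≢bot : K x ≢ bot
        k≢bot = not-bot {x} {y} (≤-reflexive (sym l))
        down : ∀ k → k ≢ bot → T (allowed k (↓ 0))
        down top _ = tt
        down mid _ = tt
        down bot b = b refl
        K∈ : K y ∈ nbrKinds (K x) (↓ 0)
        K∈ = subst (_∈ nbrKinds (K x) (↓ 0)) (cong (kind m) (sym l))
          (proj₂ (move-valid m (↓ 0) (lev< x) (down (K x) k≢bot)))
        check : T (nextLevel? (K x) (idx x) (K y) (idx y))
        check = all-< {nextLevel? (K x) (idx x) (K y)}
          (all-∈ {p = nextLevels? (K x) (idx x)} {nbrKinds (K x) (↓ 0)}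
                  (GG.vertex-check {λ k a → all (nextLevels? k a) (nbrKinds k (↓ 0))} nextLevel x) K∈)
                    (idx< y)
        steep : T (weight (K x) (idx x) <ᵇ weight (K y) (idx y)) → 2 + Λ x < Λ y
        steep t = begin-strict
          2 + (2 * lev x + weight (K x) (idx x))  <⟨ +-monoʳ-< 2 (+-monoʳ-< (2 * lev x) (<ᵇ⇒< _ _ t))
            ⟩
          2 + (2 * lev x + weight (K y) (idx y))
            ≡⟨ solve 2 (λ l w → con 2 :+ (con 2 :* l :+ w) := con 2 :* (con 1 :+ l) :+ w)
                                                       refl (lev x) (weight (K y) (idx y)) ⟩
          2 * suc (lev x) + weight (K y) (idx y)
            ≡⟨ cong (λ l → 2 * l + weight (K y) (idx y)) (sym l) ⟩
          Λ y                                     ∎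
          where
          open ≤-Reasoning
          open +-*-Solver

      -- This pair needs no common face: preserved `Λ` values already differ by at least 4.
      far-level : ∀ {x y} → Core x → Core y → 2 + lev x ≤ lev y → ¬ f x ~ᴳ f y
      far-level {x} {y} cx cy l = too-steep cx cy (begin-strict
        2 + (2 * lev x + weight (K x) (idx x))       ≤⟨ +-monoʳ-≤ 2 (+-monoʳ-≤ (2 * lev x) wx) ⟩
        2 + (2 * lev x + 4)                          <⟨ n<1+n _ ⟩
        3 + (2 * lev x + 4)                          ≤⟨ n≤1+n _ ⟩
        4 + (2 * lev x + 4)
          ≡⟨ solve 1 (λ l → con 4 :+ (con 2 :* l :+ con 4) := con 2 :* (con 2 :+ l) :+ con 4) refl
          (lev x) ⟩
        2 * (2 + lev x) + 4                          ≤⟨ +-mono-≤ (*-monoʳ-≤ 2 l) wy ⟩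
        Λ y                                          ∎)
        where
        open ≤-Reasoning
        open +-*-Solver
        wx : weight (K x) (idx x) ≤ 4
        wx = ∨-elim {K x =ᵏ bot} (⇒⁻ {core? (K x) (idx x)} (GG.vertex-check {lower?} lower x) cx)
          (λ t → contradiction (=ᵏ⇒≡ _ _ t) (not-bot {x} {y} (≤-trans (n≤1+n _) l))) (≤ᵇ⇒≤ _ _)
        wy : 4 ≤ weight (K y) (idx y)
        wy = ∨-elim {K y =ᵏ top} (⇒⁻ {core? (K y) (idx y)} (GG.vertex-check {upper?} upper y) cy)
          (λ t → contradiction (subst (2 + lev x ≤_) (top⇒0 (lev y) (=ᵏ⇒≡ _ _ t)) l) λ ()) (≤ᵇ⇒≤ _ _)

      ordered : ∀ {x y} → Core x → Core y → x ≢ y → ¬ x ~ᴴ y → lev x ≤ lev y →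
                T (shares (K x) (idx x) (K y) (idx y)) → ¬ f x ~ᴳ f y
      ordered {x} {y} cx cy x≢y x≁y x≤y sh with lev y ≟ lev x
      ... | yes eq = same-level cx cy x≢y x≁y eq sh
      ... | no neq with lev y ≟ suc (lev x)
      ... | yes eq = next-level cx cy x≁y eq sh
      ... | no neq′ = far-level cx cy (≤∧≢⇒< (≤∧≢⇒< x≤y (neq ∘ sym)) (neq′ ∘ sym))

      -- Two isolated vertices remain stacked and hence independent; one isolated vertex is handled
      -- by `isolated-core`; for two core vertices the difference of levels decides.
      separated : ∀ {x y} → x ≢ y → ¬ x ~ᴴ y →
                  FaceStructure.OnCommonFace (Embedded.faces (embeddedH m)) x y → ¬ f x ~ᴳ f y
      separated {x} {y} x≢y x≁y (φ , lx , ly) = decide (side _) (side _)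
        where
        decide : Side (core? (K x) (idx x)) → Side (core? (K y) (idx y)) → ¬ f x ~ᴳ f y
        decide (fails ¬cx) (fails ¬cy) fxy = isolated (isolated-independent fxy)
          where
          isolated : Core (f x) ⊎ Core (f y) → ⊥
          isolated (inj₁ c) = ¬cx (f-core⁻ c)
          isolated (inj₂ c) = ¬cy (f-core⁻ c)
        decide (fails ¬cx) (holds cy) = sym-≁ (isolated-core (seen lx) (seen ly) ¬cx cy)
        decide (holds cx) (fails ¬cy) = isolated-core (seen ly) (seen lx) ¬cy cx
        decide (holds cx) (holds cy) = levelwise (≤-total (lev x) (lev y))
          where
          levelwise : lev x ≤ lev y ⊎ lev y ≤ lev x → ¬ f x ~ᴳ f y
          levelwise (inj₁ le) = ordered cx cy x≢y x≁y le (shared (seen lx) (seen ly) cx cy)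
          levelwise (inj₂ le) =
            sym-≁ (ordered cy cx (x≢y ∘ sym) (x≁y ∘ HH.~-sym {y}) le
            (shared (seen ly) (seen lx) cy cx))

-- Saturation of H and the resulting bound for the family.

open import Data.Fin.Permutation using (↔⇒≡)
open import Data.Fin.Properties using (any?)
open import Data.Nat.Base using (ℕ; suc; _+_; _*_; _≤_)
open import Data.Nat.Properties
  using (+-cancelˡ-≡; *-cancelʳ-≡; suc-injective; *-monoʳ-≤; ≤-trans; ≤-reflexive)
open import Data.Nat.Solver using (module +-*-Solver)
open import Relation.Binary.PropositionalEquality using (_≡_; _≢_; refl; trans; cong; sym)
open Counting
open Search using (saturationNumber≤; liesOn?)
open Rotation using (module Embedded)
open Strip
open Tables
open Wheels using (module TG; module TH)
open Sparse using (planeH; embeddedH; leftH; isoFace; e≡H)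
open Triangulation using (module G; n≡; maximalPlanarG)
open Rigid using (module Geometry)

-- G and H have the same vertices and read codes in the same way, so inclusion of rows makes the
-- identity an embedding of H in G.
subtable? : Kind → ℕ → Code → Bool
subtable? k a c = c ∈? TG.rot k a

subtable : Valid (TH.forVertices λ k a → all (subtable? k a) (TH.rot k a))
subtable = valid tt

module _ (m : ℕ) where
  open Geometry m

  H⊆G : ∀ {x y} → x ~ᴴ y → x ~ᴳ y
  H⊆G {x} xy = decide (HH.edge⁻ xy)
    where
    decide : ∀ {y} → (∃ λ c → c ∈ HH.R x × y ≡ go x c) → x ~ᴳ y
    decide (c , c∈ , refl) = GG.edge⁺ {x} {c}
      (∈?⇒∈ (GG.R x) (HH.code-check {subtable?} subtable {x} c∈))

  saturatedH : PlaneSaturated (planeH m) GG.graph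
  saturatedH = record
    { spanning  = refl
    ; subgraph  = id , id , λ {x} {y} → H⊆G {x} {y}
    ; saturated = λ x y x≢y x≁y → decide x y x≢y x≁y (common? x y)
    }
    where
    Common : V → V → Set
    Common = FaceStructure.OnCommonFace (Embedded.faces (embeddedH m))
    -- Saturation asks for a disjunction, so it has to be decided which half is to be proved.
    common? : ∀ x y → Dec (Common x y)
    common? x y = any? λ φ → lies? x φ ×-dec lies? y φ
      where
      lies? = liesOn? (Graph.adj HH.graph) (λ x y → leftH m x (HH.code x y)) (λ _ → isoFace)
    decide : ∀ x y (x≢y : x ≢ y) → ¬ x ~ᴴ y → Dec (Common x y) →
             ¬ Common x y ⊎ ¬ (addEdge HH.graph x y x≢y ⊑ GG.graph)
    decide x y x≢y x≁y (no ¬common) = inj₁ ¬common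
    decide x y x≢y x≁y (yes common) = inj₂ λ (f , inj , hom) →
      separated f inj (λ {u} {w} uw → hom (addEdge-old HH.graph x≢y x≁y {u} {w} uw))
        x≢y x≁y common (hom (addEdge-new HH.graph x≢y x≁y))

theorem1p4 : Σ[ 𝒢 ∈ (ℕ → Graph) ]
    (∀ i j → 𝒢 i ≅ 𝒢 j → i ≡ j) ×
    (∀ i → MaximalPlanar (𝒢 i) ×
    (∃[ m ] IsPlaneSaturationNumber (𝒢 i) m × 3 * m ≤ Graph.v (𝒢 i) + 82))
theorem1p4 = 𝒢 , distinct-orders , λ i → maximalPlanarG i , bound i
  where
  𝒢 : ℕ → Graph
  𝒢 = G.graph
  distinct-orders : ∀ i j → 𝒢 i ≅ 𝒢 j → i ≡ j
  -- Isomorphic members have equal order, and 65 + 12 (i + 1) determines i.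
  distinct-orders i j (iso , _) = suc-injective (*-cancelʳ-≡ (suc i) (suc j) 12
    (+-cancelˡ-≡ 65 _ _ (trans (sym (n≡ i)) (trans (↔⇒≡ iso) (n≡ j)))))
  bound : ∀ i → ∃[ m ] IsPlaneSaturationNumber (𝒢 i) m × 3 * m ≤ Graph.v (𝒢 i) + 82
  bound i =
    let m , sat , m≤e = saturationNumber≤ (𝒢 i) (planeH i) (saturatedH i) in
    m , sat , ≤-trans (*-monoʳ-≤ 3 (≤-trans m≤e (≤-reflexive (e≡H i))))
                      (≤-reflexive (trans (count (suc i)) (cong (_+ 82) (sym (n≡ i)))))
    where
    open +-*-Solver
    count : ∀ k → 3 * (49 + k * 4) ≡ 65 + k * 12 + 82
    count = solve 1 (λ k → con 3 :* (con 49 :+ k :* con 4) := con 65 :+ k :* con 12 :+ con 82) refl
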